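{- Let $\lambda$ be a partition and $T\in\mathcal{KN}(\lambda,n)$. For each length $\ell$ of a column of $T$, let $C_\ell$ be the rightmost column of any KN skew tableau $S$ which has the same number of columns of each length as $T$, whose rightmost column has length $\ell$, whose column reading is a frank word and which rectifies to $T$. Then the tableau $K_+(T)$ of shape $\lambda$ obtained from $T$ by replacing each column of length $\ell$ by $r(C_\ell)$ is a key tableau.
   Context: Fix $n\ge1$; $[\pm n]=\{1,\dots,n,\overline n,\dots,\overline 1\}$ ($\overline i=-i$) with order $1<\dots<n<\overline n<\dots<\overline 1$. A column is a strictly increasing (top to bottom) sequence in $[\pm n]$; it is admissible if whenever $i,\overline i\in C$, with $i$ in row $a$ from the top and $\overline i$ in row $b$ from the bottom, $a+b\le i$. For admissible $C$, let $z_1>\dots>z_r$ be the $z\in[n]$ with $z,\overline z\in C$; $t_1$ is the greatest $t\in[n]$ with $t<z_1$, $t,\overline t\notin C$, and $t_k$ ($k\ge2$) the greatest $t\in[n]$ with $t<\min(t_{k-1},z_k)$, $t,\overline t\notin C$. $rC$ is obtained by replacing each $\overline{z_k}$ by $\overline{t_k}$ and reordering; $\ell C$ by replacing each $z_k$ by $t_k$ and reordering. A KN skew tableau is a semistandard skew tableau (rows weakly, columns strictly increasing) with admissible columns such that replacing each column $C$ by $\ell C\,rC$ gives a semistandard skew tableau; $\mathcal{KN}(\lambda,n)$ is the set of those of partition shape $\lambda$. The column reading $cr(T)$ reads columns right to left, each top to bottom. Knuth equivalence $\sim$ is the congruence on words generated by: (K1) $\gamma\beta\alpha\sim\beta\gamma\alpha$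 if $\gamma<\alpha\le\beta$, $(\beta,\gamma)\ne(\overline x,x)$; (K2) $\alpha\beta\gamma\sim\alpha\gamma\beta$ if $\gamma\le\alpha<\beta$, $(\beta,\gamma)\ne(\overline x,x)$; (K3) $(y+1)\overline{y+1}\beta\sim\overline y y\beta$ if $y<\beta<\overline y$, $y\in[n-1]$; (K4) $\beta\overline y y\sim\beta(y+1)\overline{y+1}$ if $y<\beta<\overline y$, $y\in[n-1]$; (K5) $w\sim w\setminus\{z,\overline z\}$ if $w$ is a strictly increasing non-admissible word all of whose proper factors are admissible columns and $z$ is the least $z\in[n]$ with $z,\overline z\in w$ and more than $z$ letters of $w$ of absolute value $\le z$. Each word $w$ is Knuth equivalent to the reading of a unique KN tableau $P(w)$ of partition shape; $S$ rectifies to $T$ if $P(cr(S))=T$. The columns of a word are its maximal strictly increasing factors; $w$ is frank if the multiset of its column lengths equals the multiset of column lengths of $P(w)$. (Such skew tableaux $S$ exist, and $C_\ell$ depends only on $\ell$.) A key tableau is a KN tableau of partition shape in which the entry set of each column contains the entry set of the next column to its right, and no $i\in[n]$ has both $i$ and $\overline i$ occurring as entries. -}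

module Defs where

open import Data.Nat using (ℕ; zero; suc; _+_; _∸_; _≤_; _<_; _<ᵇ_; _≡ᵇ_; _⊓_; _≤?_)
open import Data.Bool using (Bool; true; false; not; _∧_; if_then_else_)
open import Data.List using (List; []; _∷_; _++_; length; map; concat; concatMap; reverse; foldr; filter)
open import Data.List.Membership.Propositional using (_∈_)
open import Data.List.Relation.Unary.All using (All)
open import Data.List.Relation.Unary.Linked using (Linked)
open import Data.List.Relation.Binary.Permutation.Propositional using (_↭_)
open import Data.Maybe using (Maybe; just; nothing)
open import Data.Product using (Σ; ∃; _×_; _,_; proj₁; proj₂)
open import Data.Sum using (_⊎_)
open import Data.Empty using (⊥)
open import Relation.Nullary using (¬_)
open import Relation.Binary.PropositionalEquality using (_≡_)
open import Relation.Binary.Construct.Closure.Equivalence using (EqClosure)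

-- Letters of [±n]:  pos i  is  i,  bar i  is  \overline{i}.
-- Order: 1 < ... < n < bar n < ... < bar 1.

data L : Set where
  pos : ℕ → L
  bar : ℕ → L

Word : Set
Word = List L

ValidL : ℕ → L → Set
ValidL n (pos i) = 1 ≤ i × i ≤ n
ValidL n (bar i) = 1 ≤ i × i ≤ n

ValidW : ℕ → Word → Set
ValidW n w = All (ValidL n) w

∣_∣ᴸ : L → ℕ
∣ pos i ∣ᴸ = i
∣ bar i ∣ᴸ = i

data _<ᴸ_ : L → L → Set where
  pp : ∀ {i j} → i < j → pos i <ᴸ pos j
  pb : ∀ {i j} → pos i <ᴸ bar j
  bb : ∀ {i j} → j < i → bar i <ᴸ bar j

_≤ᴸ_ : L → L → Set
x ≤ᴸ y = x <ᴸ y ⊎ x ≡ y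

ltb : L → L → Bool
ltb (pos i) (pos j) = i <ᵇ j
ltb (pos i) (bar j) = true
ltb (bar i) (pos j) = false
ltb (bar i) (bar j) = j <ᵇ i

eqb : L → L → Bool
eqb (pos i) (pos j) = i ≡ᵇ j
eqb (bar i) (bar j) = i ≡ᵇ j
eqb _ _ = false

inb : L → Word → Bool
inb x [] = false
inb x (y ∷ ys) = if eqb x y then true else inb x ys

insertᴸ : L → Word → Word
insertᴸ x [] = x ∷ []
insertᴸ x (y ∷ ys) = if ltb y x then y ∷ insertᴸ x ys else x ∷ y ∷ ys

sortᴸ : Word → Word
sortᴸ = foldr insertᴸ []

StrictInc : Word → Set
StrictInc = Linked _<ᴸ_

At : Word → ℕ → L → Set
At [] k y = ⊥
At (x ∷ xs) zero y = x ≡ y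
At (x ∷ xs) (suc k) y = At xs k y

-- Admissible column: strictly increasing, and whenever i (0-based index a,
-- i.e. row a+1 from the top) and bar i (0-based index b, i.e. row
-- length C ∸ b from the bottom) both occur, (a+1) + (length C ∸ b) ≤ i.
Admissible : Word → Set
Admissible C = StrictInc C ×
  (∀ i a b → At C a (pos i) → At C b (bar i) → suc a + (length C ∸ b) ≤ i)

-- greatest t with 1 ≤ t < m and t, bar t ∉ C  (0 if none)
freeb : Word → ℕ → Bool
freeb C t = not (inb (pos t) C) ∧ not (inb (bar t) C)

gfb : Word → ℕ → ℕ
gfb C zero = 0
gfb C (suc zero) = 0
gfb C (suc (suc k)) = if freeb C (suc k) then suc k else gfb C (suc k)

-- z_1 > ... > z_r : the z with z, bar z ∈ C
zsOf : Word → List ℕ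
zsOf C = reverse (go C)
  where
  go : Word → List ℕ
  go [] = []
  go (pos z ∷ xs) = if inb (bar z) C then z ∷ go xs else go xs
  go (bar z ∷ xs) = go xs

tsFrom : Word → ℕ → List ℕ → List ℕ
tsFrom C prev [] = []
tsFrom C prev (z ∷ zs) = gfb C (prev ⊓ z) ∷ tsFrom C (gfb C (prev ⊓ z)) zs

tsOf : Word → List ℕ
tsOf C with zsOf C
... | [] = []
... | z ∷ zs = tsFrom C z (z ∷ zs)

zipℕ : List ℕ → List ℕ → List (ℕ × ℕ)
zipℕ (a ∷ as) (b ∷ bs) = (a , b) ∷ zipℕ as bs
zipℕ _ _ = []

lookupPair : ℕ → List (ℕ × ℕ) → Maybe ℕ
lookupPair z [] = nothing
lookupPair z ((a , b) ∷ ps) = if z ≡ᵇ a then just b else lookupPair z ps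

replBar : List (ℕ × ℕ) → L → L
replBar ps (pos i) = pos i
replBar ps (bar i) with lookupPair i ps
... | just t = bar t
... | nothing = bar i

replPos : List (ℕ × ℕ) → L → L
replPos ps (bar i) = bar i
replPos ps (pos i) with lookupPair i ps
... | just t = pos t
... | nothing = pos i

rCol : Word → Word
rCol C = sortᴸ (map (replBar (zipℕ (zsOf C) (tsOf C))) C)

lCol : Word → Word
lCol C = sortᴸ (map (replPos (zipℕ (zsOf C) (tsOf C))) C)

-- Skew tableaux: list of columns from left to right; each column is
-- (number of empty cells above it, entries top to bottom).

SkewTab : Set
SkewTab = List (ℕ × Word)

-- skew shape λ/μ with nonempty columns: μ' = offsets, λ' = bottoms,
-- both weakly decreasing.
SkewShape : SkewTab → Set
SkewShape S = All (λ c → 1 ≤ length (proj₂ c)) S ×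
  Linked (λ c d → proj₁ d ≤ proj₁ c × proj₁ d + length (proj₂ d) ≤ proj₁ c + length (proj₂ c)) S

RowsOK : (ℕ × Word) → (ℕ × Word) → Set
RowsOK (o₁ , c₁) (o₂ , c₂) = ∀ r x y → o₁ ≤ r → o₂ ≤ r →
  At c₁ (r ∸ o₁) x → At c₂ (r ∸ o₂) y → x ≤ᴸ y

SemiStd : SkewTab → Set
SemiStd S = SkewShape S × All (λ c → StrictInc (proj₂ c)) S × Linked RowsOK S

entries : SkewTab → Word
entries S = concat (map proj₂ S)

split : SkewTab → SkewTab
split = concatMap (λ c → (proj₁ c , lCol (proj₂ c)) ∷ (proj₁ c , rCol (proj₂ c)) ∷ [])

KNSkew : ℕ → SkewTab → Set
KNSkew n S = ValidW n (entries S) × SemiStd S ×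
  All (λ c → Admissible (proj₂ c)) S × SemiStd (split S)

cr : SkewTab → Word
cr S = concat (reverse (map proj₂ S))

lastCol : SkewTab → Word
lastCol [] = []
lastCol (c ∷ []) = proj₂ c
lastCol (c ∷ d ∷ S) = lastCol (d ∷ S)

-- Tableaux of partition shape: list of columns (left to right), top-aligned.

Tab : Set
Tab = List Word

asSkew : Tab → SkewTab
asSkew T = map (λ c → (0 , c)) T

PartitionShape : Tab → Set
PartitionShape T = All (λ c → 1 ≤ length c) T × Linked (λ c d → length d ≤ length c) T

-- T ∈ KN(λ, n) for λ the shape of T
KNTab : ℕ → Tab → Set
KNTab n T = PartitionShape T × KNSkew n (asSkew T)

crT : Tab → Word
crT T = concat (reverse T)

NotBarPair : L → L → Set
NotBarPair β γ = ¬ (Σ ℕ λ x → β ≡ bar x × γ ≡ pos x)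

countLe : ℕ → Word → ℕ
countLe z w = length (filter (λ x → ∣ x ∣ᴸ ≤? z) w)

BadZ : Word → ℕ → Set
BadZ w z = 1 ≤ z × pos z ∈ w × bar z ∈ w × z < countLe z w

MinBadZ : Word → ℕ → Set
MinBadZ w z = BadZ w z × (∀ z' → z' < z → ¬ BadZ w z')

removeZ : ℕ → Word → Word
removeZ z [] = []
removeZ z (x ∷ xs) = if eqb x (pos z) then removeZ z xs
  else (if eqb x (bar z) then removeZ z xs else x ∷ removeZ z xs)

data KStep (n : ℕ) : Word → Word → Set where
  k1 : ∀ {α β γ} → γ <ᴸ α → α ≤ᴸ β → NotBarPair β γ →
       KStep n (γ ∷ β ∷ α ∷ []) (β ∷ γ ∷ α ∷ [])
  k2 : ∀ {α β γ} → γ ≤ᴸ α → α <ᴸ β → NotBarPair β γ →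
       KStep n (α ∷ β ∷ γ ∷ []) (α ∷ γ ∷ β ∷ [])
  k3 : ∀ {y β} → 1 ≤ y → suc y ≤ n → pos y <ᴸ β → β <ᴸ bar y →
       KStep n (pos (suc y) ∷ bar (suc y) ∷ β ∷ []) (bar y ∷ pos y ∷ β ∷ [])
  k4 : ∀ {y β} → 1 ≤ y → suc y ≤ n → pos y <ᴸ β → β <ᴸ bar y →
       KStep n (β ∷ bar y ∷ pos y ∷ []) (β ∷ pos (suc y) ∷ bar (suc y) ∷ [])
  k5 : ∀ {w z} → StrictInc w → ¬ Admissible w →
       (∀ u x v → w ≡ u ++ x ++ v → length x < length w → Admissible x) →
       MinBadZ w z → KStep n w (removeZ z w)

data KCtx (n : ℕ) : Word → Word → Set where
  ctx : ∀ {x y} u v → KStep n x y → KCtx n (u ++ x ++ v) (u ++ y ++ v)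

_∼[_]_ : Word → ℕ → Word → Set
w ∼[ n ] w' = EqClosure (KCtx n) w w'

consRun : L → List Word → List Word
consRun x [] = (x ∷ []) ∷ []
consRun x ([] ∷ rs) = (x ∷ []) ∷ rs
consRun x ((y ∷ ys) ∷ rs) = if ltb x y then (x ∷ y ∷ ys) ∷ rs else (x ∷ []) ∷ (y ∷ ys) ∷ rs

runs : Word → List Word
runs [] = []
runs (x ∷ xs) = consRun x (runs xs)

-- P(w) is the (unique) KN tableau of partition shape Knuth equivalent to w
IsP : ℕ → Word → Tab → Set
IsP n w P = KNTab n P × w ∼[ n ] crT P

Frank : ℕ → Word → Set
Frank n w = Σ Tab λ P → IsP n w P × map length (runs w) ↭ map length P

RectifiesTo : ℕ → SkewTab → Tab → Set
RectifiesTo n S T = IsP n (cr S) T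

Admits : ℕ → Tab → ℕ → SkewTab → Set
Admits n T ℓ S = KNSkew n S ×
  map (λ c → length (proj₂ c)) S ↭ map length T ×
  length (lastCol S) ≡ ℓ ×
  Frank n (cr S) ×
  RectifiesTo n S T

-- K_+(T), given for each ℓ a choice of such S
Kplus : Tab → (ℕ → SkewTab) → Tab
Kplus T S = map (λ c → rCol (lastCol (S (length c)))) T

KeyTableau : ℕ → Tab → Set
KeyTableau n K = KNTab n K ×
  Linked (λ c d → ∀ x → x ∈ d → x ∈ c) K ×
  (∀ i → pos i ∈ concat K → bar i ∈ concat K → ⊥)

{-# OPTIONS --safe #-}
-- Let m be a rank exceeding every letter on the given Knuth paths (they may leave [±n]), and let
-- e_i^max raise a word to the top of its i-string. Knuth equivalence commutes with e_i^max. On a word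
-- of columns C₁ C₂ …, each replaced by its extremal columns rC ℓC, e_i^max acts by applying s_i to
-- some of the extremal columns. Say that v in the Weyl group dominates the word if there are
-- v ≥ σ₁ ≥ σ₂ ≥ … in Bruhat order such that σ_k starts with the k-th extremal column. If s_i v < v,
-- then v dominates w iff s_i v dominates e_i^max w (this is the string property of Demazure
-- crystals), and the identity dominates only the words all of whose columns are 1 2 … ℓ, which are
-- recognised by their weight. So the set of the v dominating a word of columns depends only on its
-- Knuth class and its multiset of column lengths. It is not empty for the reading of a KN tableau.
-- A minimal v in it starts with r(C_ℓ) for every ℓ: the columns of K_+(T) are initial segments of one
-- signed permutation.
module Submission where

open import Defs
open import Data.Bool using (Bool; true; false; if_then_else_; _∧_; _∨_; not; T)
open import Data.Empty using (⊥; ⊥-elim)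
open import Data.List using (List; []; _∷_; _++_; map; length; reverse; concat; take; drop; filter; _ʳ++_)
open import Data.List.Properties using (++-assoc; length-++; ++-identityʳ; map-++; map-∘; length-map; take-map; length-take; length-drop; unfold-reverse; filter-++; filter-all; filter-none)
open import Data.List.Membership.Propositional using (_∈_)
open import Data.List.Membership.Propositional.Properties using (∈-++⁺ˡ; ∈-++⁺ʳ; ∈-++⁻; ∈-map⁺; ∈-map⁻; ∈-concat⁻′)
open import Data.List.Relation.Binary.Permutation.Propositional using (_↭_; ↭-sym; ↭-trans; ↭-reflexive)
open import Data.List.Relation.Binary.Permutation.Propositional.Properties using (↭-reverse; ¬x∷xs↭[]; All-resp-↭) renaming (map⁺ to ↭-map⁺)
open import Data.List.Relation.Unary.All as All using (All; []; _∷_)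
open import Data.List.Relation.Unary.All.Properties using () renaming (++⁺ to All-++⁺; ++⁻ˡ to All-++⁻ˡ; ++⁻ʳ to All-++⁻ʳ; concat⁺ to All-concat⁺; concat⁻ to All-concat⁻; map⁺ to All-map⁺)
open import Data.List.Relation.Unary.AllPairs using (AllPairs; []; _∷_)
open import Data.List.Relation.Unary.AllPairs.Properties using () renaming (++⁺ to AllPairs-++⁺)
open import Data.List.Relation.Unary.Any using (here; there)
open import Data.List.Relation.Unary.Linked as Linked using (Linked; []; [-]; _∷_)
open import Data.List.Relation.Unary.Linked.Properties using (Linked⇒AllPairs; AllPairs⇒Linked) renaming (map⁺ to Linked-map⁺)
open import Data.Maybe using (just; nothing)
open import Data.Nat
open import Data.Nat.ListAction using (sum)
open import Data.Nat.ListAction.Properties using (sum-++; sum-↭)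
open import Data.Nat.Properties
open import Data.Nat.Tactic.RingSolver using (solve-∀)
open import Data.Product hiding (map)
open import Data.Sum using (_⊎_; inj₁; inj₂; [_,_]′)
open import Data.Unit using (⊤; tt)
open import Function using (_∘_; case_of_)
open import Relation.Binary.Construct.Closure.ReflexiveTransitive using (ε; _◅_)
open import Relation.Binary.Construct.Closure.Symmetric using (SymClosure; fwd; bwd)
open import Relation.Binary.PropositionalEquality
open import Relation.Nullary using (¬_; yes; no)

-- C is replaced by rC ℓC because this is its image under the dilation of weights by 2. A column
-- containing a pair is in general not an extremal vector, so no prefix of a signed permutation can
-- represent it; after dilation it is a product of two that are, and raising can be followed along
-- them with one Boolean of memory. Knuth relations are compared with raising for every number p of
-- unmatched ⊕ on their left. A context then only changes p, and each relation becomes a finite case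
-- distinction. The tableau criterion turns the lifting property of the Bruhat order into arithmetic
-- with multiplicities 0 and 1, and the sum of all counts in the criterion replaces the Coxeter
-- length in inductions. A least v is never constructed. If v dominates the word of S, then so does
-- the first σ of the chain, and σ starts with r(C_ℓ). Passing back and forth between the words of
-- two skew tableaux gives smaller and smaller signed permutations, until the same one starts with
-- the columns of both; these are then nested.

shift : ∀ {k n N} → k + suc n ≡ N → suc k + n ≡ N
shift {k} {n} = trans (sym (+-suc k n))

-- Columns as lists of types: raising, admissibility and the contraction of K5.

-- A column of letters in [±m] is the list, for k = 1, …, m, of the pairs (k ∈ C , bar k ∈ C).
Ty : Set
Ty = Bool × Bool

opt : Bool → ℕ → List ℕ
opt true k = k ∷ []
opt false k = []

data Sg : Set where
  ⊕ ⊖ ⊙ : Sg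

-- Effect of raising on a letter of the given sign when p unmatched ⊕ precede it.
act : Sg → ℕ → ℕ → ℕ
act ⊕ p c = c
act ⊖ zero c = pred c
act ⊖ (suc p) c = c
act ⊙ p c = c

next : Sg → ℕ → ℕ
next ⊕ p = suc p
next ⊖ p = pred p
next ⊙ p = p

-- d is the excess of absent values over pairs among the smaller k.
data Adm : ℕ → List Ty → Set where
  []    : ∀ {d} → Adm d []
  none  : ∀ {d cs} → Adm (suc d) cs → Adm d ((false , false) ∷ cs)
  bar₁  : ∀ {d cs} → Adm d cs → Adm d ((false , true) ∷ cs)
  pos₁  : ∀ {d cs} → Adm d cs → Adm d ((true , false) ∷ cs)
  both  : ∀ {d cs} → Adm d cs → Adm (suc d) ((true , true) ∷ cs)

-- K5: the pair removed is the first one at which the pairs outnumber the absent values.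
data Contract : ℕ → List Ty → List Ty → Set where
  hit   : ∀ {cs} → Adm 0 cs → Contract 0 ((true , true) ∷ cs) ((false , false) ∷ cs)
  none  : ∀ {d cs cs'} → Contract (suc d) cs cs' → Contract d ((false , false) ∷ cs) ((false , false) ∷ cs')
  bar₁  : ∀ {d cs cs'} → Contract d cs cs' → Contract d ((false , true) ∷ cs) ((false , true) ∷ cs')
  pos₁  : ∀ {d cs cs'} → Contract d cs cs' → Contract d ((true , false) ∷ cs) ((true , false) ∷ cs')
  both  : ∀ {d cs cs'} → Contract d cs cs' → Contract (suc d) ((true , true) ∷ cs) ((true , true) ∷ cs')

-- Raising of the letters q, q + 1 of signs ⊕ ⊖, present according to a and b.
half : ℕ → Bool → Bool → (Bool × Bool) × ℕ
half p true true = (true , true) , p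
half p true false = (true , false) , suc p
half p false false = (false , false) , p
half zero false true = (true , false) , zero
half (suc p) false true = (false , true) , p

pair₁ pair₂ : ℕ → Ty → Ty → Ty
pair₁ p (a , d) (b , c) =
  proj₁ (proj₁ (half p a b)) , proj₂ (proj₁ (half (proj₂ (half p a b)) c d))
pair₂ p (a , d) (b , c) =
  proj₂ (proj₁ (half p a b)) , proj₁ (proj₁ (half (proj₂ (half p a b)) c d))

pairOut : ℕ → Ty → Ty → ℕ
pairOut p (a , d) (b , c) = proj₂ (half (proj₂ (half p a b)) c d)

-- The argument e is the distance to the position i. In the last position m the letters i, i + 1
-- are m, bar m.
Et : ℕ → ℕ → List Ty → List Ty
Et _ p [] = []
Et (suc e) p (t ∷ cs) = t ∷ Et e p cs
Et zero p (t₁ ∷ t₂ ∷ cs) = pair₁ p t₁ t₂ ∷ pair₂ p t₁ t₂ ∷ cs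
Et zero p ((a , d) ∷ []) = proj₁ (half p a d) ∷ []

Eo : ℕ → ℕ → List Ty → ℕ
Eo _ p [] = p
Eo (suc e) p (t ∷ cs) = Eo e p cs
Eo zero p (t₁ ∷ t₂ ∷ cs) = pairOut p t₁ t₂
Eo zero p ((a , d) ∷ []) = proj₂ (half p a d)

length-Et : ∀ e p c → length (Et e p c) ≡ length c
length-Et zero p [] = refl
length-Et (suc e) p [] = refl
length-Et (suc e) p (t ∷ cs) = cong suc (length-Et e p cs)
length-Et zero p (t₁ ∷ t₂ ∷ cs) = refl
length-Et zero p (t ∷ []) = refl

-- All changes that raising can make at the positions i, i + 1, with the number of pending ⊕
-- forgotten. An invariant of raising only has to be checked on these.
data Move : Ty → Ty → Ty → Ty → Set where
  stay : ∀ {t₁ t₂} → Move t₁ t₂ t₁ t₂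
  m₁ : Move (false , true) (true , true) (true , true) (false , true)
  m₂ : Move (false , false) (true , true) (true , false) (false , true)
  m₃ : Move (false , false) (true , false) (true , false) (false , false)
  m₄ : Move (false , true) (true , false) (true , false) (false , true)
  m₅ : Move (true , true) (true , false) (true , false) (true , true)
  m₆ : Move (false , true) (false , false) (false , false) (false , true)
  m₇ : Move (false , true) (true , false) (false , false) (true , true)

pair-move : ∀ p t₁ t₂ → Move t₁ t₂ (pair₁ p t₁ t₂) (pair₂ p t₁ t₂)
pair-move p (true , true) (true , true) = stay
pair-move p (true , false) (true , true) = stay
pair-move p (true , false) (true , false) = stay
pair-move zero (true , true) (true , false) = m₅
pair-move (suc p) (true , true) (true , false) = stay
pair-move p (true , true) (false , true) = stay
pair-move p (true , false) (false , true) = stay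
pair-move p (true , true) (false , false) = stay
pair-move p (true , false) (false , false) = stay
pair-move p (false , true) (false , true) = stay
pair-move p (false , false) (false , true) = stay
pair-move p (false , false) (false , false) = stay
pair-move zero (false , true) (false , false) = m₆
pair-move (suc p) (false , true) (false , false) = stay
pair-move zero (false , true) (true , true) = m₁
pair-move zero (false , false) (true , true) = m₂
pair-move zero (false , false) (true , false) = m₃
pair-move zero (false , true) (true , false) = m₄
pair-move (suc p) (false , true) (true , true) = stay
pair-move (suc p) (false , false) (true , true) = stay
pair-move (suc p) (false , false) (true , false) = stay
pair-move (suc zero) (false , true) (true , false) = m₇
pair-move (suc (suc p)) (false , true) (true , false) = stay

single-move : ∀ p a d → proj₁ (half p a d) ≡ (a , d) ⊎
                        ((a , d) ≡ (false , true) × proj₁ (half p a d) ≡ (true , false))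
single-move p true true = inj₁ refl
single-move p true false = inj₁ refl
single-move p false false = inj₁ refl
single-move zero false true = inj₂ (refl , refl)
single-move (suc p) false true = inj₁ refl

-- Moves conserve the excess over the two positions. A shifted pair has the same excess in front of
-- it, and the pair created by `m₇` follows a fresh absent value.
Adm-move : ∀ {t₁ t₂ t₁' t₂' d cs} → Move t₁ t₂ t₁' t₂' → Adm d (t₁ ∷ t₂ ∷ cs) → Adm d (t₁' ∷ t₂' ∷ cs)
Adm-move stay x = x
Adm-move m₁ (bar₁ (both x)) = both (bar₁ x)
Adm-move m₂ (none (both x)) = pos₁ (bar₁ x)
Adm-move m₃ (none (pos₁ x)) = pos₁ (none x)
Adm-move m₄ (bar₁ (pos₁ x)) = pos₁ (bar₁ x)
Adm-move m₅ (both (pos₁ x)) = pos₁ (both x)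
Adm-move m₆ (bar₁ (none x)) = none (bar₁ x)
Adm-move m₇ (bar₁ (pos₁ x)) = none (both x)

Adm-Et : ∀ e p {d c} → Adm d c → Adm d (Et e p c)
Adm-Et zero p [] = []
Adm-Et (suc e) p [] = []
Adm-Et (suc e) p (none x) = none (Adm-Et e p x)
Adm-Et (suc e) p (bar₁ x) = bar₁ (Adm-Et e p x)
Adm-Et (suc e) p (pos₁ x) = pos₁ (Adm-Et e p x)
Adm-Et (suc e) p (both x) = both (Adm-Et e p x)
Adm-Et zero p {c = t₁ ∷ t₂ ∷ cs} x = Adm-move (pair-move p t₁ t₂) x
Adm-Et zero p {c = (a , d) ∷ []} x with proj₁ (half p a d) | single-move p a d
... | _ | inj₁ refl = x
Adm-Et zero p {c = _ ∷ []} (bar₁ []) | _ | inj₂ (refl , refl) = pos₁ []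

Contract-move : ∀ {t₁ t₂ t₁' t₂' d cs cs'} → Move t₁ t₂ t₁' t₂' →
  Contract d (t₁ ∷ t₂ ∷ cs) (t₁ ∷ t₂ ∷ cs') → Contract d (t₁' ∷ t₂' ∷ cs) (t₁' ∷ t₂' ∷ cs')
Contract-move stay x = x
Contract-move m₁ (bar₁ (both x)) = both (bar₁ x)
Contract-move m₂ (none (both x)) = pos₁ (bar₁ x)
Contract-move m₃ (none (pos₁ x)) = pos₁ (none x)
Contract-move m₄ (bar₁ (pos₁ x)) = pos₁ (bar₁ x)
Contract-move m₅ (both (pos₁ x)) = pos₁ (both x)
Contract-move m₆ (bar₁ (none x)) = none (bar₁ x)
Contract-move m₇ (bar₁ (pos₁ x)) = none (both x)

Contract-pair : ∀ p {t₁ t₂ d cs cs'} → Contract d (t₁ ∷ t₂ ∷ cs) (t₁ ∷ t₂ ∷ cs') →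
  Contract d (Et 0 p (t₁ ∷ t₂ ∷ cs)) (Et 0 p (t₁ ∷ t₂ ∷ cs')) × Eo 0 p (t₁ ∷ t₂ ∷ cs) ≡ Eo 0 p (t₁ ∷ t₂ ∷ cs')
Contract-pair p {t₁} {t₂} x = Contract-move (pair-move p t₁ t₂) x , refl

-- Away from the removed pair, raising sees the same types on both sides. A removed pair at i or i +
-- 1 may be moved to the other of the two positions, and there it is still the pair that gets
-- contracted.
Contract-Et : ∀ e p {d c c'} → Contract d c c' →
              Contract d (Et e p c) (Et e p c') × Eo e p c ≡ Eo e p c'
Contract-Et (suc e) p (hit x) = hit (Adm-Et e p x) , refl
Contract-Et (suc e) p (none x) = map₁ none (Contract-Et e p x)
Contract-Et (suc e) p (bar₁ x) = map₁ bar₁ (Contract-Et e p x)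
Contract-Et (suc e) p (pos₁ x) = map₁ pos₁ (Contract-Et e p x)
Contract-Et (suc e) p (both x) = map₁ both (Contract-Et e p x)
Contract-Et zero p (hit []) = hit [] , refl
Contract-Et zero p (hit (none x)) = hit (none x) , refl
Contract-Et zero p (hit (bar₁ x)) = hit (bar₁ x) , refl
Contract-Et zero zero (hit (pos₁ x)) = pos₁ (hit x) , refl
Contract-Et zero (suc p) (hit (pos₁ x)) = hit (pos₁ x) , refl
Contract-Et zero zero (bar₁ (hit x)) = hit (bar₁ x) , refl
Contract-Et zero (suc p) (bar₁ (hit x)) = bar₁ (hit x) , refl
Contract-Et zero p (pos₁ (hit x)) = pos₁ (hit x) , refl
Contract-Et zero p (both (hit x)) = both (hit x) , refl
Contract-Et zero p (none y@(none x)) = Contract-pair p (none y)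
Contract-Et zero p (none y@(bar₁ x)) = Contract-pair p (none y)
Contract-Et zero p (none y@(pos₁ x)) = Contract-pair p (none y)
Contract-Et zero p (none y@(both x)) = Contract-pair p (none y)
Contract-Et zero p (bar₁ y@(none x)) = Contract-pair p (bar₁ y)
Contract-Et zero p (bar₁ y@(bar₁ x)) = Contract-pair p (bar₁ y)
Contract-Et zero p (bar₁ y@(pos₁ x)) = Contract-pair p (bar₁ y)
Contract-Et zero p (bar₁ y@(both x)) = Contract-pair p (bar₁ y)
Contract-Et zero p (pos₁ y@(none x)) = Contract-pair p (pos₁ y)
Contract-Et zero p (pos₁ y@(bar₁ x)) = Contract-pair p (pos₁ y)
Contract-Et zero p (pos₁ y@(pos₁ x)) = Contract-pair p (pos₁ y)
Contract-Et zero p (pos₁ y@(both x)) = Contract-pair p (pos₁ y)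
Contract-Et zero p (both y@(none x)) = Contract-pair p (both y)
Contract-Et zero p (both y@(bar₁ x)) = Contract-pair p (both y)
Contract-Et zero p (both y@(pos₁ x)) = Contract-pair p (both y)
Contract-Et zero p (both y@(both x)) = Contract-pair p (both y)

-- Extremal columns on types.

-- Number of pairs waiting for a partner t when the values are scanned downwards: the t_k are the
-- absent values met while a pair is waiting.
pending : List Ty → ℕ
pending [] = 0
pending ((true , true) ∷ cs) = suc (pending cs)
pending ((true , false) ∷ cs) = pending cs
pending ((false , true) ∷ cs) = pending cs
pending ((false , false) ∷ cs) = pred (pending cs)

-- The number h counts the pairs waiting among the larger values. An absent value met with h > 0 is
-- some t_k: it receives its bar in rC and the unbarred letter in ℓC.
rTy lTy : ℕ → Ty → Ty
rTy h (true , true) = true , false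
rTy h (true , false) = true , false
rTy h (false , true) = false , true
rTy zero (false , false) = false , false
rTy (suc h) (false , false) = false , true
lTy h (true , true) = false , true
lTy h (true , false) = true , false
lTy h (false , true) = false , true
lTy zero (false , false) = false , false
lTy (suc h) (false , false) = true , false

resolve : (ℕ → Ty → Ty) → List Ty → List Ty
resolve f [] = []
resolve f (t ∷ cs) = f (pending cs) t ∷ resolve f cs

rT lT : List Ty → List Ty
rT = resolve rTy
lT = resolve lTy

-- The excess below bounds the number of pairs left without a partner. For d = 0 every pair of an
-- admissible column finds its t_k.
pending-≤ : ∀ {d c} → Adm d c → pending c ≤ d
pending-≤ [] = z≤n
pending-≤ (none x) = pred-mono-≤ (pending-≤ x)
pending-≤ (bar₁ x) = pending-≤ x
pending-≤ (pos₁ x) = pending-≤ x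
pending-≤ (both x) = s≤s (pending-≤ x)

pending-move : ∀ {t₁ t₂ t₁' t₂'} cs → Move t₁ t₂ t₁' t₂' → pending (t₁' ∷ t₂' ∷ cs) ≡ pending (t₁ ∷ t₂ ∷ cs)
pending-move cs stay = refl
pending-move cs m₁ = refl
pending-move cs m₂ = refl
pending-move cs m₃ = refl
pending-move cs m₄ = refl
pending-move cs m₅ = refl
pending-move cs m₆ = refl
pending-move cs m₇ = refl

length-Contract : ∀ {d c c'} → Contract d c c' → length c ≡ length c'
length-Contract (hit x) = refl
length-Contract (none x) = cong suc (length-Contract x)
length-Contract (bar₁ x) = cong suc (length-Contract x)
length-Contract (pos₁ x) = cong suc (length-Contract x)
length-Contract (both x) = cong suc (length-Contract x)

-- Counting letters, and the Bruhat order.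

is geb : ℕ → ℕ → ℕ
is zero zero = 1
is zero (suc c) = 0
is (suc q) zero = 0
is (suc q) (suc c) = is q c
geb zero c = 1
geb (suc t) zero = 0
geb (suc t) (suc c) = geb t c

cnt ge : ℕ → List ℕ → ℕ
cnt q [] = 0
cnt q (c ∷ w) = is q c + cnt q w
ge t [] = 0
ge t (c ∷ w) = geb t c + ge t w

is-refl : ∀ c → is c c ≡ 1
is-refl zero = refl
is-refl (suc c) = is-refl c

is-≢ : ∀ {q c} → q ≢ c → is q c ≡ 0
is-≢ {zero} {zero} n = ⊥-elim (n refl)
is-≢ {zero} {suc c} n = refl
is-≢ {suc q} {zero} n = refl
is-≢ {suc q} {suc c} n = is-≢ (n ∘ cong suc)

is-⇔ : ∀ {a b c d} → (a ≡ b → c ≡ d) → (c ≡ d → a ≡ b) → is a b ≡ is c d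
is-⇔ {a} {b} {c} {d} f g with a ≟ b
... | yes refl rewrite f refl = trans (is-refl a) (sym (is-refl d))
... | no n = trans (is-≢ n) (sym (is-≢ (n ∘ g)))

geb-suc : ∀ q c → geb q c ≡ geb (suc q) c + is q c
geb-suc zero zero = refl
geb-suc zero (suc c) = refl
geb-suc (suc q) zero = refl
geb-suc (suc q) (suc c) = geb-suc q c

+-interchange : ∀ a b c d → (a + b) + (c + d) ≡ (a + c) + (b + d)
+-interchange a b c d = trans (+-assoc a b (c + d)) (trans (cong (a +_)
  (trans (sym (+-assoc b c d)) (trans (cong (_+ d) (+-comm b c)) (+-assoc c b d)))) (sym (+-assoc a c (b + d))))

ge-suc : ∀ q w → ge q w ≡ ge (suc q) w + cnt q w
ge-suc q [] = refl
ge-suc q (c ∷ w) = trans (cong₂ _+_ (geb-suc q c) (ge-suc q w)) (+-interchange (geb (suc q) c) _ _ _)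

cnt-++ : ∀ q u v → cnt q (u ++ v) ≡ cnt q u + cnt q v
cnt-++ q [] v = refl
cnt-++ q (c ∷ u) v = trans (cong (is q c +_) (cnt-++ q u v)) (sym (+-assoc (is q c) _ _))

cnt-take : ∀ q ℓ w → cnt q (take ℓ w) ≤ cnt q w
cnt-take q zero w = z≤n
cnt-take q (suc ℓ) [] = z≤n
cnt-take q (suc ℓ) (c ∷ w) = +-monoʳ-≤ (is q c) (cnt-take q ℓ w)

cnt-take-mono : ∀ q {k ℓ} w → k ≤ ℓ → cnt q (take k w) ≤ cnt q (take ℓ w)
cnt-take-mono q w z≤n = z≤n
cnt-take-mono q [] (s≤s l) = z≤n
cnt-take-mono q (c ∷ w) (s≤s l) = +-monoʳ-≤ (is q c) (cnt-take-mono q w l)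

-- ⊑ is the Bruhat order, by the tableau criterion.
infix 4 _≋_ _⊑_
_≋_ : List ℕ → List ℕ → Set
x ≋ y = ∀ c → cnt c x ≡ cnt c y

_⊑_ : List ℕ → List ℕ → Set
ρ ⊑ τ = ∀ ℓ t → ge t (take ℓ ρ) ≤ ge t (take ℓ τ)

⊑-refl : ∀ {ρ} → ρ ⊑ ρ
⊑-refl ℓ t = ≤-refl

⊑-trans : ∀ {ρ σ τ} → ρ ⊑ σ → σ ⊑ τ → ρ ⊑ τ
⊑-trans p q ℓ t = ≤-trans (p ℓ t) (q ℓ t)

private
  -- The arithmetic of the lifting property for prefixes R of ρ and T of τ: a, b (resp. A, B) are the
  -- multiplicities of q, q + 1, and g, g₂ count the letters ≥ q + 1, ≥ q + 2, in R (resp. in T); X and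
  -- Y count the letters ≥ q + 1 after swapping q and q + 1.
  raise-bound : ∀ {X g a b g₂ G A B G₂} → b ≤ a → a ≤ 1 → X + b ≡ g + a → g ≡ g₂ + b →
    g ≤ G → g + a ≤ G + A → g₂ ≤ G₂ → G ≡ G₂ + B → A ≤ B → X ≤ G
  raise-bound {X} {g} {zero} {zero} _ _ e _ gG _ _ _ _ =
    ≤-trans (≤-reflexive (trans (sym (+-identityʳ X)) (trans e (+-identityʳ g)))) gG
  raise-bound {X} {g} {suc zero} {suc zero} _ _ e _ gG _ _ _ _ =
    ≤-trans (≤-reflexive (+-cancelʳ-≡ 1 X g e)) gG
  raise-bound {X} {g} {suc zero} {zero} {G = G} {zero} _ _ e _ _ h _ _ _ =
    ≤-trans (≤-reflexive (trans (sym (+-identityʳ X)) e)) (≤-trans h (≤-reflexive (+-identityʳ G)))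
  raise-bound {X} {g} {suc zero} {zero} {g₂} {G} {suc A} {suc B} _ _ e e₂ _ _ h₂ E₂ _ = begin
    X          ≡⟨ trans (sym (+-identityʳ X)) e ⟩
    g + 1      ≡⟨ cong (_+ 1) (trans e₂ (+-identityʳ g₂)) ⟩
    g₂ + 1     ≤⟨ +-mono-≤ h₂ (s≤s z≤n) ⟩
    _          ≡⟨ sym E₂ ⟩
    G          ∎
    where open ≤-Reasoning
  raise-bound {a = suc (suc a)} _ (s≤s ())
  raise-bound {a = suc zero} {suc (suc b)} (s≤s ())

  lower-bound : ∀ {Y g a b g₂ G A B G₂} → b ≤ a → A ≤ B → B ≤ 1 → Y + B ≡ G + A → g ≡ g₂ + b →
    g ≤ G → g + a ≤ G + A → g₂ ≤ G₂ → G ≡ G₂ + B → a ≤ 1 → g ≤ Y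
  lower-bound {Y} {g} {G = G} {zero} {zero} _ _ _ e _ gG _ _ _ _ =
    ≤-trans gG (≤-reflexive (trans (sym (+-identityʳ G)) (trans (sym e) (+-identityʳ Y))))
  lower-bound {Y} {g} {G = G} {suc zero} {suc zero} _ _ _ e _ gG _ _ _ _ =
    ≤-trans gG (≤-reflexive (sym (+-cancelʳ-≡ 1 Y G e)))
  lower-bound {Y} {g} {b = zero} {g₂} {G} {zero} {suc zero} {G₂} _ _ _ e e₂ _ _ h₂ E₂ _ = begin
    g    ≡⟨ trans e₂ (+-identityʳ g₂) ⟩
    g₂   ≤⟨ h₂ ⟩
    G₂   ≡⟨ sym (+-cancelʳ-≡ 1 Y G₂ (trans e (trans (+-identityʳ G) E₂))) ⟩
    Y    ∎
    where open ≤-Reasoning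
  lower-bound {Y} {g} {suc zero} {suc zero} {g₂} {G} {zero} {suc zero} _ _ _ e _ _ h _ _ _ =
    +-cancelʳ-≤ 1 g Y (≤-trans h (≤-reflexive (sym e)))
  lower-bound {B = suc (suc B)} _ _ (s≤s ())
  lower-bound {a = suc (suc a)} _ _ _ _ _ _ _ _ _ (s≤s ())
  lower-bound {a = suc zero} {suc (suc b)} (s≤s ())
  lower-bound {A = suc (suc A)} {suc zero} _ (s≤s ())

-- Raising on the two extremal columns of one column.

pos? : ℕ → Bool
pos? zero = false
pos? (suc p) = true

_==_ : Bool → Bool → Bool
true == b = b
false == b = not b

eqTy : Ty → Ty → Bool
eqTy (a , b) (c , d) = (a == c) ∧ (b == d)

private
  ∧-true : ∀ {a b} → (a ∧ b) ≡ true → a ≡ true × b ≡ true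
  ∧-true {true} {true} _ = refl , refl

  ∨-true : ∀ {a b} → (a ∨ b) ≡ true → a ≡ true ⊎ b ≡ true
  ∨-true {true} _ = inj₁ refl
  ∨-true {false} e = inj₂ e

  ==-true : ∀ {a b} → (a == b) ≡ true → a ≡ b
  ==-true {true} {true} _ = refl
  ==-true {false} {false} _ = refl

  eqTy-true : ∀ {s t} → eqTy s t ≡ true → s ≡ t
  eqTy-true {a , b} {c , d} e = let x , y = ∧-true {a == c} e in cong₂ _,_ (==-true x) (==-true y)

  allBool : (Bool → Bool) → Bool
  allBool f = f true ∧ f false

  allBool-true : ∀ f → allBool f ≡ true → ∀ b → f b ≡ true
  allBool-true f e true = proj₁ (∧-true e)
  allBool-true f e false = proj₂ (∧-true {f true} e)

  allTy : (Ty → Bool) → Bool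
  allTy f = allBool λ a → allBool λ b → f (a , b)

  allTy-true : ∀ f → allTy f ≡ true → ∀ t → f t ≡ true
  allTy-true f e (a , b) = allBool-true (λ b → f (a , b)) (allBool-true (λ a → allBool λ b → f (a , b)) e a) b

-- The sign of the weight on the i-th coroot. For types without pairs the two cases exclude each
-- other, and if neither holds the types are equal.
posT negT : Ty → Ty → Bool
posT (a , d) (b , c) = (a ∧ not b) ∨ (c ∧ not d)
negT (a , d) (b , c) = (b ∧ not a) ∨ (d ∧ not c)

-- One extremal column under e_i^max, with the information whether an unmatched ⊕ is pending before
-- and after it. Only a negative column met with nothing pending is reflected. A negative column may
-- or may not use up all that is pending, so its outgoing Boolean is free.
data St : Bool → Ty → Ty → Ty → Ty → Bool → Set where
  spos : ∀ {b t₁ t₂} → posT t₁ t₂ ≡ true → St b t₁ t₂ t₁ t₂ true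
  szer : ∀ {b t} → St b t t t t b
  sneg : ∀ {b t₁ t₂} → negT t₁ t₂ ≡ true → St true t₁ t₂ t₁ t₂ b
  sflp : ∀ {t₁ t₂} → negT t₁ t₂ ≡ true → St false t₁ t₂ t₂ t₁ false

private
  same? : Ty → Ty → Ty → Ty → Bool
  same? t₁ t₂ u₁ u₂ = eqTy t₁ u₁ ∧ eqTy t₂ u₂

  -- A Boolean form of `St`, so that the tables below are settled by evaluation.
  st? : Bool → Ty → Ty → Ty → Ty → Bool → Bool
  st? b t₁ t₂ u₁ u₂ b' =
    ((posT t₁ t₂ ∧ b') ∧ same? t₁ t₂ u₁ u₂) ∨
    ((eqTy t₁ t₂ ∧ (b == b')) ∧ same? t₁ t₂ u₁ u₂) ∨
    ((negT t₁ t₂ ∧ b) ∧ same? t₁ t₂ u₁ u₂) ∨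
    ((negT t₁ t₂ ∧ (not b ∧ not b')) ∧ same? t₁ t₂ u₂ u₁)

  same-true : ∀ {t₁ t₂ u₁ u₂} → same? t₁ t₂ u₁ u₂ ≡ true → t₁ ≡ u₁ × t₂ ≡ u₂
  same-true {t₁} {t₂} {u₁} e = let x , y = ∧-true {eqTy t₁ u₁} e in eqTy-true x , eqTy-true y

  not-true : ∀ {b} → not b ≡ true → b ≡ false
  not-true {false} _ = refl

  st-sound : ∀ b t₁ t₂ u₁ u₂ b' → st? b t₁ t₂ u₁ u₂ b' ≡ true → St b t₁ t₂ u₁ u₂ b'
  st-sound b t₁ t₂ u₁ u₂ b' e with ∨-true {(posT t₁ t₂ ∧ b') ∧ same? t₁ t₂ u₁ u₂} e
  ... | inj₁ x with ∧-true {posT t₁ t₂ ∧ b'} x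
  ... | y , s with ∧-true {posT t₁ t₂} y | same-true {t₁} {t₂} {u₁} {u₂} s
  ... | p , refl | refl , refl = spos p
  st-sound b t₁ t₂ u₁ u₂ b' e | inj₂ e₁ with ∨-true {(eqTy t₁ t₂ ∧ (b == b')) ∧ same? t₁ t₂ u₁ u₂} e₁
  ... | inj₁ x with ∧-true {eqTy t₁ t₂ ∧ (b == b')} x
  ... | y , s with ∧-true {eqTy t₁ t₂} y | same-true {t₁} {t₂} {u₁} {u₂} s
  ... | p , q | refl , refl with eqTy-true {t₁} {t₂} p | ==-true {b} {b'} q
  ... | refl | refl = szer
  st-sound b t₁ t₂ u₁ u₂ b' e | inj₂ e₁ | inj₂ e₂ with ∨-true {(negT t₁ t₂ ∧ b) ∧ same? t₁ t₂ u₁ u₂} e₂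
  ... | inj₁ x with ∧-true {negT t₁ t₂ ∧ b} x
  ... | y , s with ∧-true {negT t₁ t₂} y | same-true {t₁} {t₂} {u₁} {u₂} s
  ... | p , refl | refl , refl = sneg p
  st-sound b t₁ t₂ u₁ u₂ b' e | inj₂ e₁ | inj₂ e₂ | inj₂ x with ∧-true {negT t₁ t₂ ∧ (not b ∧ not b')} x
  ... | y , s with ∧-true {negT t₁ t₂} y | same-true {t₁} {t₂} {u₂} {u₁} s
  ... | p , q | refl , refl with not-true {b} (proj₁ (∧-true {not b} q)) | not-true {b'} (proj₂ (∧-true {not b} q))
  ... | refl | refl = sflp p

step : ℕ → Ty → ℕ
step h (true , true) = suc h
step h (true , false) = h
step h (false , true) = h
step h (false , false) = pred h

pending-step : ∀ t cs → pending (t ∷ cs) ≡ step (pending cs) t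
pending-step (true , true) cs = refl
pending-step (true , false) cs = refl
pending-step (false , true) cs = refl
pending-step (false , false) cs = refl

-- The Booleans tell whether an unmatched ⊕ precedes rC, lies between rC and ℓC, or follows ℓC.
PairSteps : ℕ → ℕ → Ty → Ty → Bool → Set
PairSteps p h t₁ t₂ b =
  St (pos? p) (rTy (step h t₂) t₁) (rTy h t₂) (rTy (step h u₂) u₁) (rTy h u₂) b ×
  St b (lTy (step h t₂) t₁) (lTy h t₂) (lTy (step h u₂) u₁) (lTy h u₂) (pos? (pairOut p t₁ t₂))
  where
  u₁ = pair₁ p t₁ t₂
  u₂ = pair₂ p t₁ t₂

LastSteps : ℕ → Ty → Bool → Set
LastSteps p t b =
  St (pos? p) (rTy 0 t) (swap (rTy 0 t)) (rTy 0 u) (swap (rTy 0 u)) b ×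
  St b (lTy 0 t) (swap (lTy 0 t)) (lTy 0 u) (swap (lTy 0 u)) (pos? (proj₂ (half p (proj₁ t) (proj₂ t))))
  where
  u = proj₁ (half p (proj₁ t) (proj₂ t))

private
  pairCheck : ℕ → ℕ → Ty → Ty → Bool → Bool
  pairCheck p h t₁ t₂ b =
    st? (pos? p) (rTy (step h t₂) t₁) (rTy h t₂) (rTy (step h u₂) u₁) (rTy h u₂) b ∧
    st? b (lTy (step h t₂) t₁) (lTy h t₂) (lTy (step h u₂) u₁) (lTy h u₂) (pos? (pairOut p t₁ t₂))
    where
    u₁ = pair₁ p t₁ t₂
    u₂ = pair₂ p t₁ t₂

  -- Only the cases 0, 1 and at least 2 of p and of h have to be told apart, which leaves nine
  -- evaluations over all pairs of types.
  pairTable : ∀ p h → allTy (λ t₁ → allTy λ t₂ → pairCheck p h t₁ t₂ true ∨ pairCheck p h t₁ t₂ false) ≡ true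
  pairTable zero zero = refl
  pairTable zero (suc zero) = refl
  pairTable zero (suc (suc h)) = refl
  pairTable (suc zero) zero = refl
  pairTable (suc zero) (suc zero) = refl
  pairTable (suc zero) (suc (suc h)) = refl
  pairTable (suc (suc p)) zero = refl
  pairTable (suc (suc p)) (suc zero) = refl
  pairTable (suc (suc p)) (suc (suc h)) = refl

  lastCheck : ℕ → Ty → Bool → Bool
  lastCheck p t b =
    st? (pos? p) (rTy 0 t) (swap (rTy 0 t)) (rTy 0 u) (swap (rTy 0 u)) b ∧
    st? b (lTy 0 t) (swap (lTy 0 t)) (lTy 0 u) (swap (lTy 0 u)) (pos? (proj₂ (half p (proj₁ t) (proj₂ t))))
    where
    u = proj₁ (half p (proj₁ t) (proj₂ t))

  lastTable : ∀ p → allTy (λ t → lastCheck p t true ∨ lastCheck p t false) ≡ true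
  lastTable zero = refl
  lastTable (suc zero) = refl
  lastTable (suc (suc p)) = refl

pair-steps : ∀ p h t₁ t₂ → Σ Bool (PairSteps p h t₁ t₂)
pair-steps p h t₁ t₂ =
  [ found true , found false ]′ (∨-true {pairCheck p h t₁ t₂ true}
    (allTy-true (λ t₂ → pairCheck p h t₁ t₂ true ∨ pairCheck p h t₁ t₂ false)
      (allTy-true (λ t₁ → allTy λ t₂ → pairCheck p h t₁ t₂ true ∨ pairCheck p h t₁ t₂ false) (pairTable p h) t₁) t₂))
  where
  u₁ = pair₁ p t₁ t₂
  u₂ = pair₂ p t₁ t₂
  found : ∀ b → pairCheck p h t₁ t₂ b ≡ true → Σ Bool (PairSteps p h t₁ t₂)
  found b e = let x , y = ∧-true {st? (pos? p) (rTy (step h t₂) t₁) (rTy h t₂) (rTy (step h u₂) u₁) (rTy h u₂) b} e in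
    b , st-sound _ _ _ _ _ _ x , st-sound _ _ _ _ _ _ y

last-steps : ∀ p t → Σ Bool (LastSteps p t)
last-steps p t =
  [ found true , found false ]′ (∨-true {lastCheck p t true}
    (allTy-true (λ t → lastCheck p t true ∨ lastCheck p t false) (lastTable p) t))
  where
  u = proj₁ (half p (proj₁ t) (proj₂ t))
  found : ∀ b → lastCheck p t b ≡ true → Σ Bool (LastSteps p t)
  found b e = let x , y = ∧-true {st? (pos? p) (rTy 0 t) (swap (rTy 0 t)) (rTy 0 u) (swap (rTy 0 u)) b} e in
    b , st-sound _ _ _ _ _ _ x , st-sound _ _ _ _ _ _ y

-- With the convention that m + 1 is bar m, the types at m and m + 1 are swaps of each other.
data Sits : ℕ → Ty → Ty → List Ty → Set where
  here  : ∀ {t₁ t₂ cs} → Sits 0 t₁ t₂ (t₁ ∷ t₂ ∷ cs)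
  last  : ∀ {t} → Sits 0 t (swap t) (t ∷ [])
  there : ∀ {e t₁ t₂ t cs} → Sits e t₁ t₂ cs → Sits (suc e) t₁ t₂ (t ∷ cs)

data Diff : ℕ → Ty → Ty → Ty → Ty → List Ty → List Ty → Set where
  here  : ∀ {t₁ t₂ u₁ u₂ cs} → Diff 0 t₁ t₂ u₁ u₂ (t₁ ∷ t₂ ∷ cs) (u₁ ∷ u₂ ∷ cs)
  last  : ∀ {t u} → Diff 0 t (swap t) u (swap u) (t ∷ []) (u ∷ [])
  there : ∀ {e t₁ t₂ u₁ u₂ t X Y} → Diff e t₁ t₂ u₁ u₂ X Y → Diff (suc e) t₁ t₂ u₁ u₂ (t ∷ X) (t ∷ Y)

diff-sits : ∀ {e t₁ t₂ u₁ u₂ X Y} → Diff e t₁ t₂ u₁ u₂ X Y → Sits e t₁ t₂ X × Sits e u₁ u₂ Y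
diff-sits here = here , here
diff-sits last = last , last
diff-sits (there d) = let x , y = diff-sits d in there x , there y

diff-refl : ∀ {e t₁ t₂ X Y} → Diff e t₁ t₂ t₁ t₂ X Y → X ≡ Y
diff-refl here = refl
diff-refl last = refl
diff-refl (there d) = cong (_ ∷_) (diff-refl d)

diff-length : ∀ {e t₁ t₂ u₁ u₂ X Y} → Diff e t₁ t₂ u₁ u₂ X Y → length X ≡ length Y
diff-length here = refl
diff-length last = refl
diff-length (there d) = cong suc (diff-length d)

bit : Bool → ℕ
bit true = 1
bit false = 0

size : List Ty → ℕ
size [] = 0
size ((a , b) ∷ cs) = bit a + bit b + size cs

swap-size : ∀ {e t₁ t₂ X Y} → Diff e t₁ t₂ t₂ t₁ X Y → size X ≡ size Y
swap-size (here {a , d} {b , c} {cs = cs}) = trans (sym (+-assoc (bit a + bit d) (bit b + bit c) (size cs)))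
  (trans (cong (_+ size cs) (+-comm (bit a + bit d) _)) (+-assoc (bit b + bit c) (bit a + bit d) (size cs)))
swap-size (last {a , b}) = cong (_+ 0) (+-comm (bit a) (bit b))
swap-size (there d) = cong (_ +_) (swap-size d)

-- The smaller values find the same number of waiting pairs as before, so raising changes rC and ℓC
-- at most at the positions i and i + 1.
pending-Et : ∀ e p c → 1 ≤ length c → pending (Et e p c) ≡ pending c
pending-Et (suc e) p (t ∷ []) _ = refl
pending-Et (suc e) p (t ∷ t' ∷ cs) _ =
  trans (pending-step t (Et e p (t' ∷ cs)))
    (trans (cong (λ h → step h t) (pending-Et e p (t' ∷ cs) (s≤s z≤n))) (sym (pending-step t (t' ∷ cs))))
pending-Et zero p (t₁ ∷ t₂ ∷ cs) _ = pending-move cs (pair-move p t₁ t₂)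
pending-Et zero p ((a , d) ∷ []) _ with proj₁ (half p a d) | single-move p a d
... | _ | inj₁ refl = refl
... | _ | inj₂ (refl , refl) = refl

record ColumnSteps (e p : ℕ) (c : List Ty) : Set where
  constructor steps
  field
    {r₁ r₂ r₁' r₂' l₁ l₂ l₁' l₂'} : Ty
    mid  : Bool
    rSt  : St (pos? p) r₁ r₂ r₁' r₂' mid
    lSt  : St mid l₁ l₂ l₁' l₂' (pos? (Eo e p c))
    rDiff : Diff e r₁ r₂ r₁' r₂' (rT c) (rT (Et e p c))
    lDiff : Diff e l₁ l₂ l₁' l₂' (lT c) (lT (Et e p c))

-- Positions after i + 1 enter only through the number h of waiting pairs, positions before i not at
-- all; the finite tables cover the rest.
column-steps : ∀ e p c → e < length c → ColumnSteps e p c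
column-steps (suc e) p (t ∷ cs) (s≤s e<) with column-steps e p cs e<
... | steps b r l dr dl =
  steps b r l
    (subst (λ h → Diff _ _ _ _ _ (rTy (pending cs) t ∷ rT cs) (rTy h t ∷ rT (Et e p cs))) (sym (pending-Et e p cs (≤-trans (s≤s z≤n) e<))) (there dr))
    (subst (λ h → Diff _ _ _ _ _ (lTy (pending cs) t ∷ lT cs) (lTy h t ∷ lT (Et e p cs))) (sym (pending-Et e p cs (≤-trans (s≤s z≤n) e<))) (there dl))
column-steps zero p (t₁ ∷ t₂ ∷ cs) _ =
  let b , r , l = pair-steps p h t₁ t₂ in steps b r l
    (subst₂ (λ x y → Diff 0 (rTy (step h t₂) t₁) (rTy h t₂) (rTy (step h u₂) u₁) (rTy h u₂)
      (rTy x t₁ ∷ rTy h t₂ ∷ rT cs) (rTy y u₁ ∷ rTy h u₂ ∷ rT cs))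
      (sym (pending-step t₂ cs)) (sym (pending-step u₂ cs)) here)
    (subst₂ (λ x y → Diff 0 (lTy (step h t₂) t₁) (lTy h t₂) (lTy (step h u₂) u₁) (lTy h u₂)
      (lTy x t₁ ∷ lTy h t₂ ∷ lT cs) (lTy y u₁ ∷ lTy h u₂ ∷ lT cs))
      (sym (pending-step t₂ cs)) (sym (pending-step u₂ cs)) here)
  where
  h = pending cs
  u₁ = pair₁ p t₁ t₂
  u₂ = pair₂ p t₁ t₂
column-steps zero p ((a , d) ∷ []) _ =
  let b , r , l = last-steps p (a , d) in steps b r l last last

Ecols : ℕ → ℕ → List (List Ty) → List (List Ty)
Ecols e p [] = []
Ecols e p (c ∷ cs) = Et e p c ∷ Ecols e (Eo e p c) cs

length-resolve : ∀ f c → length (resolve f c) ≡ length c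
length-resolve f [] = refl
length-resolve f (t ∷ c) = cong suc (length-resolve f c)

-- Prefixes, sums over ranges, runs of consecutive letters.

take-++-+ : ∀ (u v : List ℕ) k → take (length u + k) (u ++ v) ≡ u ++ take k v
take-++-+ [] v k = refl
take-++-+ (x ∷ u) v k = cong (x ∷_) (take-++-+ u v k)

take-++-≤ : ∀ {k} (u v : List ℕ) → k ≤ length u → take k (u ++ v) ≡ take k u
take-++-≤ {zero} u v _ = refl
take-++-≤ {suc k} (x ∷ u) v (s≤s l) = cong (x ∷_) (take-++-≤ u v l)

take-+ : ∀ a b (w : List ℕ) → take (a + b) w ≡ take a w ++ take b (drop a w)
take-+ zero b w = refl
take-+ (suc a) zero [] = refl
take-+ (suc a) (suc b) [] = refl
take-+ (suc a) b (x ∷ w) = cong (x ∷_) (take-+ a b w)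

ge-++ : ∀ t u v → ge t (u ++ v) ≡ ge t u + ge t v
ge-++ t [] v = refl
ge-++ t (c ∷ u) v = trans (cong (geb t c +_) (ge-++ t u v)) (sym (+-assoc (geb t c) _ _))

geb≤1 : ∀ t c → geb t c ≤ 1
geb≤1 zero c = ≤-refl
geb≤1 (suc t) zero = z≤n
geb≤1 (suc t) (suc c) = geb≤1 t c

geb-mono : ∀ t {c d} → c ≤ d → geb t c ≤ geb t d
geb-mono zero l = ≤-refl
geb-mono (suc t) z≤n = z≤n
geb-mono (suc t) (s≤s l) = geb-mono t l

geb-1 : ∀ {t c} → t ≤ c → geb t c ≡ 1
geb-1 z≤n = refl
geb-1 (s≤s l) = geb-1 l

geb-0 : ∀ {t c} → c < t → geb t c ≡ 0
geb-0 {suc t} {zero} _ = refl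
geb-0 {suc t} {suc c} (s≤s l) = geb-0 l

ge≤length : ∀ t w → ge t w ≤ length w
ge≤length t [] = z≤n
ge≤length t (c ∷ w) = +-mono-≤ (geb≤1 t c) (ge≤length t w)

ge-all : ∀ {t w} → All (t ≤_) w → ge t w ≡ length w
ge-all [] = refl
ge-all (l ∷ ls) = cong₂ _+_ (geb-1 l) (ge-all ls)

ge-none : ∀ {t w} → All (_< t) w → ge t w ≡ 0
ge-none [] = refl
ge-none (l ∷ ls) = cong₂ _+_ (geb-0 l) (ge-none ls)

ge-take : ∀ t k w → ge t (take k w) ≤ ge t w
ge-take t zero w = z≤n
ge-take t (suc k) [] = z≤n
ge-take t (suc k) (c ∷ w) = +-monoʳ-≤ (geb t c) (ge-take t k w)

take-all : ∀ {P : ℕ → Set} k {w} → All P w → All P (take k w)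
take-all zero _ = []
take-all (suc k) [] = []
take-all (suc k) (p ∷ ps) = p ∷ take-all k ps

sumTo : ℕ → (ℕ → ℕ) → ℕ
sumTo zero f = 0
sumTo (suc n) f = f n + sumTo n f

sumTo-mono : ∀ n {f g} → (∀ x → f x ≤ g x) → sumTo n f ≤ sumTo n g
sumTo-mono zero le = z≤n
sumTo-mono (suc n) le = +-mono-≤ (le n) (sumTo-mono n le)

sumTo-strict : ∀ n {f g x} → (∀ x → f x ≤ g x) → x < n → f x < g x → sumTo n f < sumTo n g
sumTo-strict (suc n) {x = x} le (s≤s x≤n) lt with m≤n⇒m<n∨m≡n x≤n
... | inj₁ x<n = +-mono-≤-< (le n) (sumTo-strict n le x<n lt)
... | inj₂ refl = +-mono-<-≤ lt (sumTo-mono n le)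

sumTo-≡ : ∀ n {f g} → (∀ x → f x ≤ g x) → sumTo n f ≡ sumTo n g → ∀ {x} → x < n → f x ≡ g x
sumTo-≡ n {f} {g} le eq {x} x<n with f x ≟ g x
... | yes e = e
... | no ne = ⊥-elim (<⇒≢ (sumTo-strict n le x<n (≤∧≢⇒< (le x) ne)) eq)

run : ℕ → ℕ → List ℕ
run a zero = []
run a (suc n) = a ∷ run (suc a) n

take-run : ∀ a {k n} → k ≤ n → take k (run a n) ≡ run a k
take-run a z≤n = refl
take-run a (s≤s l) = cong (a ∷_) (take-run (suc a) l)

run-snoc : ∀ a n w → run a n ++ (a + n) ∷ w ≡ run a (suc n) ++ w
run-snoc a zero w = cong (_∷ w) (+-identityʳ a)
run-snoc a (suc n) w = cong (a ∷_) (trans (cong (λ x → run (suc a) n ++ x ∷ w) (+-suc a n)) (run-snoc (suc a) n w))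

cnt-run : ∀ {q} a n → a ≤ q → q < a + n → cnt q (run a n) ≡ 1
cnt-run a zero l u = ⊥-elim (<⇒≱ u (≤-trans (≤-reflexive (+-identityʳ a)) l))
cnt-run {q} a (suc n) l u with q ≟ a
... | yes refl rewrite is-refl q = cong suc (below (suc q) n ≤-refl)
  where
  below : ∀ a n → q < a → cnt q (run a n) ≡ 0
  below a zero lt = refl
  below a (suc n) lt rewrite is-≢ (<⇒≢ lt) = below (suc a) n (≤-trans lt (n≤1+n a))
... | no ne rewrite is-≢ ne = cnt-run (suc a) n (≤∧≢⇒< l (ne ∘ sym)) (≤-trans u (≤-reflexive (+-suc a n)))

cnt-run-bound : ∀ {q} a n → 0 < cnt q (run a n) → q < a + n
cnt-run-bound {q} a (suc n) lt with q ≟ a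
... | yes refl = ≤-trans (s≤s (m≤m+n q n)) (≤-reflexive (sym (+-suc q n)))
... | no ne rewrite is-≢ ne = ≤-trans (cnt-run-bound (suc a) n lt) (≤-reflexive (sym (+-suc a n)))

run-below : ∀ a n {t} → a + n ≤ t → All (_< t) (run a n)
run-below a zero l = []
run-below a (suc n) l = ≤-trans (s≤s (m≤m+n a n)) l' ∷ run-below (suc a) n l'
  where l' = ≤-trans (≤-reflexive (sym (+-suc a n))) l

ge-run : ∀ a n → ge (a + n) (run a n) ≡ 0
ge-run a n = ge-none (run-below a n ≤-refl)

ge-antitone : ∀ {s t} w → s ≤ t → ge t w ≤ ge s w
ge-antitone [] l = z≤n
ge-antitone (c ∷ w) l = +-mono-≤ (go c l) (ge-antitone w l)
  where
  go : ∀ {s t} c → s ≤ t → geb t c ≤ geb s c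
  go {zero} {zero} c l = ≤-refl
  go {zero} {suc t} zero l = z≤n
  go {zero} {suc zero} (suc c) l = ≤-refl
  go {zero} {suc (suc t)} (suc c) l = go {zero} {suc t} c z≤n
  go {suc s} {suc t} zero (s≤s l) = z≤n
  go {suc s} {suc t} (suc c) (s≤s l) = go c l

cnt≤ge : ∀ q w → cnt q w ≤ ge q w
cnt≤ge q w = ≤-trans (m≤n+m _ _) (≤-reflexive (sym (ge-suc q w)))

-- What passing to rC and ℓC preserves.

NoBars NoPairs : List Ty → Set
NoBars = All (λ t → proj₂ t ≡ false)
NoPairs = All (λ t → t ≢ (true , true))

noBars⇒noPairs : ∀ {c} → NoBars c → NoPairs c
noBars⇒noPairs = All.map λ { refl () }

noPairs-pending : ∀ {c} → NoPairs c → pending c ≡ 0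
noPairs-pending [] = refl
noPairs-pending {(true , true) ∷ c} (n ∷ ns) = ⊥-elim (n refl)
noPairs-pending {(true , false) ∷ c} (n ∷ ns) = noPairs-pending ns
noPairs-pending {(false , true) ∷ c} (n ∷ ns) = noPairs-pending ns
noPairs-pending {(false , false) ∷ c} (n ∷ ns) = cong pred (noPairs-pending ns)

weight : Ty → ℕ
weight (a , b) = bit a + bit b

-- The common properties of `rTy` and `lTy`. Along a column, `balance` telescopes to the invariance
-- of the number of letters.
record Resolution (f : ℕ → Ty → Ty) : Set where
  field
    fixes    : ∀ {t} → t ≢ (true , true) → f 0 t ≡ t
    separate : ∀ h t → f h t ≢ (true , true)
    balance  : ∀ h t → weight (f h t) + step h t ≡ weight t + h
open Resolution

rRes : Resolution rTy
rRes .fixes {true , true} n = ⊥-elim (n refl)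
rRes .fixes {true , false} n = refl
rRes .fixes {false , true} n = refl
rRes .fixes {false , false} n = refl
rRes .separate h (true , true) ()
rRes .separate h (true , false) ()
rRes .separate h (false , true) ()
rRes .separate zero (false , false) ()
rRes .separate (suc h) (false , false) ()
rRes .balance h (true , true) = refl
rRes .balance h (true , false) = refl
rRes .balance h (false , true) = refl
rRes .balance zero (false , false) = refl
rRes .balance (suc h) (false , false) = refl

lRes : Resolution lTy
lRes .fixes {true , true} n = ⊥-elim (n refl)
lRes .fixes {true , false} n = refl
lRes .fixes {false , true} n = refl
lRes .fixes {false , false} n = refl
lRes .separate h (true , true) ()
lRes .separate h (true , false) ()
lRes .separate h (false , true) ()
lRes .separate zero (false , false) ()
lRes .separate (suc h) (false , false) ()
lRes .balance h (true , true) = refl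
lRes .balance h (true , false) = refl
lRes .balance h (false , true) = refl
lRes .balance zero (false , false) = refl
lRes .balance (suc h) (false , false) = refl

resolve-fixed : ∀ {f c} → Resolution f → NoPairs c → resolve f c ≡ c
resolve-fixed R [] = refl
resolve-fixed R (n ∷ ns) rewrite noPairs-pending ns = cong₂ _∷_ (R .fixes n) (resolve-fixed R ns)

resolve-noPairs : ∀ {f} → Resolution f → ∀ c → NoPairs (resolve f c)
resolve-noPairs R [] = []
resolve-noPairs R (t ∷ c) = R .separate (pending c) t ∷ resolve-noPairs R c

resolve-size : ∀ {f} → Resolution f → ∀ c → pending c ≡ 0 → size (resolve f c) ≡ size c
resolve-size {f} R c h = trans (sym (+-identityʳ _)) (trans (cong (size (resolve f c) +_) (sym h)) (go c))
  where
  go : ∀ c → size (resolve f c) + pending c ≡ size c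
  go [] = refl
  go (t ∷ c) = begin
    weight t' + size (resolve f c) + pending (t ∷ c)      ≡⟨ cong (weight t' + size (resolve f c) +_) (pending-step t c) ⟩
    weight t' + size (resolve f c) + step (pending c) t   ≡⟨ r (weight t') _ _ ⟩
    weight t' + step (pending c) t + size (resolve f c)   ≡⟨ cong (_+ size (resolve f c)) (R .balance (pending c) t) ⟩
    weight t + pending c + size (resolve f c)             ≡⟨ r (weight t) _ _ ⟩
    weight t + size (resolve f c) + pending c             ≡⟨ +-assoc (weight t) _ _ ⟩
    weight t + (size (resolve f c) + pending c)           ≡⟨ cong (weight t +_) (go c) ⟩
    weight t + size c                                     ∎
    where
    open ≡-Reasoning
    t' = f (pending c) t
    r : ∀ a b c → a + b + c ≡ a + c + b
    r = solve-∀

-- Single bars stay in rC, and a pair puts the bar of its t_k there; since no pair is left waiting,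
-- every bar of c leaves a trace in rC.
rT-noBars : ∀ {c} → pending c ≡ 0 → NoBars (rT c) → NoBars c
rT-noBars {[]} _ _ = []
rT-noBars {(true , false) ∷ c} e (n ∷ ns) = refl ∷ rT-noBars e ns
rT-noBars {(false , false) ∷ c} e (n ∷ ns) with pending c in eq
... | zero = refl ∷ rT-noBars eq ns

-- Apart from the waiting pairs, each pair is compensated by an absent value. An admissible column
-- therefore has at most m letters.
size-bound : ∀ c → size c ≤ length c + pending c
size-bound [] = z≤n
size-bound ((true , true) ∷ c) = s≤s (≤-trans (s≤s (size-bound c)) (≤-reflexive (sym (+-suc _ _))))
size-bound ((true , false) ∷ c) = s≤s (size-bound c)
size-bound ((false , true) ∷ c) = s≤s (size-bound c)
size-bound ((false , false) ∷ c) with pending c | size-bound c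
... | zero | l = ≤-trans l (n≤1+n _)
... | suc h | l = ≤-trans l (≤-reflexive (+-suc _ h))

size-twice : ∀ c → size c ≤ length c + length c
size-twice [] = z≤n
size-twice ((a , b) ∷ c) = ≤-trans (+-mono-≤ (+-mono-≤ (bit≤1 a) (bit≤1 b)) (size-twice c)) (s≤s (≤-reflexive (sym (+-suc _ _))))
  where
  bit≤1 : ∀ a → bit a ≤ 1
  bit≤1 true = ≤-refl
  bit≤1 false = z≤n

-- The order on letters, and columns as words.

<ᴸ-trans : ∀ {x y z} → x <ᴸ y → y <ᴸ z → x <ᴸ z
<ᴸ-trans (pp a) (pp b) = pp (<-trans a b)
<ᴸ-trans (pp a) pb = pb
<ᴸ-trans pb (bb b) = pb
<ᴸ-trans (bb a) (bb b) = bb (<-trans b a)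

<ᴸ-irrefl : ∀ {x} → ¬ x <ᴸ x
<ᴸ-irrefl (pp a) = <-irrefl refl a
<ᴸ-irrefl (bb a) = <-irrefl refl a

Sorted : Word → Set
Sorted = AllPairs _<ᴸ_

sorted : ∀ {w} → StrictInc w → Sorted w
sorted = Linked⇒AllPairs <ᴸ-trans

private
  shrink : ∀ {x y xs ys} → (∀ {z} → z ∈ x ∷ xs → z ∈ y ∷ ys) → All (x <ᴸ_) xs → x ≡ y → ∀ {z} → z ∈ xs → z ∈ ys
  shrink f x<xs refl z∈ with f (there z∈)
  ... | here refl = ⊥-elim (<ᴸ-irrefl (All.lookup x<xs z∈))
  ... | there r = r

  skip : ∀ {x y xs ys} → (∀ {z} → z ∈ x ∷ xs → z ∈ y ∷ ys) → All (x <ᴸ_) xs →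
         All (y <ᴸ_) ys → x ∈ ys → ∀ {z} → z ∈ x ∷ xs → z ∈ ys
  skip f x<xs y<ys x∈ys (here refl) = x∈ys
  skip f x<xs y<ys x∈ys (there z∈) with f (there z∈)
  ... | here refl = ⊥-elim (<ᴸ-irrefl (<ᴸ-trans (All.lookup y<ys x∈ys) (All.lookup x<xs z∈)))
  ... | there r = r

sorted-⊆-length : ∀ {xs ys} → Sorted xs → Sorted ys → (∀ {z} → z ∈ xs → z ∈ ys) → length xs ≤ length ys
sorted-⊆-length [] _ f = z≤n
sorted-⊆-length (x<xs ∷ s) [] f = case f (here refl) of λ ()
sorted-⊆-length (x<xs ∷ s) (y<ys ∷ t) f with f (here refl)
... | here refl = s≤s (sorted-⊆-length s t (shrink f x<xs refl))
... | there x∈ = ≤-trans (sorted-⊆-length (x<xs ∷ s) t (skip f x<xs y<ys x∈)) (n≤1+n _)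

-- With this, one inclusion and a count identify rC and ℓC later; the converse inclusion never has
-- to be traced through the definitions.
sorted-⊆-≡ : ∀ {xs ys} → Sorted xs → Sorted ys → (∀ {z} → z ∈ xs → z ∈ ys) → length ys ≤ length xs → xs ≡ ys
sorted-⊆-≡ [] [] f l = refl
sorted-⊆-≡ (x<xs ∷ s) [] f l = case f (here refl) of λ ()
sorted-⊆-≡ (x<xs ∷ s) (y<ys ∷ t) f (s≤s l) with f (here refl)
... | here refl = cong (_ ∷_) (sorted-⊆-≡ s t (shrink f x<xs refl) l)
... | there x∈ = ⊥-elim (<⇒≱ (s≤s l) (sorted-⊆-length (x<xs ∷ s) t (skip f x<xs y<ys x∈)))

optP optB : Bool → ℕ → Word
optP true k = pos k ∷ []
optP false k = []
optB true k = bar k ∷ []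
optB false k = []

-- Built from the outside in: the value k contributes k at the top and its bar at the bottom, and
-- all larger values lie between, as in the order of [±m].
wordL : ℕ → List Ty → Word
wordL k [] = []
wordL k ((a , b) ∷ cs) = optP a k ++ wordL (suc k) cs ++ optB b k

data Has : ℕ → List Ty → ℕ → Ty → Set where
  here  : ∀ {k t cs} → Has k (t ∷ cs) k t
  there : ∀ {k s cs i t} → Has (suc k) cs i t → Has k (s ∷ cs) i t

has-≥ : ∀ {k c i t} → Has k c i t → k ≤ i
has-≥ here = ≤-refl
has-≥ (there h) = ≤-trans (n≤1+n _) (has-≥ h)

has-< : ∀ {k c i t} → Has k c i t → i < k + length c
has-< {k} here = ≤-trans (≤-reflexive (+-comm 1 k)) (+-monoʳ-≤ k (s≤s z≤n))
has-< {k} (there h) = ≤-trans (has-< h) (≤-reflexive (sym (+-suc k _)))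

has-unique : ∀ {k c i s t} → Has k c i s → Has k c i t → s ≡ t
has-unique here here = refl
has-unique here (there h) = ⊥-elim (<-irrefl refl (has-≥ h))
has-unique (there h) here = ⊥-elim (<-irrefl refl (has-≥ h))
has-unique (there h) (there h') = has-unique h h'

has-at : ∀ {k c i} → k ≤ i → i < k + length c → ∃ (Has k c i)
has-at {k} {[]} l u = ⊥-elim (<⇒≱ u (≤-trans (≤-reflexive (+-identityʳ k)) l))
has-at {k} {t ∷ c} {i} l u with k ≟ i
... | yes refl = t , here
... | no n = let s , h = has-at (≤∧≢⇒< l n) (≤-trans u (≤-reflexive (+-suc k _))) in s , there h

pos⁺ : ∀ {k c i b} → Has k c i (true , b) → pos i ∈ wordL k c
pos⁺ here = here refl
pos⁺ {k} (there {s = a , b} h) = ∈-++⁺ʳ (optP a k) (∈-++⁺ˡ (pos⁺ h))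

bar⁺ : ∀ {k c i a} → Has k c i (a , true) → bar i ∈ wordL k c
bar⁺ {k} {_ ∷ cs} {a = a} here = ∈-++⁺ʳ (optP a k) (∈-++⁺ʳ (wordL (suc k) cs) (here refl))
bar⁺ {k} (there {s = a , b} h) = ∈-++⁺ʳ (optP a k) (∈-++⁺ˡ (bar⁺ h))

letter⁻ : ∀ {k c x} → x ∈ wordL k c →
          (Σ ℕ λ i → Σ Bool λ b → x ≡ pos i × Has k c i (true , b)) ⊎ (Σ ℕ λ i → Σ Bool λ a → x ≡ bar i × Has k c i (a , true))
letter⁻ {k} {(a , b) ∷ cs} x∈ with ∈-++⁻ (optP a k) x∈
letter⁻ {k} {(true , b) ∷ cs} x∈ | inj₁ (here refl) = inj₁ (k , b , refl , here)
... | inj₂ y with ∈-++⁻ (wordL (suc k) cs) y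
letter⁻ {k} {(a , true) ∷ cs} x∈ | inj₂ y | inj₂ (here refl) = inj₂ (k , a , refl , here)
... | inj₁ z with letter⁻ z
... | inj₁ (i , b' , e , h) = inj₁ (i , b' , e , there h)
... | inj₂ (i , a' , e , h) = inj₂ (i , a' , e , there h)

pos⁻ : ∀ {k c i} → pos i ∈ wordL k c → Σ Bool λ b → Has k c i (true , b)
pos⁻ x∈ with letter⁻ x∈
... | inj₁ (_ , b , refl , h) = b , h

bar⁻ : ∀ {k c i} → bar i ∈ wordL k c → Σ Bool λ a → Has k c i (a , true)
bar⁻ x∈ with letter⁻ x∈
... | inj₂ (_ , a , refl , h) = a , h

AbsIn : ℕ → ℕ → L → Set
AbsIn a b x = a ≤ ∣ x ∣ᴸ × ∣ x ∣ᴸ < b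

wordL-abs : ∀ k c → All (AbsIn k (k + length c)) (wordL k c)
wordL-abs k c = All.tabulate λ x∈ → case letter⁻ {k} {c} x∈ of λ
  { (inj₁ (i , _ , refl , h)) → has-≥ h , has-< h
  ; (inj₂ (i , _ , refl , h)) → has-≥ h , has-< h }

wordL-sorted : ∀ k c → Sorted (wordL k c)
wordL-sorted k [] = []
wordL-sorted k ((a , b) ∷ cs) = AllPairs-++⁺ (oneP a) (AllPairs-++⁺ (wordL-sorted (suc k) cs) (oneB b)
    (All.map (λ {x} p → lowB b {x} (proj₁ p)) W))
    (lowP a (All-++⁺ (All.map (λ {x} p → posk<  {x} (proj₁ p)) W) (pkb b)))
  where
  W = wordL-abs (suc k) cs
  oneP : ∀ a → Sorted (optP a k)
  oneP true = [] ∷ []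
  oneP false = []
  oneB : ∀ b → Sorted (optB b k)
  oneB true = [] ∷ []
  oneB false = []
  lowB : ∀ b {x} → suc k ≤ ∣ x ∣ᴸ → All (x <ᴸ_) (optB b k)
  lowB true {pos i} l = pb ∷ []
  lowB true {bar i} l = bb l ∷ []
  lowB false l = []
  posk< : ∀ {x} → suc k ≤ ∣ x ∣ᴸ → pos k <ᴸ x
  posk< {pos i} l = pp l
  posk< {bar i} l = pb
  pkb : ∀ b → All (pos k <ᴸ_) (optB b k)
  pkb true = pb ∷ []
  pkb false = []
  lowP : ∀ a {ys} → All (pos k <ᴸ_) ys → All (λ x → All (x <ᴸ_) ys) (optP a k)
  lowP true l = l ∷ []
  lowP false l = []

≡ᵇ-refl : ∀ i → (i ≡ᵇ i) ≡ true
≡ᵇ-refl zero = refl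
≡ᵇ-refl (suc i) = ≡ᵇ-refl i

eqb-refl : ∀ x → eqb x x ≡ true
eqb-refl (pos i) = ≡ᵇ-refl i
eqb-refl (bar i) = ≡ᵇ-refl i

eqb-≡ : ∀ x y → eqb x y ≡ true → x ≡ y
eqb-≡ (pos i) (pos j) e = cong pos (≡ᵇ⇒≡ i j (subst T (sym e) tt))
eqb-≡ (bar i) (bar j) e = cong bar (≡ᵇ⇒≡ i j (subst T (sym e) tt))

inb⁺ : ∀ {x w} → x ∈ w → inb x w ≡ true
inb⁺ {x} (here refl) rewrite eqb-refl x = refl
inb⁺ {x} {y ∷ w} (there x∈) with eqb x y
... | true = refl
... | false = inb⁺ x∈

inb⁻ : ∀ {x} w → inb x w ≡ true → x ∈ w
inb⁻ {x} (y ∷ w) e with eqb x y in eq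
... | true = here (eqb-≡ x y eq)
... | false = there (inb⁻ w e)

typesFrom : ℕ → ℕ → Word → List Ty
typesFrom k zero w = []
typesFrom k (suc n) w = (inb (pos k) w , inb (bar k) w) ∷ typesFrom (suc k) n w

length-types : ∀ k n w → length (typesFrom k n w) ≡ n
length-types k zero w = refl
length-types k (suc n) w = cong suc (length-types (suc k) n w)

has-types : ∀ {k i t} n w → Has k (typesFrom k n w) i t → t ≡ (inb (pos i) w , inb (bar i) w)
has-types (suc n) w here = refl
has-types (suc n) w (there h) = has-types n w h

types-has : ∀ {k i} n w → k ≤ i → i < k + n → Has k (typesFrom k n w) i (inb (pos i) w , inb (bar i) w)
types-has {k} {i} n w l u with has-at {c = typesFrom k n w} l (≤-trans u (≤-reflexive (cong (k +_) (sym (length-types k n w)))))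
... | t , h = subst (Has k (typesFrom k n w) i) (has-types n w h) h

types : ℕ → Word → List Ty
types m w = typesFrom 1 m w

types-word : ∀ {m w} → StrictInc w → ValidW m w → wordL 1 (types m w) ≡ w
types-word {m} {w} s v = sorted-⊆-≡ (wordL-sorted 1 (types m w)) (sorted s) to
    (sorted-⊆-length (sorted s) (wordL-sorted 1 (types m w)) from)
  where
  to : ∀ {z} → z ∈ wordL 1 (types m w) → z ∈ w
  to z∈ with letter⁻ {1} {types m w} z∈
  ... | inj₁ (i , b , refl , h) = inb⁻ w (sym (cong proj₁ (has-types m w h)))
  ... | inj₂ (i , a , refl , h) = inb⁻ w (sym (cong proj₂ (has-types m w h)))
  from : ∀ {z} → z ∈ w → z ∈ wordL 1 (types m w)
  from {pos i} z∈ = let l , u = All.lookup v z∈ in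
    pos⁺ (subst (λ a → Has 1 (types m w) i (a , inb (bar i) w)) (inb⁺ z∈) (types-has m w l (s≤s u)))
  from {bar i} z∈ = let l , u = All.lookup v z∈ in
    bar⁺ (subst (λ b → Has 1 (types m w) i (inb (pos i) w , b)) (inb⁺ z∈) (types-has m w l (s≤s u)))

private
  at-++ : ∀ (u : Word) x v → At (u ++ x ∷ v) (length u) x
  at-++ [] x v = refl
  at-++ (y ∷ u) x v = at-++ u x v

  regroupᴸ : ∀ (u a w b v : Word) → u ++ (a ++ w ++ b) ++ v ≡ (u ++ a) ++ w ++ (b ++ v)
  regroupᴸ u a w b v = trans (cong (u ++_) (trans (++-assoc a (w ++ b) v) (cong (a ++_) (++-assoc w b v))))
                             (sym (++-assoc u a (w ++ (b ++ v))))

-- Admissibility and K5 read off from types.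

Balanced : Word → Set
Balanced C = ∀ i a b → At C a (pos i) → At C b (bar i) → suc a + (length C ∸ b) ≤ i

-- The words u and v hold the letters of absolute value below k. Each of the k - 1 values gives one
-- letter, except absent values (none) and pairs (two), so the lengths of u and v add up to k - 1 -
-- d. Balance at a pair k asks that this sum plus 2 be at most k, that is, d > 0.
balanced-adm : ∀ k c u v d → suc (length u + length v + d) ≡ k → Balanced (u ++ wordL k c ++ v) → Adm d c
balanced-adm k [] u v d eq B = []
balanced-adm k ((false , false) ∷ cs) u v d eq B =
  none (balanced-adm (suc k) cs u v (suc d) (cong suc (trans (+-suc _ d) eq))
    (subst (λ w → Balanced (u ++ w ++ v)) (++-identityʳ (wordL (suc k) cs)) B))
balanced-adm k ((true , false) ∷ cs) u v d eq B =
  pos₁ (balanced-adm (suc k) cs (u ++ pos k ∷ []) v d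
    (cong suc (trans (cong (λ x → x + length v + d) (trans (length-++ u) (+-comm _ 1))) eq))
    (subst Balanced (regroupᴸ u (pos k ∷ []) (wordL (suc k) cs) [] v) B))
balanced-adm k ((false , true) ∷ cs) u v d eq B =
  bar₁ (balanced-adm (suc k) cs u (bar k ∷ v) d
    (cong suc (trans (cong (_+ d) (+-suc (length u) (length v))) eq))
    (subst Balanced (trans (regroupᴸ u [] (wordL (suc k) cs) (bar k ∷ []) v) (cong (_++ _) (++-identityʳ u))) B))
balanced-adm k ((true , true) ∷ cs) u v d eq B = finish d eq
  where
  W = wordL (suc k) cs
  B' : Balanced ((u ++ pos k ∷ []) ++ W ++ (bar k ∷ v))
  B' = subst Balanced (regroupᴸ u (pos k ∷ []) W (bar k ∷ []) v) B
  C = (u ++ pos k ∷ []) ++ W ++ (bar k ∷ v)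
  C≡ : C ≡ (u ++ pos k ∷ W) ++ bar k ∷ v
  C≡ = trans (++-assoc u (pos k ∷ []) _) (sym (++-assoc u (pos k ∷ W) (bar k ∷ v)))
  le : suc (length u) + (length C ∸ length (u ++ pos k ∷ W)) ≤ k
  le = B' k (length u) (length (u ++ pos k ∷ W))
    (subst (λ X → At X (length u) (pos k)) (sym (++-assoc u (pos k ∷ []) _)) (at-++ u (pos k) _))
    (subst (λ X → At X (length (u ++ pos k ∷ W)) (bar k)) (sym C≡) (at-++ (u ++ pos k ∷ W) (bar k) v))
  le' : suc (length u) + suc (length v) ≤ k
  le' = subst (λ x → suc (length u) + x ≤ k)
    (trans (cong (_∸ length (u ++ pos k ∷ W)) (trans (cong length C≡) (trans (length-++ (u ++ pos k ∷ W)) (+-comm _ (suc (length v))))))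
      (m+n∸n≡m (suc (length v)) (length (u ++ pos k ∷ W)))) le
  finish : ∀ d → suc (length u + length v + d) ≡ k → Adm d ((true , true) ∷ cs)
  finish zero eq = ⊥-elim (<⇒≱ (≤-reflexive (trans (cong suc (sym eq)) (r (length u) (length v)))) le')
    where
    r : ∀ a b → suc (suc (a + b + 0)) ≡ suc a + suc b
    r = solve-∀
  finish (suc d) eq = both (balanced-adm (suc k) cs (u ++ pos k ∷ []) (bar k ∷ v) d
    (trans (cong (λ x → suc (x + suc (length v) + d)) (length-++ u))
      (trans (r (length u) (length v) d) (cong suc eq))) B')
    where
    r : ∀ a b d → suc (a + 1 + suc b + d) ≡ suc (suc (a + b + suc d))
    r = solve-∀

admissible-adm : ∀ {c} → Admissible (wordL 1 c) → Adm 0 c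
admissible-adm {c} (_ , B) = balanced-adm 1 c [] [] 0 refl (subst Balanced (sym (++-identityʳ (wordL 1 c))) B)

-- Contract without its condition on the types after the removed pair. That condition comes from the
-- admissibility of the word without its first letter.
data Hit : ℕ → List Ty → List Ty → Set where
  hit   : ∀ {cs} → Hit 0 ((true , true) ∷ cs) ((false , false) ∷ cs)
  none  : ∀ {d cs cs'} → Hit (suc d) cs cs' → Hit d ((false , false) ∷ cs) ((false , false) ∷ cs')
  bar₁  : ∀ {d cs cs'} → Hit d cs cs' → Hit d ((false , true) ∷ cs) ((false , true) ∷ cs')
  pos₁  : ∀ {d cs cs'} → Hit d cs cs' → Hit d ((true , false) ∷ cs) ((true , false) ∷ cs')
  both  : ∀ {d cs cs'} → Hit d cs cs' → Hit (suc d) ((true , true) ∷ cs) ((true , true) ∷ cs')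

-- The removal of the first letter of a column that has an unbarred letter, as every column with a
-- pair does.
dropFirst : List Ty → List Ty
dropFirst [] = []
dropFirst ((true , b) ∷ cs) = (false , b) ∷ cs
dropFirst ((false , b) ∷ cs) = (false , b) ∷ dropFirst cs

-- The additional unit of excess carries admissibility past the removed pair, and the types after it
-- are then reached with excess 0, as `Contract` demands.
hit-adm : ∀ {d c c'} → Hit d c c' → Adm (suc d) c → Contract d c c'
hit-adm hit (both x) = hit x
hit-adm (none h) (none x) = none (hit-adm h x)
hit-adm (bar₁ h) (bar₁ x) = bar₁ (hit-adm h x)
hit-adm (pos₁ h) (pos₁ x) = pos₁ (hit-adm h x)
hit-adm (both h) (both x) = both (hit-adm h x)

-- From its first letter on, the shortened column has an excess larger by one, whether a single
-- letter or half of a pair was taken away.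
hit-dropFirst : ∀ {d c c'} → Hit d c c' → Adm d (dropFirst c) → Contract d c c'
hit-dropFirst hit (bar₁ x) = hit x
hit-dropFirst (none h) (none x) = none (hit-dropFirst h x)
hit-dropFirst (bar₁ h) (bar₁ x) = bar₁ (hit-dropFirst h x)
hit-dropFirst (pos₁ h) (none x) = pos₁ (hit-adm h x)
hit-dropFirst (both h) (bar₁ x) = both (hit-adm h x)

wordL-dropFirst : ∀ {k c i b} → Has k c i (true , b) → Σ L λ x → wordL k c ≡ x ∷ wordL k (dropFirst c)
wordL-dropFirst {k} here = pos k , refl
wordL-dropFirst {k} (there {s = true , b} h) = pos k , refl
wordL-dropFirst {k} (there {s = false , b} h) = let x , e = wordL-dropFirst h in x , cong (_++ optB b k) e

countLe-++ : ∀ z u v → countLe z (u ++ v) ≡ countLe z u + countLe z v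
countLe-++ z u v = trans (cong length (filter-++ (λ x → ∣ x ∣ᴸ ≤? z) u v)) (length-++ (filter (λ x → ∣ x ∣ᴸ ≤? z) u))

countLe-all : ∀ {z w} → All (λ x → ∣ x ∣ᴸ ≤ z) w → countLe z w ≡ length w
countLe-all a = cong length (filter-all _ a)

countLe-none : ∀ {z w} → All (λ x → z < ∣ x ∣ᴸ) w → countLe z w ≡ 0
countLe-none a = cong length (filter-none _ (All.map <⇒≱ a))

removeZ-++ : ∀ z u v → removeZ z (u ++ v) ≡ removeZ z u ++ removeZ z v
removeZ-++ z [] v = refl
removeZ-++ z (x ∷ u) v with eqb x (pos z)
... | true = removeZ-++ z u v
... | false with eqb x (bar z)
... | true = removeZ-++ z u v
... | false = cong (x ∷_) (removeZ-++ z u v)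

removeZ-other : ∀ {z w} → All (λ x → ∣ x ∣ᴸ ≢ z) w → removeZ z w ≡ w
removeZ-other [] = refl
removeZ-other {z} {x ∷ w} (n ∷ ns) with eqb x (pos z) in e
... | true = ⊥-elim (n (cong ∣_∣ᴸ (eqb-≡ x (pos z) e)))
... | false with eqb x (bar z) in e'
... | true = ⊥-elim (n (cong ∣_∣ᴸ (eqb-≡ x (bar z) e')))
... | false = cong (x ∷_) (removeZ-other ns)

removeZ-opts : ∀ {k z} a b w → k ≢ z → removeZ z (optP a k ++ w ++ optB b k) ≡ optP a k ++ removeZ z w ++ optB b k
removeZ-opts {k} {z} a b w n = trans (removeZ-++ z (optP a k) (w ++ optB b k)) (cong₂ _++_ (removeZ-other (oP a))
    (trans (removeZ-++ z w (optB b k)) (cong (removeZ z w ++_) (removeZ-other (oB b)))))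
  where
  oP : ∀ a → All (λ x → ∣ x ∣ᴸ ≢ z) (optP a k)
  oP true = n ∷ []
  oP false = []
  oB : ∀ b → All (λ x → ∣ x ∣ᴸ ≢ z) (optB b k)
  oB true = n ∷ []
  oB false = []

count-pair : ∀ k cs u v → All (λ x → ∣ x ∣ᴸ < k) u → All (λ x → ∣ x ∣ᴸ < k) v →
  countLe k (u ++ wordL k ((true , true) ∷ cs) ++ v) ≡ suc (suc (length u + length v))
count-pair k cs u v U V = trans (cong (countLe k) (regroupᴸ u (pos k ∷ []) W (bar k ∷ []) v))
    (trans (countLe-++ k (u ++ pos k ∷ []) _) (trans (cong₂ _+_
      (trans (countLe-all (All-++⁺ (All.map <⇒≤ U) (≤-refl ∷ []))) (trans (length-++ u) (+-comm _ 1)))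
      (trans (countLe-++ k W (bar k ∷ v)) (cong₂ _+_ (countLe-none (All.map proj₁ (wordL-abs (suc k) cs)))
        (countLe-all {k} {bar k ∷ v} (≤-refl ∷ All.map <⇒≤ V)))))
      (cong suc (+-suc (length u) (length v)))))
  where W = wordL (suc k) cs

-- At a pair k there are k + 1 - d letters of absolute value at most k, so a bad value is a pair met
-- with excess 0. Minimality of z excludes such a pair on the way, and `Hit` stops exactly at z.
find-hit : ∀ {k c z} u v d → Has k c z (true , true) → suc (length u + length v + d) ≡ k →
  All (λ x → ∣ x ∣ᴸ < k) u → All (λ x → ∣ x ∣ᴸ < k) v → MinBadZ (u ++ wordL k c ++ v) z →
  Σ (List Ty) λ c' → Hit d c c' × wordL k c' ≡ removeZ z (wordL k c)
find-hit {k} {_ ∷ cs} u v d here eq U V ((_ , _ , _ , bad) , _) = finish d eq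
  where
  W = wordL (suc k) cs
  W> : All (λ x → k < ∣ x ∣ᴸ) W
  W> = All.map proj₁ (wordL-abs (suc k) cs)
  removed : wordL (suc k) cs ++ [] ≡ removeZ k (pos k ∷ W ++ bar k ∷ [])
  removed rewrite eqb-refl (pos k) | removeZ-++ k W (bar k ∷ []) | eqb-refl (bar k) =
    cong (_++ []) (sym (removeZ-other (All.map (λ l e → <⇒≢ l (sym e)) W>)))
  finish : ∀ d → suc (length u + length v + d) ≡ k →
    Σ (List Ty) λ c' → Hit d ((true , true) ∷ cs) c' × wordL k c' ≡ removeZ k (pos k ∷ W ++ bar k ∷ [])
  finish zero eq = (false , false) ∷ cs , hit , removed
  finish (suc d) eq = ⊥-elim (<⇒≱ (subst (k <_) (count-pair k cs u v U V) bad)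
    (≤-trans (s≤s (≤-trans (s≤s (m≤m+n (length u + length v) d)) (≤-reflexive (sym (+-suc _ d))))) (≤-reflexive eq)))
find-hit {k} {(a , b) ∷ cs} {z} u v d (there h) eq U V M = go a b d eq M
  where
  W = wordL (suc k) cs
  k≢z : k ≢ z
  k≢z = <⇒≢ (has-≥ h)
  U' = All.map (λ l → ≤-trans l (n≤1+n k)) U
  V' = All.map (λ l → ≤-trans l (n≤1+n k)) V
  ext : ∀ a b {c'} → wordL (suc k) c' ≡ removeZ z W → wordL k ((a , b) ∷ c') ≡ removeZ z (wordL k ((a , b) ∷ cs))
  ext a b e = trans (cong (λ w → optP a k ++ w ++ optB b k) e) (sym (removeZ-opts a b W k≢z))
  go : ∀ a b d → suc (length u + length v + d) ≡ k → MinBadZ (u ++ wordL k ((a , b) ∷ cs) ++ v) z →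
    Σ (List Ty) λ c' → Hit d ((a , b) ∷ cs) c' × wordL k c' ≡ removeZ z (wordL k ((a , b) ∷ cs))
  go false false d eq M =
    let c' , H , e = find-hit u v (suc d) h (cong suc (trans (+-suc _ d) eq)) U' V'
                       (subst (λ w → MinBadZ (u ++ w ++ v) z) (++-identityʳ W) M)
    in (false , false) ∷ c' , none H , ext false false {c'} e
  go true false d eq M =
    let c' , H , e = find-hit (u ++ pos k ∷ []) v d h
                       (cong suc (trans (cong (λ x → x + length v + d) (trans (length-++ u) (+-comm _ 1))) eq))
                       (All-++⁺ U' (≤-refl ∷ [])) V' (subst (λ w → MinBadZ w z) (regroupᴸ u (pos k ∷ []) W [] v) M)
    in (true , false) ∷ c' , pos₁ H , ext true false {c'} e
  go false true d eq M =
    let c' , H , e = find-hit u (bar k ∷ v) d h (cong suc (trans (cong (_+ d) (+-suc (length u) (length v))) eq))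
                       U' (≤-refl ∷ V') (subst (λ w → MinBadZ w z)
                         (trans (regroupᴸ u [] W (bar k ∷ []) v) (cong (_++ _) (++-identityʳ u))) M)
    in (false , true) ∷ c' , bar₁ H , ext false true {c'} e
  go true true zero eq (_ , min) = ⊥-elim (min k (has-≥ h) (≤-trans (s≤s z≤n) (≤-reflexive eq) ,
      ∈-++⁺ʳ u (∈-++⁺ˡ {xs = wordL k ((true , true) ∷ cs)} (here refl)) ,
      ∈-++⁺ʳ u (∈-++⁺ˡ {xs = wordL k ((true , true) ∷ cs)} (there (∈-++⁺ʳ W (here refl)))) ,
      ≤-reflexive (sym (trans (count-pair k cs u v U V) (cong suc (trans (cong suc (sym (+-identityʳ _))) eq))))))
  go true true (suc d) eq M =
    let c' , H , e = find-hit (u ++ pos k ∷ []) (bar k ∷ v) d h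
                       (trans (cong (λ x → suc (x + suc (length v) + d)) (length-++ u)) (trans (r (length u) (length v) d) (cong suc eq)))
                       (All-++⁺ U' (≤-refl ∷ [])) (≤-refl ∷ V')
                       (subst (λ w → MinBadZ w z) (regroupᴸ u (pos k ∷ []) W (bar k ∷ []) v) M)
    in (true , true) ∷ c' , both H , ext true true {c'} e
    where
    r : ∀ a b d → suc (a + 1 + suc b + d) ≡ suc (suc (a + b + suc d))
    r = solve-∀

-- Knuth paths may leave [±n] but never reach the absolute value 0. Together with an upper bound
-- this makes all words of a path valid in one rank.
Positive : Word → Set
Positive = All (λ x → 1 ≤ ∣ x ∣ᴸ)

maxAbs : Word → ℕ
maxAbs [] = 0
maxAbs (x ∷ w) = ∣ x ∣ᴸ ⊔ maxAbs w

valid : ∀ {m w} → Positive w → maxAbs w ≤ m → ValidW m w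
valid [] _ = []
valid {m} {pos i ∷ w} (p ∷ ps) l = (p , ≤-trans (m≤m⊔n i (maxAbs w)) l) ∷ valid ps (≤-trans (m≤n⊔m i (maxAbs w)) l)
valid {m} {bar i ∷ w} (p ∷ ps) l = (p , ≤-trans (m≤m⊔n i (maxAbs w)) l) ∷ valid ps (≤-trans (m≤n⊔m i (maxAbs w)) l)

removeZ-positive : ∀ z w → Positive w → Positive (removeZ z w)
removeZ-positive z [] [] = []
removeZ-positive z (x ∷ w) (p ∷ ps) with eqb x (pos z)
... | true = removeZ-positive z w ps
... | false with eqb x (bar z)
... | true = removeZ-positive z w ps
... | false = p ∷ removeZ-positive z w ps

removeZ-positive⁻ : ∀ z w → 1 ≤ z → Positive (removeZ z w) → Positive w
removeZ-positive⁻ z [] l ps = []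
removeZ-positive⁻ z (x ∷ w) l ps with eqb x (pos z) in e
... | true = subst (1 ≤_) (sym (cong ∣_∣ᴸ (eqb-≡ x (pos z) e))) l ∷ removeZ-positive⁻ z w l ps
... | false with eqb x (bar z) in e'
... | true = subst (1 ≤_) (sym (cong ∣_∣ᴸ (eqb-≡ x (bar z) e'))) l ∷ removeZ-positive⁻ z w l ps
removeZ-positive⁻ z (x ∷ w) l (p ∷ ps) | false | false = p ∷ removeZ-positive⁻ z w l ps

kstep-positive : ∀ {n x y} → KStep n x y → Positive x → Positive y
kstep-positive (k1 _ _ _) (a ∷ b ∷ c ∷ []) = b ∷ a ∷ c ∷ []
kstep-positive (k2 _ _ _) (a ∷ b ∷ c ∷ []) = a ∷ c ∷ b ∷ []
kstep-positive (k3 l _ _ _) (a ∷ b ∷ c ∷ []) = l ∷ l ∷ c ∷ []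
kstep-positive (k4 l _ _ _) (a ∷ b ∷ c ∷ []) = a ∷ s≤s z≤n ∷ s≤s z≤n ∷ []
kstep-positive (k5 {w} {z} _ _ _ _) p = removeZ-positive z w p

kstep-positive⁻ : ∀ {n x y} → KStep n x y → Positive y → Positive x
kstep-positive⁻ (k1 _ _ _) (a ∷ b ∷ c ∷ []) = b ∷ a ∷ c ∷ []
kstep-positive⁻ (k2 _ _ _) (a ∷ b ∷ c ∷ []) = a ∷ c ∷ b ∷ []
kstep-positive⁻ (k3 l _ _ _) (a ∷ b ∷ c ∷ []) = s≤s z≤n ∷ s≤s z≤n ∷ c ∷ []
kstep-positive⁻ (k4 l _ _ _) (a ∷ b ∷ c ∷ []) = a ∷ l ∷ l ∷ []
kstep-positive⁻ (k5 {w} {z} _ _ _ ((l , _) , _)) p = removeZ-positive⁻ z w l p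

in-context : ∀ {P : L → Set} u {x y} v → (All P x → All P y) → All P (u ++ x ++ v) → All P (u ++ y ++ v)
in-context u {x} v f p = let q = All-++⁻ʳ u p in All-++⁺ (All-++⁻ˡ u p) (All-++⁺ (f (All-++⁻ˡ x q)) (All-++⁻ʳ x q))

context-middle : ∀ {P : L → Set} u {x} v → All P (u ++ x ++ v) → All P x
context-middle u {x} v p = All-++⁻ˡ x (All-++⁻ʳ u p)

-- The values z_k and t_k, and the words rC and ℓC.

pairsIn : Word → Word → List ℕ
pairsIn C [] = []
pairsIn C (pos z ∷ xs) = if inb (bar z) C then z ∷ pairsIn C xs else pairsIn C xs
pairsIn C (bar z ∷ xs) = pairsIn C xs

-- The local function of zsOf cannot be named outside Defs: the left-hand side of
-- zsOf-local is solved by unification at its uses in zsOf-pairs.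
mutual
  zsOf-pairs : ∀ C → zsOf C ≡ reverse (pairsIn C C)
  zsOf-pairs [] = refl
  zsOf-pairs (pos z ∷ xs) with pos z ∷ xs
  ... | D = cong (λ w → reverse (if inb (bar z) xs then z ∷ w else w)) (zsOf-local D xs)
  zsOf-pairs (bar z ∷ xs) with bar z ∷ xs
  ... | D = cong reverse (zsOf-local D xs)

  zsOf-local : ∀ D xs → _ ≡ pairsIn D xs
  zsOf-local D [] = refl
  zsOf-local D (pos z ∷ xs) = cong (λ w → if inb (bar z) D then z ∷ w else w) (zsOf-local D xs)
  zsOf-local D (bar z ∷ xs) = zsOf-local D xs

pairsIn-++ : ∀ C u v → pairsIn C (u ++ v) ≡ pairsIn C u ++ pairsIn C v
pairsIn-++ C [] v = refl
pairsIn-++ C (pos z ∷ u) v with inb (bar z) C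
... | true = cong (z ∷_) (pairsIn-++ C u v)
... | false = pairsIn-++ C u v
pairsIn-++ C (bar z ∷ u) v = pairsIn-++ C u v

pairs : ℕ → List Ty → List ℕ
pairs k [] = []
pairs k ((true , true) ∷ cs) = pairs (suc k) cs ++ k ∷ []
pairs k ((true , false) ∷ cs) = pairs (suc k) cs
pairs k ((false , _) ∷ cs) = pairs (suc k) cs

∈-pairs : ∀ {k c i} → Has k c i (true , true) → i ∈ pairs k c
∈-pairs {k} {_ ∷ cs} here = ∈-++⁺ʳ (pairs (suc k) cs) (here refl)
∈-pairs (there {s = true , true} h) = ∈-++⁺ˡ (∈-pairs h)
∈-pairs (there {s = true , false} h) = ∈-pairs h
∈-pairs (there {s = false , _} h) = ∈-pairs h

pairs-≤ : ∀ {B} k c → k + length c ≤ suc B → All (_≤ B) (pairs k c)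
pairs-≤ k [] l = []
pairs-≤ k (t ∷ cs) l with ≤-trans (≤-reflexive (sym (+-suc k (length cs)))) l
pairs-≤ k ((true , true) ∷ cs) l | l' = All-++⁺ (pairs-≤ (suc k) cs l') (≤-pred (≤-trans (s≤s (m≤m+n k _)) l') ∷ [])
pairs-≤ k ((true , false) ∷ cs) l | l' = pairs-≤ (suc k) cs l'
pairs-≤ k ((false , _) ∷ cs) l | l' = pairs-≤ (suc k) cs l'

inb-false : ∀ {x} w → ¬ x ∈ w → inb x w ≡ false
inb-false {x} w n with inb x w in e
... | true = ⊥-elim (n (inb⁻ w e))
... | false = refl

inb-pos : ∀ {c i a b} → Has 1 c i (a , b) → inb (pos i) (wordL 1 c) ≡ a
inb-pos {a = true} h = inb⁺ (pos⁺ h)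
inb-pos {c} {a = false} h = inb-false (wordL 1 c) λ x∈ → case cong proj₁ (has-unique h (proj₂ (pos⁻ {1} {c} x∈))) of λ ()

inb-bar : ∀ {c i a b} → Has 1 c i (a , b) → inb (bar i) (wordL 1 c) ≡ b
inb-bar {b = true} h = inb⁺ (bar⁺ h)
inb-bar {c} {b = false} h = inb-false (wordL 1 c) λ x∈ → case cong proj₂ (has-unique h (proj₂ (bar⁻ {1} {c} x∈))) of λ ()

freeb-type : ∀ {c i a b} → Has 1 c i (a , b) → freeb (wordL 1 c) i ≡ not a ∧ not b
freeb-type h rewrite inb-pos h | inb-bar h = refl

Suffix : ℕ → List Ty → List Ty → Set
Suffix k cs c = ∀ {i t} → Has k cs i t → Has 1 c i t

pairsIn-word : ∀ {c} k cs → Suffix k cs c → reverse (pairsIn (wordL 1 c) (wordL k cs)) ≡ pairs k cs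
pairsIn-word k [] S = refl
pairsIn-word {c} k ((a , b) ∷ cs) S = trans (cong reverse flat) (go a b S)
  where
  C = wordL 1 c
  bars : ∀ b → pairsIn C (optB b k) ≡ []
  bars true = refl
  bars false = refl
  flat : pairsIn C (wordL k ((a , b) ∷ cs)) ≡ pairsIn C (optP a k) ++ pairsIn C (wordL (suc k) cs)
  flat = trans (pairsIn-++ C (optP a k) _) (cong (pairsIn C (optP a k) ++_)
    (trans (pairsIn-++ C (wordL (suc k) cs) (optB b k)) (trans (cong (pairsIn C (wordL (suc k) cs) ++_) (bars b)) (++-identityʳ _))))
  go : ∀ a b → Suffix k ((a , b) ∷ cs) c → reverse (pairsIn C (optP a k) ++ pairsIn C (wordL (suc k) cs)) ≡ pairs k ((a , b) ∷ cs)
  go true true S rewrite inb-bar (S here) =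
    trans (unfold-reverse k (pairsIn C (wordL (suc k) cs))) (cong (_++ k ∷ []) (pairsIn-word (suc k) cs (S ∘ there)))
  go true false S rewrite inb-bar (S here) = pairsIn-word (suc k) cs (S ∘ there)
  go false b S = pairsIn-word (suc k) cs (S ∘ there)

zsOf-word : ∀ c → zsOf (wordL 1 c) ≡ pairs 1 c
zsOf-word c = trans (zsOf-pairs (wordL 1 c)) (pairsIn-word {c} 1 c (λ h → h))

-- As B is at least every z, taking the minimum with B has no effect on the first search. The scan
-- below needs a starting value independent of z_1.
tsOf-from : ∀ {B} C → All (_≤ B) (zsOf C) → tsOf C ≡ tsFrom C B (zsOf C)
tsOf-from {B} C le with zsOf C | le
... | [] | _ = refl
... | z ∷ zs | l ∷ _ rewrite ⊓-idem z | m≥n⇒m⊓n≡n l = refl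

gfb-greatest : ∀ {C k} b → 1 ≤ k → k < b → freeb C k ≡ true → (∀ i → k < i → i < b → freeb C i ≡ false) → gfb C b ≡ k
gfb-greatest {k = suc k} (suc zero) _ (s≤s ()) _ _
gfb-greatest {C} {suc k} (suc (suc b)) l (s≤s k≤b) free gaps = descend (m≤n⇒m<n∨m≡n k≤b)
    λ k<b → gfb-greatest (suc b) l k<b free λ i l' u → gaps i l' (≤-trans u (n≤1+n _))
  where
  descend : suc k < suc b ⊎ suc k ≡ suc b → (suc k < suc b → gfb C (suc b) ≡ suc k) → gfb C (suc (suc b)) ≡ suc k
  descend (inj₂ refl) rec rewrite free = refl
  descend (inj₁ k<b) rec rewrite gaps (suc b) k<b ≤-refl = rec k<b

-- The absent values that serve as t_k for some pair.
data Marked : ℕ → List Ty → ℕ → Set where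
  here  : ∀ {k cs h} → pending cs ≡ suc h → Marked k ((false , false) ∷ cs) k
  there : ∀ {k t cs i} → Marked (suc k) cs i → Marked k (t ∷ cs) i

marked-rT : ∀ {k c i} → Marked k c i → Has k (rT c) i (false , true)
marked-rT (here e) rewrite e = here
marked-rT (there x) = there (marked-rT x)

marked-lT : ∀ {k c i} → Marked k c i → Has k (lT c) i (true , false)
marked-lT (here e) rewrite e = here
marked-lT (there x) = there (marked-lT x)

module Matching (c : List Ty) (B : ℕ) where
  C : Word
  C = wordL 1 c

  -- No value from k up to the bound of the next search is free; so the next absent value met on the
  -- way down is the result of that search.
  Window : ℕ → ℕ → List ℕ → Set
  Window k prev [] = k ≤ prev
  Window k prev (z ∷ zs) = k ≤ prev × k ≤ z × All (k ≤_) zs × (∀ i → k ≤ i → i < prev ⊓ z → freeb C i ≡ false)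

  -- Scanning the absolute values downwards to k, the pairs found so far that wait for a
  -- partner t form the queue; the others have produced the values in done.
  record Scan (k : ℕ) (cs : List Ty) : Set where
    constructor scan
    field
      done queue : List ℕ
      prev : ℕ
      unfolds : ∀ rest → tsFrom C B (pairs k cs ++ rest) ≡ done ++ tsFrom C prev (queue ++ rest)
      marked : All (Marked k cs) done
      waiting : length queue ≡ pending cs
      window : Window k prev queue

  private
    lower : ∀ {k prev} queue → Window (suc k) prev queue → k ≤ prev
    lower [] w = <⇒≤ w
    lower (_ ∷ _) (w , _) = <⇒≤ w

    widen : ∀ {k prev} queue → freeb C k ≡ false → Window (suc k) prev queue → Window k prev queue
    widen [] _ w = <⇒≤ w
    widen {k} (z ∷ zs) f (p , q , r , free) = <⇒≤ p , <⇒≤ q , All.map <⇒≤ r , λ i l u →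
      [ (λ l' → free i l' u) , (λ e → subst (λ x → freeb C x ≡ false) e f) ]′ (m≤n⇒m<n∨m≡n l)

    enqueue : ∀ {k prev} queue → freeb C k ≡ false → Window (suc k) prev queue → Window k prev (queue ++ k ∷ [])
    enqueue {k} {prev} [] f w = <⇒≤ w , ≤-refl , [] , λ i l u → ⊥-elim (<⇒≱ u (≤-trans (m⊓n≤n prev k) l))
    enqueue (z ∷ zs) f w = let p , q , r , free = widen (z ∷ zs) f w in p , q , All-++⁺ r (≤-refl ∷ []) , free

    dequeue : ∀ {k} zs → All (suc k ≤_) zs → Window k k zs
    dequeue [] _ = ≤-refl
    dequeue {k} (z ∷ zs) (l ∷ ls) = ≤-refl , <⇒≤ l , All.map <⇒≤ ls , λ i l' u → ⊥-elim (<⇒≱ u (≤-trans (m⊓n≤m k z) l'))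

  scanning : ∀ k cs → 1 ≤ k → k + length cs ≤ B → Suffix k cs c → Scan k cs
  scanning k [] _ l S = scan [] [] B (λ _ → refl) [] refl (≤-trans (≤-reflexive (sym (+-identityʳ k))) l)
  scanning k (t ∷ cs) p l S with scanning (suc k) cs (s≤s z≤n) (≤-trans (≤-reflexive (sym (+-suc k _))) l) (S ∘ there)
  scanning k ((true , true) ∷ cs) p l S | scan done queue prev un mk wt win =
    scan done (queue ++ k ∷ []) prev
      (λ rest → trans (cong (tsFrom C B) (++-assoc (pairs (suc k) cs) (k ∷ []) rest))
        (trans (un (k ∷ rest)) (cong (λ q → done ++ tsFrom C prev q) (sym (++-assoc queue (k ∷ []) rest)))))
      (All.map there mk) (trans (length-++ queue) (trans (+-comm _ 1) (cong suc wt)))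
      (enqueue queue (freeb-type (S here)) win)
  scanning k ((true , false) ∷ cs) p l S | scan done queue prev un mk wt win =
    scan done queue prev un (All.map there mk) wt (widen queue (freeb-type (S here)) win)
  scanning k ((false , true) ∷ cs) p l S | scan done queue prev un mk wt win =
    scan done queue prev un (All.map there mk) wt (widen queue (freeb-type (S here)) win)
  scanning k ((false , false) ∷ cs) p l S | scan done [] prev un mk wt win =
    scan done [] prev un (All.map there mk) (cong pred wt) (<⇒≤ win)
  scanning k ((false , false) ∷ cs) p l S | scan done (z ∷ zs) prev un mk wt (w₁ , w₂ , w₃ , free) =
    scan (done ++ k ∷ []) zs k
      (λ rest → trans (un rest) (trans (cong (λ g → done ++ g ∷ tsFrom C g (zs ++ rest)) g≡k) (sym (++-assoc done (k ∷ []) _))))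
      (All-++⁺ (All.map there mk) (here (sym wt) ∷ [])) (cong pred wt) (dequeue zs w₃)
    where
    g≡k : gfb C (prev ⊓ z) ≡ k
    g≡k = gfb-greatest (prev ⊓ z) p (⊓-glb w₁ w₂) (freeb-type (S here)) free

lookup-just : ∀ {z t} as bs → lookupPair z (zipℕ as bs) ≡ just t → t ∈ bs
lookup-just {z} (a ∷ as) (b ∷ bs) e with z ≡ᵇ a
lookup-just (a ∷ as) (b ∷ bs) refl | true = here refl
... | false = there (lookup-just as bs e)

lookup-nothing : ∀ {z} as bs → length bs ≡ length as → lookupPair z (zipℕ as bs) ≡ nothing → ¬ z ∈ as
lookup-nothing {z} (a ∷ as) (b ∷ bs) l e z∈ with z ≡ᵇ a in eq
lookup-nothing {z} (a ∷ as) (b ∷ bs) l e (here refl) | false = case trans (sym eq) (≡ᵇ-refl z) of λ ()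
lookup-nothing {z} (a ∷ as) (b ∷ bs) l e (there z∈) | false = lookup-nothing as bs (suc-injective l) e z∈

length-tsFrom : ∀ C p zs → length (tsFrom C p zs) ≡ length zs
length-tsFrom C p [] = refl
length-tsFrom C p (z ∷ zs) = cong suc (length-tsFrom C _ zs)

insertᴸ-∈ : ∀ {x} y w → x ∈ insertᴸ y w → x ≡ y ⊎ x ∈ w
insertᴸ-∈ y [] (here e) = inj₁ e
insertᴸ-∈ y (z ∷ w) x∈ with ltb z y
insertᴸ-∈ y (z ∷ w) (here e) | true = inj₂ (here e)
insertᴸ-∈ y (z ∷ w) (there x∈) | true with insertᴸ-∈ y w x∈
... | inj₁ e = inj₁ e
... | inj₂ r = inj₂ (there r)
insertᴸ-∈ y (z ∷ w) (here e) | false = inj₁ e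
insertᴸ-∈ y (z ∷ w) (there x∈) | false = inj₂ x∈

sortᴸ-∈ : ∀ {x} w → x ∈ sortᴸ w → x ∈ w
sortᴸ-∈ (y ∷ w) x∈ with insertᴸ-∈ y (sortᴸ w) x∈
... | inj₁ e = here e
... | inj₂ r = there (sortᴸ-∈ w r)

length-insertᴸ : ∀ y w → length (insertᴸ y w) ≡ suc (length w)
length-insertᴸ y [] = refl
length-insertᴸ y (z ∷ w) with ltb z y
... | true = cong suc (length-insertᴸ y w)
... | false = refl

length-sortᴸ : ∀ w → length (sortᴸ w) ≡ length w
length-sortᴸ [] = refl
length-sortᴸ (x ∷ w) = trans (length-insertᴸ x (sortᴸ w)) (cong suc (length-sortᴸ w))

ltb-true : ∀ x y → ltb x y ≡ true → x <ᴸ y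
ltb-true (pos i) (pos j) e = pp (<ᵇ⇒< i j (subst T (sym e) _))
ltb-true (pos i) (bar j) e = pb
ltb-true (bar i) (bar j) e = bb (<ᵇ⇒< j i (subst T (sym e) _))

sortᴸ-sorted : ∀ {w} → Sorted w → sortᴸ w ≡ w
sortᴸ-sorted [] = refl
sortᴸ-sorted {x ∷ w} (l ∷ s) rewrite sortᴸ-sorted s = front l
  where
  front : ∀ {w} → All (x <ᴸ_) w → insertᴸ x w ≡ x ∷ w
  front [] = refl
  front {y ∷ w} (l ∷ _) with ltb y x in e
  ... | true = ⊥-elim (<ᴸ-irrefl (<ᴸ-trans l (ltb-true y x e)))
  ... | false = refl

has-resolve : ∀ {f k c i t} → Has k c i t → Σ ℕ λ h → Has k (resolve f c) i (f h t)
has-resolve {c = _ ∷ cs} here = pending cs , here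
has-resolve (there h) = map₂ there (has-resolve h)

length-wordL : ∀ k c → length (wordL k c) ≡ size c
length-wordL k [] = refl
length-wordL k ((a , b) ∷ cs) rewrite length-++ (optP a k) {wordL (suc k) cs ++ optB b k}
  | length-++ (wordL (suc k) cs) {optB b k} | length-wordL (suc k) cs =
  trans (cong₂ (λ x y → x + (size cs + y)) (oP a) (oB b))
    (trans (cong (bit a +_) (+-comm (size cs) (bit b))) (sym (+-assoc (bit a) (bit b) (size cs))))
  where
  oP : ∀ a → length (optP a k) ≡ bit a
  oP true = refl
  oP false = refl
  oB : ∀ b → length (optB b k) ≡ bit b
  oB true = refl
  oB false = refl

module Extremal (c : List Ty) (p0 : pending c ≡ 0) where
  private
    C : Word
    C = wordL 1 c
    B : ℕ
    B = suc (length c)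
    S : Matching.Scan c B 1 c
    S = Matching.scanning c B 1 c ≤-refl ≤-refl (λ h → h)
    open Matching.Scan S

    ts≡ : tsOf C ≡ tsFrom C B (zsOf C)
    ts≡ = tsOf-from C (subst (All (_≤ B)) (sym (zsOf-word c)) (pairs-≤ 1 c (s≤s (n≤1+n _))))

    ts-done : tsOf C ≡ done
    ts-done = trans ts≡ (trans (cong (tsFrom C B) (trans (zsOf-word c) (sym (++-identityʳ _))))
      (trans (unfolds []) (trans (cong (λ q → done ++ tsFrom C prev (q ++ [])) (empty queue (trans waiting p0))) (++-identityʳ done))))
      where
      empty : ∀ (q : List ℕ) → length q ≡ 0 → q ≡ []
      empty [] _ = refl

    lengths : length (tsOf C) ≡ length (zsOf C)
    lengths = trans (cong length ts≡) (length-tsFrom C B (zsOf C))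

    ts-marked : ∀ {t} → t ∈ tsOf C → Marked 1 c t
    ts-marked t∈ = All.lookup marked (subst (_ ∈_) ts-done t∈)

    unpaired : ∀ {i t} → Has 1 c i t → lookupPair i (zipℕ (zsOf C) (tsOf C)) ≡ nothing → t ≢ (true , true)
    unpaired h e refl = lookup-nothing (zsOf C) (tsOf C) lengths e (subst (_ ∈_) (sym (zsOf-word c)) (∈-pairs h))

    replBar-∈ : ∀ {y} → y ∈ C → replBar (zipℕ (zsOf C) (tsOf C)) y ∈ wordL 1 (rT c)
    replBar-∈ {pos i} y∈ with pos⁻ {1} {c} y∈
    ... | true , h = pos⁺ (proj₂ (has-resolve h))
    ... | false , h = pos⁺ (proj₂ (has-resolve h))
    replBar-∈ {bar i} y∈ with lookupPair i (zipℕ (zsOf C) (tsOf C)) in e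
    ... | just t = bar⁺ (marked-rT (ts-marked (lookup-just (zsOf C) (tsOf C) e)))
    ... | nothing with bar⁻ {1} {c} y∈
    ... | true , h = ⊥-elim (unpaired h e refl)
    ... | false , h = bar⁺ (proj₂ (has-resolve h))

    replPos-∈ : ∀ {y} → y ∈ C → replPos (zipℕ (zsOf C) (tsOf C)) y ∈ wordL 1 (lT c)
    replPos-∈ {bar i} y∈ with bar⁻ {1} {c} y∈
    ... | true , h = bar⁺ (proj₂ (has-resolve h))
    ... | false , h = bar⁺ (proj₂ (has-resolve h))
    replPos-∈ {pos i} y∈ with lookupPair i (zipℕ (zsOf C) (tsOf C)) in e
    ... | just t = pos⁺ (marked-lT (ts-marked (lookup-just (zsOf C) (tsOf C) e)))
    ... | nothing with pos⁻ {1} {c} y∈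
    ... | true , h = ⊥-elim (unpaired h e refl)
    ... | false , h = pos⁺ (proj₂ (has-resolve h))

  -- Every letter of rC lies in the resolved column, and the numbers of letters agree. Since rC is
  -- strictly increasing by hypothesis, no letter is repeated and the inclusion is an equality.
  rCol-word : StrictInc (rCol C) → rCol C ≡ wordL 1 (rT c)
  rCol-word s = sorted-⊆-≡ (sorted s) (wordL-sorted 1 (rT c))
    (λ x∈ → case ∈-map⁻ _ (sortᴸ-∈ (map (replBar _) C) x∈) of λ { (y , y∈ , refl) → replBar-∈ y∈ })
    (≤-reflexive (trans (length-wordL 1 (rT c)) (trans (resolve-size rRes c p0)
      (sym (trans (length-sortᴸ (map (replBar _) C)) (trans (length-map _ C) (length-wordL 1 c)))))))

  lCol-word : StrictInc (lCol C) → lCol C ≡ wordL 1 (lT c)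
  lCol-word s = sorted-⊆-≡ (sorted s) (wordL-sorted 1 (lT c))
    (λ x∈ → case ∈-map⁻ _ (sortᴸ-∈ (map (replPos _) C) x∈) of λ { (y , y∈ , refl) → replPos-∈ y∈ })
    (≤-reflexive (trans (length-wordL 1 (lT c)) (trans (resolve-size lRes c p0)
      (sym (trans (length-sortᴸ (map (replPos _) C)) (trans (length-map _ C) (length-wordL 1 c)))))))

pairs-none : ∀ k {c} → NoPairs c → pairs k c ≡ []
pairs-none k [] = refl
pairs-none k {(true , true) ∷ c} (n ∷ ns) = ⊥-elim (n refl)
pairs-none k {(true , false) ∷ c} (n ∷ ns) = pairs-none (suc k) ns
pairs-none k {(false , _) ∷ c} (n ∷ ns) = pairs-none (suc k) ns

replBar-[] : ∀ w → map (replBar []) w ≡ w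
replBar-[] [] = refl
replBar-[] (pos i ∷ w) = cong (pos i ∷_) (replBar-[] w)
replBar-[] (bar i ∷ w) = cong (bar i ∷_) (replBar-[] w)

replPos-[] : ∀ w → map (replPos []) w ≡ w
replPos-[] [] = refl
replPos-[] (pos i ∷ w) = cong (pos i ∷_) (replPos-[] w)
replPos-[] (bar i ∷ w) = cong (bar i ∷_) (replPos-[] w)

rCol-extremal : ∀ {c} → NoPairs c → rCol (wordL 1 c) ≡ wordL 1 c
rCol-extremal {c} n rewrite trans (zsOf-word c) (pairs-none 1 n) | replBar-[] (wordL 1 c) = sortᴸ-sorted (wordL-sorted 1 c)

lCol-extremal : ∀ {c} → NoPairs c → lCol (wordL 1 c) ≡ wordL 1 c
lCol-extremal {c} n rewrite trans (zsOf-word c) (pairs-none 1 n) | replPos-[] (wordL 1 c) = sortᴸ-sorted (wordL-sorted 1 c)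

record ColOK (n : ℕ) (C : Word) : Set where
  constructor colOK
  field
    letters    : ValidW n C
    increasing : StrictInc C
    admissible : Admissible C
    lStrict    : StrictInc (lCol C)
    rStrict    : StrictInc (rCol C)
open ColOK

columns-ok : ∀ {n} S → KNSkew n S → All (ColOK n) (map proj₂ S)
columns-ok {n} S (V , (_ , s , _) , a , (_ , s' , _)) = go S (All-concat⁻ V) s a s'
  where
  go : ∀ S → All (ValidW n) (map proj₂ S) → All (λ c → StrictInc (proj₂ c)) S → All (λ c → Admissible (proj₂ c)) S →
       All (λ c → StrictInc (proj₂ c)) (split S) → All (ColOK n) (map proj₂ S)
  go [] [] [] [] [] = []
  go (c ∷ S) (v ∷ vs) (s ∷ ss) (a ∷ as) (l ∷ r ∷ rs) = colOK v s a l r ∷ go S vs ss as rs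

valid-mono : ∀ {n m w} → n ≤ m → ValidW n w → ValidW m w
valid-mono le = All.map λ { {pos i} (l , u) → l , ≤-trans u le ; {bar i} (l , u) → l , ≤-trans u le }

wordL-valid : ∀ c → ValidW (length c) (wordL 1 c)
wordL-valid c = All.map (λ { {pos i} (l , u) → l , ≤-pred u ; {bar i} (l , u) → l , ≤-pred u }) (wordL-abs 1 c)

proj₂-asSkew : ∀ T → map proj₂ (asSkew T) ≡ T
proj₂-asSkew [] = refl
proj₂-asSkew (c ∷ T) = cong (c ∷_) (proj₂-asSkew T)

sits-has : ∀ {e k t₁ t₂ X} → Sits e t₁ t₂ X →
           Has k X (k + e) t₁ × (Has k X (k + suc e) t₂ ⊎ (t₂ ≡ swap t₁ × length X ≡ suc e))
sits-has {k = k} (here {t₁} {t₂} {cs}) = subst (λ i → Has k (t₁ ∷ t₂ ∷ cs) i t₁) (sym (+-identityʳ k)) here ,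
  inj₁ (subst (λ i → Has k (t₁ ∷ t₂ ∷ cs) i t₂) (+-comm 1 k) (there here))
sits-has {k = k} (last {t}) = subst (λ i → Has k (t ∷ []) i t) (sym (+-identityʳ k)) here , inj₂ (refl , refl)
sits-has {suc e} {k} (there {t₁ = t₁} {t₂} {t} {cs} s) with sits-has {k = suc k} s
... | h , r = subst (λ i → Has k (t ∷ cs) i t₁) (sym (+-suc k e)) (there h) ,
  [ (λ h' → inj₁ (subst (λ i → Has k (t ∷ cs) i t₂) (sym (+-suc k (suc e))) (there h'))) , (λ (x , y) → inj₂ (x , cong suc y)) ]′ r

-- A fixed rank m: letters coded by 1, ..., 2m, and Knuth steps on codes.

module Rank (m : ℕ) where
  -- The letter bar k is coded by conj k.
  conj : ℕ → ℕ
  conj k = suc (m + m) ∸ k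

  word : ℕ → List Ty → List ℕ
  word k [] = []
  word k ((a , b) ∷ cs) = opt a k ++ word (suc k) cs ++ opt b (conj k)

  -- In `ks3` and `ks4`, y' = 2m - y is the code of bar (y + 1) and y' + 1 that of bar y. A sum of
  -- codes 2m + 1 means a letter and its bar.
  data KS : List ℕ → List ℕ → Set where
    ks1 : ∀ {α β γ} → γ < α → α ≤ β → β + γ ≢ suc (m + m) →
          KS (γ ∷ β ∷ α ∷ []) (β ∷ γ ∷ α ∷ [])
    ks2 : ∀ {α β γ} → γ ≤ α → α < β → β + γ ≢ suc (m + m) →
          KS (α ∷ β ∷ γ ∷ []) (α ∷ γ ∷ β ∷ [])
    ks3 : ∀ {y y' β} → y + y' ≡ m + m → y < β → β ≤ y' →
          KS (suc y ∷ y' ∷ β ∷ []) (suc y' ∷ y ∷ β ∷ [])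
    ks4 : ∀ {y y' β} → y + y' ≡ m + m → y < β → β ≤ y' →
          KS (β ∷ suc y' ∷ y ∷ []) (β ∷ suc y ∷ y' ∷ [])
    ks5 : ∀ {c c'} → Contract 0 c c' → length c ≡ m → KS (word 1 c) (word 1 c')

  data _≈ₖ_ : List ℕ → List ℕ → Set where
    same : ∀ {w} → w ≈ₖ w
    fwd  : ∀ {w w'} → KS w w' → w ≈ₖ w'
    bwd  : ∀ {w w'} → KS w' w → w ≈ₖ w'

  conj-sum : ∀ {k} → k ≤ suc (m + m) → k + conj k ≡ suc (m + m)
  conj-sum = m+[n∸m]≡n

  -- Knuth equivalence commutes with raising at one index.

  module Index (i j : ℕ) (i≤j : i ≤ j) (i+j : i + j ≡ m + m) where
    -- The letters i, bar (i + 1) have sign ⊕ and i + 1, bar i have sign ⊖; with j = 2m − i these are the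
    -- codes i, j and i + 1, j + 1, so that raising a letter is pred.
    Pl : ℕ → Set
    Pl c = c ≡ i ⊎ c ≡ j

    data View (c : ℕ) : Sg → Set where
      vp : Pl c → View c ⊕
      vm : ∀ {c'} → c ≡ suc c' → Pl c' → View c ⊖
      vz : ¬ Pl c → (∀ {c'} → c ≡ suc c' → ¬ Pl c') → View c ⊙

    -- By parity, since i + j = 2m. Otherwise the code j would carry both signs.
    j≢1+i : j ≢ suc i
    j≢1+i refl = go i m (trans (sym (+-suc i i)) i+j)
      where
      go : ∀ a b → suc (a + a) ≢ b + b
      go a zero ()
      go zero (suc b) eq = case trans eq (cong suc (+-suc b b)) of λ ()
      go (suc a) (suc b) eq = go a b (suc-injective (suc-injective (trans (cong (suc ∘ suc) (sym (+-suc a a)))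
        (trans eq (cong suc (+-suc b b))))))

    i≢1+j : i ≢ suc j
    i≢1+j eq = <-irrefl refl (≤-trans (≤-reflexive (sym eq)) i≤j)

    gap : ∀ {c} → Pl c → ¬ Pl (suc c)
    gap (inj₁ refl) (inj₁ eq) = 1+n≢n eq
    gap (inj₁ refl) (inj₂ eq) = j≢1+i (sym eq)
    gap (inj₂ refl) (inj₁ eq) = i≢1+j (sym eq)
    gap (inj₂ refl) (inj₂ eq) = 1+n≢n eq

    Pl? : ∀ c → Pl c ⊎ ¬ Pl c
    Pl? c with c ≟ i | c ≟ j
    ... | yes p | _ = inj₁ (inj₁ p)
    ... | no _ | yes q = inj₁ (inj₂ q)
    ... | no p | no q = inj₂ λ { (inj₁ x) → p x ; (inj₂ x) → q x }

    Pl-co : ∀ {a b} → a + b ≡ m + m → Pl a → Pl b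
    Pl-co {a} {b} eq (inj₁ refl) = inj₂ (+-cancelˡ-≡ a b j (trans eq (sym i+j)))
    Pl-co {a} {b} eq (inj₂ refl) = inj₁ (+-cancelˡ-≡ a b i (trans eq (trans (sym i+j) (+-comm i j))))

    ¬Pl-co : ∀ {a b} → a + b ≡ m + m → ¬ Pl a → ¬ Pl b
    ¬Pl-co {a} {b} eq ¬a q = ¬a (Pl-co (trans (+-comm b a) eq) q)

    -- Opaque on purpose: signs are only determined through `View` and its uniqueness.
    abstract
      view : ∀ c → Σ Sg (View c)
      view c with Pl? c
      view c | inj₁ p = ⊕ , vp p
      view zero | inj₂ ¬p = ⊙ , vz ¬p (λ ())
      view (suc c) | inj₂ ¬p with Pl? c
      ... | inj₁ p = ⊖ , vm refl p
      ... | inj₂ ¬q = ⊙ , vz ¬p λ { refl → ¬q }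

    sgn : ℕ → Sg
    sgn c = proj₁ (view c)

    V-unique : ∀ {c s t} → View c s → View c t → s ≡ t
    V-unique (vp _) (vp _) = refl
    V-unique (vp p) (vm refl q) = ⊥-elim (gap q p)
    V-unique (vp p) (vz ¬p _) = ⊥-elim (¬p p)
    V-unique (vm refl q) (vp p) = ⊥-elim (gap q p)
    V-unique (vm _ _) (vm _ _) = refl
    V-unique (vm refl q) (vz _ ¬q) = ⊥-elim (¬q refl q)
    V-unique (vz ¬p _) (vp p) = ⊥-elim (¬p p)
    V-unique (vz _ ¬q) (vm refl q) = ⊥-elim (¬q refl q)
    V-unique (vz _ _) (vz _ _) = refl

    sgn-≡ : ∀ {c s} → View c s → sgn c ≡ s
    sgn-≡ {c} v = V-unique (proj₂ (view c)) v

    -- E 0 is e_i^max; E p leaves unraised the first p of the letters ⊖ that E 0 would raise.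
    E : ℕ → List ℕ → List ℕ
    E p [] = []
    E p (c ∷ w) = act (sgn c) p c ∷ E (next (sgn c) p) w

    out : ℕ → List ℕ → ℕ
    out p [] = p
    out p (c ∷ w) = out (next (sgn c) p) w

    E-++ : ∀ p u v → E p (u ++ v) ≡ E p u ++ E (out p u) v
    E-++ p [] v = refl
    E-++ p (c ∷ u) v = cong (_ ∷_) (E-++ _ u v)

    out-++ : ∀ p u v → out p (u ++ v) ≡ out (out p u) v
    out-++ p [] v = refl
    out-++ p (c ∷ u) v = out-++ _ u v

    length-E : ∀ p w → length (E p w) ≡ length w
    length-E p [] = refl
    length-E p (c ∷ w) = cong suc (length-E _ w)

    act-suc : ∀ s p c → act s (suc p) c ≡ c
    act-suc ⊕ p c = refl
    act-suc ⊖ p c = refl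
    act-suc ⊙ p c = refl

    -- A left context acts on x and y only through the number p of unmatched ⊕ it hands over, and
    -- equal values of `out` keep the right context in step.
    CompatibleAt : ℕ → List ℕ → List ℕ → Set
    CompatibleAt p x y = out p x ≡ out p y × E p x ≈ₖ E p y

    Compatible : List ℕ → List ℕ → Set
    Compatible x y = ∀ p → CompatibleAt p x y

    private
      <-drop : ∀ {a b} → a < suc b → a ≢ b → a < b
      <-drop (s≤s a≤b) a≢b = ≤∧≢⇒< a≤b a≢b

      ≤-drop : ∀ {a b} → a ≤ suc b → a ≢ suc b → a ≤ b
      ≤-drop a≤b a≢b = ≤-pred (≤∧≢⇒< a≤b a≢b)

      ≢Pl : ∀ {a b} → ¬ Pl a → Pl b → a ≢ b
      ≢Pl ¬a b refl = ¬a b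

      sum-odd : ∀ {a b} → Pl a → Pl b → a ≢ b → suc (a + b) ≡ suc (m + m)
      sum-odd (inj₁ refl) (inj₁ refl) n = ⊥-elim (n refl)
      sum-odd (inj₁ refl) (inj₂ refl) n = cong suc i+j
      sum-odd (inj₂ refl) (inj₁ refl) n = cong suc (trans (+-comm j i) i+j)
      sum-odd (inj₂ refl) (inj₂ refl) n = ⊥-elim (n refl)

      Pl-sum : ∀ {a b} → Pl a → Pl b → a < b → a + b ≡ m + m
      Pl-sum p q a<b = suc-injective (sum-odd p q (<⇒≢ a<b))

      notBar-0 : ∀ {a b} → ¬ Pl a → (∀ {c} → a ≡ suc c → ¬ Pl c) → Pl b → b + a ≢ suc (m + m)
      notBar-0 {zero} {b} ¬a ¬a' q eq with q
      ... | inj₁ refl = <-irrefl refl (≤-trans (≤-reflexive (sym (trans (sym (+-identityʳ i)) eq)))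
                          (≤-trans (m≤m+n i j) (≤-reflexive i+j)))
      ... | inj₂ refl = <-irrefl refl (≤-trans (≤-reflexive (sym (trans (sym (+-identityʳ j)) eq)))
                          (≤-trans (m≤n+m j i) (≤-reflexive i+j)))
      notBar-0 {suc a} {b} ¬a ¬a' q eq = ¬a' refl (Pl-co (suc-injective (trans (sym (+-suc b a)) eq)) q)

      notBar-0' : ∀ {a b} → ¬ Pl a → (∀ {c} → a ≡ suc c → ¬ Pl c) → Pl b → a + b ≢ suc (m + m)
      notBar-0' {a} {b} ¬a ¬a' q eq = notBar-0 ¬a ¬a' q (trans (+-comm b a) eq)

      notBar-2m : ∀ {a b} → a + b ≡ m + m → a + b ≢ suc (m + m)
      notBar-2m eq eq' = 1+n≢n (trans (sym eq') eq)

    private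
      act≤ : ∀ s p c → act s p c ≤ c
      act≤ ⊕ p c = ≤-refl
      act≤ ⊖ zero c = pred[n]≤n
      act≤ ⊖ (suc p) c = ≤-refl
      act≤ ⊙ p c = ≤-refl

      pred≤act : ∀ s p c → pred c ≤ act s p c
      pred≤act ⊕ p c = pred[n]≤n
      pred≤act ⊖ zero c = ≤-refl
      pred≤act ⊖ (suc p) c = pred[n]≤n
      pred≤act ⊙ p c = pred[n]≤n

      act-kept : ∀ s p c {q} → next s p ≡ suc q → act s p c ≡ c
      act-kept ⊕ p c _ = refl
      act-kept ⊖ (suc p) c _ = refl
      act-kept ⊙ p c _ = refl

      -- Raising lowers a letter by at most one, and only from q + 1 to q with q of sign ⊕. The
      -- inequalities between letters survive because the colliding cases have incompatible signs.
      <act : ∀ {s α γ} p → View α s → ¬ Pl γ → γ < α → γ < act s p α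
      <act p (vp _) n l = l
      <act zero (vm refl a) n l = <-drop l (≢Pl n a)
      <act (suc p) (vm _ _) n l = l
      <act p (vz _ _) n l = l

      act₀≤ : ∀ {s α β} → View α s → Pl β → α ≤ suc β → act s 0 α ≤ β
      act₀≤ v@(vp _) b l = ≤-drop l λ { refl → case V-unique v (vm refl b) of λ () }
      act₀≤ (vm refl _) b l = ≤-pred l
      act₀≤ v@(vz _ _) b l = ≤-drop l λ { refl → case V-unique v (vm refl b) of λ () }

      act< : ∀ {s α β} p → next s p ≡ 0 → View α s → Pl β → α < suc β → act s p α < β
      act< zero _ (vz n _) b l = <-drop l (≢Pl n b)
      act< zero _ (vm refl a) b l = ≤-pred l
      act< (suc zero) _ (vm refl a) b l = <-drop l λ { refl → gap a b }

      ≤act : ∀ {s α γ} p → View α s → (s ≡ ⊖ → γ ≢ α) → γ ≤ α → γ ≤ act s p α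
      ≤act p (vp _) n l = l
      ≤act zero (vm refl _) n l = ≤-drop l (n refl)
      ≤act (suc p) (vm _ _) n l = l
      ≤act p (vz _ _) n l = l

    -- The relation may change its kind. If γ has sign ⊕ and β sign ⊖, the exclusion of barred pairs
    -- leaves only q, q + 1, q + 1, and for p = 0 the result is a K2. If both have sign ⊖ and one ⊕
    -- is pending, only the one that comes first is protected, and the result is a K3.
    ks1-compat : ∀ {α β γ} → γ < α → α ≤ β → β + γ ≢ suc (m + m) →
                 Compatible (γ ∷ β ∷ α ∷ []) (β ∷ γ ∷ α ∷ [])
    ks1-compat {α} {β} {γ} γ<α α≤β nb p with view γ | view β | view α
    ks1-compat {α} γ<α α≤β nb p | ⊕ , g | ⊕ , b | s , a rewrite act-suc s (suc p) α = refl , fwd (ks1 γ<α α≤β nb)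
    ks1-compat {α} γ<α α≤β nb p | ⊕ , g | ⊙ , b | s , a rewrite act-suc s p α = refl , fwd (ks1 γ<α α≤β nb)
    ks1-compat {α} γ<α α≤β nb p | ⊙ , g | ⊕ , b | s , a rewrite act-suc s p α = refl , fwd (ks1 γ<α α≤β nb)
    ks1-compat {α} {β} {γ} γ<α α≤β nb p | ⊕ , vp g | ⊖ , vm {β'} refl b | s , a with γ ≟ β'
    ... | no γ≢β' = ⊥-elim (nb (trans (cong suc (+-comm β' γ)) (sum-odd g b γ≢β')))
    ... | yes refl with ≤-antisym α≤β γ<α
    ... | refl with V-unique a (vm refl b)
    ks1-compat γ<α α≤β nb zero | ⊕ , vp g | ⊖ , vm refl b | s , a | yes refl | refl | refl =
      refl , fwd (ks2 ≤-refl ≤-refl nb)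
    ks1-compat γ<α α≤β nb (suc p) | ⊕ , vp g | ⊖ , vm refl b | s , a | yes refl | refl | refl =
      refl , fwd (ks1 γ<α α≤β nb)
    ks1-compat {α} {β} γ<α α≤β nb p | ⊖ , vm {γ'} refl g | ⊕ , vp b | s , a =
      ⊥-elim (nb (trans (+-comm β (suc γ')) (sum-odd g b λ eq → <-irrefl eq
        (≤-trans (n≤1+n _) (≤-trans γ<α α≤β)))))
    ks1-compat {α} γ<α α≤β nb zero | ⊖ , vm {γ'} refl g | ⊖ , vm {β'} refl b | s , a =
      refl , fwd (ks1 (≤-trans (pred-mono-≤ γ<α) (pred≤act s 0 α)) (act₀≤ a b α≤β)
        (notBar-2m {β'} {γ'} (trans (+-comm β' γ') (Pl-sum g b (≤-pred (≤-trans γ<α α≤β))))))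
    ks1-compat {α} γ<α α≤β nb (suc zero) | ⊖ , vm refl g | ⊖ , vm refl b | s , a =
      refl , fwd (ks3 (Pl-sum g b (≤-pred (≤-trans γ<α α≤β))) (≤-trans (pred-mono-≤ γ<α) (pred≤act s 0 α)) (act₀≤ a b α≤β))
    ks1-compat {α} γ<α α≤β nb (suc (suc p)) | ⊖ , vm refl g | ⊖ , vm refl b | s , a =
      refl , fwd (ks1 (<act p a (gap g) γ<α) (≤-trans (act≤ s p α) α≤β) nb)
    ks1-compat {α} γ<α α≤β nb p | ⊙ , vz g _ | ⊙ , b | s , a =
      refl , fwd (ks1 (<act p a g γ<α) (≤-trans (act≤ s p α) α≤β) nb)
    ks1-compat {α} γ<α α≤β nb zero | ⊖ , vm refl g | ⊙ , vz b b' | s , a =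
      refl , fwd (ks1 (≤-trans (pred-mono-≤ γ<α) (pred≤act s 0 α)) (≤-trans (act≤ s 0 α) α≤β) (notBar-0' b b' g))
    ks1-compat {α} γ<α α≤β nb (suc p) | ⊖ , vm refl g | ⊙ , b | s , a =
      refl , fwd (ks1 (<act p a (gap g) γ<α) (≤-trans (act≤ s p α) α≤β) nb)
    ks1-compat γ<α α≤β nb zero | ⊙ , vz g g' | ⊖ , vm refl b | s , a =
      refl , fwd (ks1 (<act 0 a g γ<α) (act₀≤ a b α≤β) (notBar-0 g g' b))
    ks1-compat {α} γ<α α≤β nb (suc p) | ⊙ , vz g _ | ⊖ , b | s , a =
      refl , fwd (ks1 (<act p a g γ<α) (≤-trans (act≤ s p α) α≤β) nb)

    -- The first letter α fixes how many ⊕ remain for β and γ. If both of these have sign ⊖ and one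
    -- ⊕ remains, the result is a K4.
    ks2-compat : ∀ {α β γ} → γ ≤ α → α < β → β + γ ≢ suc (m + m) →
                 Compatible (α ∷ β ∷ γ ∷ []) (α ∷ γ ∷ β ∷ [])
    ks2-compat {α} {β} {γ} γ≤α α<β nb p with view γ | view β | view α
    ks2-compat {α} γ≤α α<β nb p | ⊕ , g | ⊕ , b | s , a =
      refl , fwd (ks2 (≤act p a (λ { refl refl → case V-unique g a of λ () }) γ≤α) (≤-<-trans (act≤ s p α) α<β) nb)
    ks2-compat {α} γ≤α α<β nb p | ⊕ , g | ⊙ , b | s , a =
      refl , fwd (ks2 (≤act p a (λ { refl refl → case V-unique g a of λ () }) γ≤α) (≤-<-trans (act≤ s p α) α<β) nb)
    ks2-compat {α} γ≤α α<β nb p | ⊙ , g | ⊕ , b | s , a =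
      refl , fwd (ks2 (≤act p a (λ { refl refl → case V-unique g a of λ () }) γ≤α) (≤-<-trans (act≤ s p α) α<β) nb)
    ks2-compat {α} γ≤α α<β nb p | ⊙ , g | ⊙ , b | s , a =
      refl , fwd (ks2 (≤act p a (λ { refl refl → case V-unique g a of λ () }) γ≤α) (≤-<-trans (act≤ s p α) α<β) nb)
    ks2-compat {α} {β} {γ} γ≤α α<β nb p | ⊕ , vp g | ⊖ , vm {β'} refl b | s , a with γ ≟ β'
    ... | no γ≢β' = ⊥-elim (nb (trans (cong suc (+-comm β' γ)) (sum-odd g b γ≢β')))
    ... | yes refl with ≤-antisym γ≤α (≤-pred α<β)
    ... | refl with V-unique a (vp g)
    ... | refl = refl , fwd (ks2 ≤-refl ≤-refl nb)
    ks2-compat {α} {β} γ≤α α<β nb p | ⊖ , vm {γ'} refl g | ⊕ , vp b | s , a =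
      ⊥-elim (nb (trans (+-comm β (suc γ')) (sum-odd g b λ eq → <-irrefl eq
        (≤-trans γ≤α (≤-trans (n≤1+n _) α<β)))))
    ks2-compat {α} γ≤α α<β nb p | ⊖ , vm refl g | ⊙ , vz b b' | s , a with next s p in eq
    ... | zero = refl , fwd (ks2 (≤-trans (pred-mono-≤ γ≤α) (pred≤act s p α)) (≤-<-trans (act≤ s p α) α<β) (notBar-0' b b' g))
    ... | suc q rewrite act-kept s p α eq = refl , fwd (ks2 γ≤α α<β nb)
    ks2-compat {α} γ≤α α<β nb p | ⊙ , g@(vz n n') | ⊖ , vm refl b | s , a with next s p in eq
    ... | zero = refl , fwd (ks2 (≤act p a (λ { refl refl → case V-unique g a of λ () }) γ≤α) (act< p eq a b α<β) (notBar-0 n n' b))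
    ... | suc q rewrite act-kept s p α eq = refl , fwd (ks2 γ≤α α<β nb)
    ks2-compat {α} γ≤α α<β nb p | ⊖ , vm {γ'} refl g | ⊖ , vm {β'} refl b | s , a with next s p in eq
    ... | zero = refl , fwd (ks2 (≤-trans (pred-mono-≤ γ≤α) (pred≤act s p α)) (act< p eq a b α<β)
          (notBar-2m {β'} {γ'} (trans (+-comm β' γ') (Pl-sum g b (≤-pred (≤-trans (s≤s γ≤α) α<β))))))
    ... | suc zero rewrite act-kept s p α eq =
          refl , fwd (ks4 (Pl-sum g b (≤-pred (≤-trans (s≤s γ≤α) α<β))) γ≤α (≤-pred α<β))
    ... | suc (suc q) rewrite act-kept s p α eq = refl , fwd (ks2 γ≤α α<β nb)

    private
      data Cancels (a b : ℕ) : Set where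
        plus-minus : sgn a ≡ ⊕ → sgn b ≡ ⊖ → Cancels a b
        neutral    : sgn a ≡ ⊙ → sgn b ≡ ⊙ → Cancels a b

      -- The two letters are bars of each other, so their signs are opposite or both neutral. A
      -- first letter of sign ⊖ would make y one of i, j; what remains is ⊕ ⊖ or a neutral pair, and
      -- raising passes over both.
      cancels : ∀ {y y'} → y + y' ≡ m + m → ¬ Pl y → Cancels (suc y) y'
      cancels {y} {y'} eq ¬y with view (suc y)
      ... | ⊖ , vm refl p = ⊥-elim (¬y p)
      cancels {y} {zero} eq ¬y | ⊕ , vp p = ⊥-elim (notBar-0 {0} {suc y}
        (λ q → ¬y (Pl-co {0} {y} (trans (sym (+-identityʳ y)) eq) q)) (λ ()) p (cong suc eq))
      cancels {y} {suc y'} eq ¬y | ⊕ , v@(vp p) =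
        plus-minus (sgn-≡ v) (sgn-≡ (vm refl (Pl-co (trans (sym (+-suc y y')) eq) p)))
      cancels {y} {y'} eq ¬y | ⊙ , v@(vz n _) = neutral (sgn-≡ v) (sgn-≡ (vz
        (λ p → ¬y (Pl-co (trans (+-comm y' y) eq) p))
        λ { {c} refl q → n (Pl-co (trans (+-comm c (suc y)) (trans (sym (+-suc y c)) eq)) q) }))

      E-cancels : ∀ {a b} p w → Cancels a b → E p (a ∷ b ∷ w) ≡ a ∷ b ∷ E p w
      E-cancels p w (plus-minus x y) rewrite x | y = refl
      E-cancels p w (neutral x y) rewrite x | y = refl

      out-cancels : ∀ {a b} p w → Cancels a b → out p (a ∷ b ∷ w) ≡ out p w
      out-cancels p w (plus-minus x y) rewrite x | y = refl
      out-cancels p w (neutral x y) rewrite x | y = refl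

      stays-between : ∀ {y y' β s} p → View β s → y + y' ≡ m + m → ¬ Pl y → y < β → β ≤ y' →
                      y < act s p β × act s p β ≤ y'
      stays-between p (vp _) eq ¬y l u = l , u
      stays-between zero (vm refl b) eq ¬y l u = <-drop l (≢Pl ¬y b) , ≤-trans (n≤1+n _) u
      stays-between (suc p) (vm refl b) eq ¬y l u = l , u
      stays-between p (vz _ _) eq ¬y l u = l , u

    private
      ks3-neutral : ∀ {y y' β} p → y + y' ≡ m + m → ¬ Pl y → y < β → β ≤ y' → CompatibleAt p (suc y ∷ y' ∷ β ∷ []) (suc y' ∷ y ∷ β ∷ [])
      ks3-neutral {y} {y'} {β} p eq ¬y l u
        rewrite E-cancels p (β ∷ []) (cancels {y} {y'} eq ¬y)
              | E-cancels p (β ∷ []) (cancels {y'} {y} (trans (+-comm y' y) eq) (¬Pl-co eq ¬y))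
              | out-cancels p (β ∷ []) (cancels {y} {y'} eq ¬y)
              | out-cancels p (β ∷ []) (cancels {y'} {y} (trans (+-comm y' y) eq) (¬Pl-co eq ¬y))
        = let l' , u' = stays-between p (proj₂ (view β)) eq ¬y l u in refl , fwd (ks3 eq l' u')

      -- Both words start with ⊖ ⊕. With nothing pending the first letter is lowered and K3 turns
      -- into K1; otherwise nothing changes.
      ks3-active : ∀ {y y' β} p → y + y' ≡ m + m → Pl y → y < β → β ≤ y' → CompatibleAt p (suc y ∷ y' ∷ β ∷ []) (suc y' ∷ y ∷ β ∷ [])
      ks3-active {y} {y'} {β} p eq q l u
        rewrite sgn-≡ (vm {suc y} refl q) | sgn-≡ (vp (Pl-co eq q))
              | sgn-≡ (vm {suc y'} refl (Pl-co eq q)) | sgn-≡ (vp q)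
        with p | view β
      ... | zero | ⊕ , _ = refl , fwd (ks1 l u (notBar-2m {y'} {y} (trans (+-comm y' y) eq)))
      ... | zero | ⊖ , _ = refl , fwd (ks1 l u (notBar-2m {y'} {y} (trans (+-comm y' y) eq)))
      ... | zero | ⊙ , _ = refl , fwd (ks1 l u (notBar-2m {y'} {y} (trans (+-comm y' y) eq)))
      ... | suc p | ⊕ , _ = refl , fwd (ks3 eq l u)
      ... | suc p | ⊖ , _ = refl , fwd (ks3 eq l u)
      ... | suc p | ⊙ , _ = refl , fwd (ks3 eq l u)

    ks3-compat : ∀ {y y' β} → y + y' ≡ m + m → y < β → β ≤ y' →
                 Compatible (suc y ∷ y' ∷ β ∷ []) (suc y' ∷ y ∷ β ∷ [])
    ks3-compat {y} eq l u p =
      [ (λ q → ks3-active p eq q l u) , (λ ¬y → ks3-neutral p eq ¬y l u) ]′ (Pl? y)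

    private
      ks4-neutral : ∀ {y y' β} p → y + y' ≡ m + m → ¬ Pl y → y < β → β ≤ y' → CompatibleAt p (β ∷ suc y' ∷ y ∷ []) (β ∷ suc y ∷ y' ∷ [])
      ks4-neutral {y} {y'} {β} p eq ¬y l u
        rewrite E-cancels (next (sgn β) p) [] (cancels {y} {y'} eq ¬y)
              | E-cancels (next (sgn β) p) [] (cancels {y'} {y} (trans (+-comm y' y) eq) (¬Pl-co eq ¬y))
              | out-cancels (next (sgn β) p) [] (cancels {y} {y'} eq ¬y)
              | out-cancels (next (sgn β) p) [] (cancels {y'} {y} (trans (+-comm y' y) eq) (¬Pl-co eq ¬y))
        = let l' , u' = stays-between p (proj₂ (view β)) eq ¬y l u in refl , fwd (ks4 eq l' u')

      -- As for K3, but it is the number of ⊕ pending after β that counts: if there is none, K4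
      -- turns into K2.
      ks4-active : ∀ {y y' β} p → y + y' ≡ m + m → Pl y → y < β → β ≤ y' → CompatibleAt p (β ∷ suc y' ∷ y ∷ []) (β ∷ suc y ∷ y' ∷ [])
      ks4-active {y} {y'} {β} p eq q l u
        rewrite sgn-≡ (vm {suc y} refl q) | sgn-≡ (vp (Pl-co eq q))
              | sgn-≡ (vm {suc y'} refl (Pl-co eq q)) | sgn-≡ (vp q)
        with p | view β
      ... | p | ⊕ , _ = refl , fwd (ks4 eq l u)
      ... | zero | ⊙ , vz n _ = refl , fwd (ks2 (<⇒≤ l) (≤∧≢⇒< u (≢Pl n (Pl-co eq q))) (notBar-2m {y'} {y} (trans (+-comm y' y) eq)))
      ... | suc p | ⊙ , _ = refl , fwd (ks4 eq l u)
      ... | zero | ⊖ , vm refl b = refl , fwd (ks2 (≤-pred l) u (notBar-2m {y'} {y} (trans (+-comm y' y) eq)))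
      ... | suc zero | ⊖ , vm refl b = refl , fwd (ks2 (<⇒≤ l) (≤∧≢⇒< u λ { refl → gap b (Pl-co eq q) }) (notBar-2m {y'} {y} (trans (+-comm y' y) eq)))
      ... | suc (suc p) | ⊖ , _ = refl , fwd (ks4 eq l u)

    ks4-compat : ∀ {y y' β} → y + y' ≡ m + m → y < β → β ≤ y' →
                 Compatible (β ∷ suc y' ∷ y ∷ []) (β ∷ suc y ∷ y' ∷ [])
    ks4-compat {y} eq l u p =
      [ (λ q → ks4-active p eq q l u) , (λ ¬y → ks4-neutral p eq ¬y l u) ]′ (Pl? y)

    i≤m : i ≤ m
    i≤m with ≤-total i m
    ... | inj₁ x = x
    ... | inj₂ m≤i = ≤-reflexive (≤-antisym
            (+-cancelˡ-≤ m i m (≤-trans (+-monoˡ-≤ i m≤i) (≤-trans (+-monoʳ-≤ i i≤j) (≤-reflexive i+j)))) m≤i)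

    m≤j : m ≤ j
    m≤j = +-cancelˡ-≤ i m j (≤-trans (+-monoˡ-≤ m i≤m) (≤-reflexive (sym i+j)))

    conj-i : conj i ≡ suc j
    conj-i = trans (cong (λ x → suc x ∸ i) (trans (sym i+j) (+-comm i j)))
                   (m+n∸n≡m (suc j) i)

    conj-1+i : conj (suc i) ≡ j
    conj-1+i = trans (cong (_∸ i) (trans (sym i+j) (+-comm i j))) (m+n∸n≡m j i)

    Neutral : ℕ → Set
    Neutral c = View c ⊙

    neutral-below : ∀ {k} → k < i → Neutral k
    neutral-below k<i = vz (λ { (inj₁ refl) → <-irrefl refl k<i ; (inj₂ refl) → <⇒≱ k<i i≤j })
      λ { refl (inj₁ refl) → <⇒≱ k<i (n≤1+n _) ; refl (inj₂ refl) → <⇒≱ k<i (≤-trans i≤j (n≤1+n _)) }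

    neutral-above : ∀ {k} → suc i < k → k ≤ m → Neutral k
    neutral-above i<k k≤m = vz (λ { (inj₁ refl) → <⇒≱ i<k (n≤1+n _) ; (inj₂ refl) → <⇒≱ (<⇒≤ i<k) (j≤i k≤m) })
      λ { refl (inj₁ refl) → <-irrefl refl i<k
        ; refl (inj₂ refl) → <⇒≱ (≤-pred i<k) (j≤i (≤-trans (n≤1+n _) k≤m)) }
      where
      j≤i : j ≤ m → j ≤ i
      j≤i j≤m = +-cancelˡ-≤ m j i (≤-trans (+-monoʳ-≤ m j≤m) (≤-trans (≤-reflexive (trans (sym i+j) (+-comm i j))) (+-monoˡ-≤ i j≤m)))

    neutral-conj : ∀ {k} → k ≤ m + m → Neutral (suc k) → Neutral (conj (suc k))
    neutral-conj {k} k≤m (vz n n') = vz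
      (λ q → n' refl (Pl-co (trans (+-comm (m + m ∸ k) k) k+) q))
      λ {c} eq q → n (Pl-co (trans (+-comm c (suc k)) (trans (sym (+-suc k c)) (trans (cong (k +_) (sym eq)) k+))) q)
      where
      k+ : k + (m + m ∸ k) ≡ m + m
      k+ = m+[n∸m]≡n k≤m

    E-neutral : ∀ {w} p → All Neutral w → E p w ≡ w
    E-neutral p [] = refl
    E-neutral p (v ∷ vs) rewrite sgn-≡ v = cong (_ ∷_) (E-neutral p vs)

    out-neutral : ∀ {w} p → All Neutral w → out p w ≡ p
    out-neutral p [] = refl
    out-neutral p (v ∷ vs) rewrite sgn-≡ v = out-neutral p vs

    neutral-opt : ∀ a {x} → Neutral x → All Neutral (opt a x)
    neutral-opt true v = v ∷ []
    neutral-opt false v = []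

    neutral-word : ∀ {k} c → suc i < k → k + length c ≡ suc m → All Neutral (word k c)
    neutral-word [] _ _ = []
    neutral-word {suc k} ((a , b) ∷ cs) i<k eq = All-++⁺ (neutral-opt a nk)
      (All-++⁺ (neutral-word cs (≤-trans i<k (n≤1+n _)) (shift {suc k} eq))
        (neutral-opt b (neutral-conj (≤-trans (≤-trans (n≤1+n _) k≤m) (m≤m+n m m)) nk)))
      where
      k≤m : suc k ≤ m
      k≤m = ≤-pred (≤-trans (≤-trans (≤-reflexive (+-comm 1 (suc k))) (+-monoʳ-≤ (suc k) (s≤s z≤n))) (≤-reflexive eq))
      nk = neutral-above i<k k≤m

    Splits : ℕ → List ℕ → List ℕ → ℕ → Set
    Splits p w w' p' = E p w ≡ w' × out p w ≡ p'

    splits-++ : ∀ {p u u' q v v' r} → Splits p u u' q → Splits q v v' r → Splits p (u ++ v) (u' ++ v') r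
    splits-++ {p} {u} {v = v} (refl , refl) (refl , refl) = E-++ p u v , out-++ p u v

    splits-neutral : ∀ {p w} → All Neutral w → Splits p w w p
    splits-neutral n = E-neutral _ n , out-neutral _ n

    splits-half : ∀ {q} p a b → Pl q →
      Splits p (opt a q ++ opt b (suc q))
               (opt (proj₁ (proj₁ (half p a b))) q ++ opt (proj₂ (proj₁ (half p a b))) (suc q))
               (proj₂ (half p a b))
    splits-half p true true Q rewrite sgn-≡ (vp Q) | sgn-≡ (vm refl Q) = refl , refl
    splits-half p true false Q rewrite sgn-≡ (vp Q) = refl , refl
    splits-half p false false Q = refl , refl
    splits-half zero false true Q rewrite sgn-≡ (vm refl Q) = refl , refl
    splits-half (suc p) false true Q rewrite sgn-≡ (vm refl Q) = refl , refl

    regroup : ∀ (a b w c d : List ℕ) → a ++ (b ++ w ++ c) ++ d ≡ (a ++ b) ++ w ++ (c ++ d)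
    regroup a b w c d = trans (cong (a ++_) (trans (++-assoc b (w ++ c) d) (cong (b ++_) (++-assoc w c d))))
                              (sym (++-assoc a b (w ++ (c ++ d))))

    -- All letters of a column other than i, i + 1, j, j + 1 are neutral, so raising is `half` on i,
    -- i + 1 followed by `half` on j, j + 1. For i = m these are the same two letters and one `half`
    -- remains.
    splits-word : ∀ e p {k} c → 1 ≤ k → k + e ≡ i → k + length c ≡ suc m →
                  Splits p (word k c) (word k (Et e p c)) (Eo e p c)
    splits-word e p [] _ _ _ = refl , refl
    splits-word (suc e) p {suc k} ((a , b) ∷ cs) _ k+e eq =
      splits-++ (splits-neutral (neutral-opt a nk)) (splits-++
        (splits-word e p cs (s≤s z≤n) (shift {suc k} k+e) (shift {suc k} eq))
        (splits-neutral (neutral-opt b (neutral-conj (≤-trans (≤-trans (n≤1+n k) (<⇒≤ (<-≤-trans k<i i≤m))) (m≤m+n m m)) nk))))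
      where
      k<i : suc k < i
      k<i = ≤-trans (≤-reflexive (+-comm 1 (suc k))) (≤-trans (+-monoʳ-≤ (suc k) (s≤s z≤n)) (≤-reflexive k+e))
      nk = neutral-below k<i
    splits-word zero p {k} ((a , d) ∷ (b , c) ∷ cs) _ k+e eq with trans (sym (+-identityʳ k)) k+e
    ... | refl rewrite conj-i | conj-1+i
                     | regroup (opt a i) (opt b (suc i)) (word (suc (suc i)) cs) (opt c j) (opt d (suc j))
                     | regroup (opt (proj₁ (pair₁ p (a , d) (b , c))) i) (opt (proj₁ (pair₂ p (a , d) (b , c))) (suc i))
                         (word (suc (suc i)) cs) (opt (proj₂ (pair₂ p (a , d) (b , c))) j)
                         (opt (proj₂ (pair₁ p (a , d) (b , c))) (suc j))
        = splits-++ (splits-half p a b (inj₁ refl)) (splits-++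
            (splits-neutral (neutral-word cs ≤-refl
              (trans (sym (+-suc (suc i) _)) (trans (sym (+-suc i _)) eq))))
            (splits-half _ c d (inj₂ refl)))
    splits-word zero p {k} ((a , d) ∷ []) _ k+e eq with trans (sym (+-identityʳ k)) k+e
    ... | refl with suc-injective (trans (+-comm 1 i) eq)
    ... | refl with +-cancelˡ-≡ i j i i+j
    ... | refl rewrite conj-i = splits-half p a d (inj₁ refl)

    ks5-compat : ∀ e → suc e ≡ i → ∀ {c c'} → Contract 0 c c' → length c ≡ m →
                 Compatible (word 1 c) (word 1 c')
    ks5-compat e e+1 {c} {c'} x len p
      with splits-word e p c (s≤s z≤n) e+1 (cong suc len)
         | splits-word e p c' (s≤s z≤n) e+1 (cong suc (trans (sym (length-Contract x)) len))
         | Contract-Et e p x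
    ... | E≡ , o≡ | E≡' , o≡' | x' , oo =
      trans o≡ (trans oo (sym o≡')) ,
      subst₂ _≈ₖ_ (sym E≡) (sym E≡') (fwd (ks5 x' (trans (length-Et e p c) len)))

    ks-compat : ∀ e → suc e ≡ i → ∀ {x y} → KS x y → Compatible x y
    ks-compat e ei (ks1 a b c) = ks1-compat a b c
    ks-compat e ei (ks2 a b c) = ks2-compat a b c
    ks-compat e ei (ks3 a b c) = ks3-compat a b c
    ks-compat e ei (ks4 a b c) = ks4-compat a b c
    ks-compat e ei (ks5 x l) = ks5-compat e ei x l

  data KC : List ℕ → List ℕ → Set where
    kc : ∀ u {x y} v → x ≈ₖ y → KC (u ++ x ++ v) (u ++ y ++ v)

  ≈ₖ-sym : ∀ {x y} → x ≈ₖ y → y ≈ₖ x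
  ≈ₖ-sym same = same
  ≈ₖ-sym (fwd x) = bwd x
  ≈ₖ-sym (bwd x) = fwd x

  -- Signed permutations, domination, multiplicities in columns.

  InRange : ℕ → Set
  InRange c = 1 ≤ c × c ≤ m + m

  -- Signed permutations in one-line notation.
  record Flag (σ : List ℕ) : Set where
    constructor flag
    field
      len   : length σ ≡ m
      range : All InRange σ
      once  : ∀ k → InRange k → cnt k σ + cnt (conj k) σ ≡ 1
  open Flag public

  exts : List (List Ty) → List (List ℕ)
  exts [] = []
  exts (c ∷ cs) = word 1 (rT c) ∷ word 1 (lT c) ∷ exts cs

  -- In terms of crystals: the product of the extremal columns xs lies in the Demazure crystal of v.
  Dem : List ℕ → List (List ℕ) → Set
  Dem v [] = ⊤
  Dem v (x ∷ xs) = Σ (List ℕ) λ σ → Flag σ × σ ⊑ v × take (length x) σ ≋ x × Dem σ xs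

  Dem-mono : ∀ {v v'} xs → v ⊑ v' → Dem v xs → Dem v' xs
  Dem-mono [] _ _ = tt
  Dem-mono (x ∷ xs) l (σ , F , σv , eq , d) = σ , F , ⊑-trans σv l , eq , d

  cnt≤1 : ∀ {σ} → Flag σ → ∀ ℓ {k} → InRange k → cnt k (take ℓ σ) ≤ 1
  cnt≤1 {σ} F ℓ {k} r = ≤-trans (cnt-take k ℓ σ) (≤-trans (m≤m+n _ _) (≤-reflexive (once F k r)))

  length-word : ∀ k c → length (word k c) ≡ size c
  length-word k [] = refl
  length-word k ((a , b) ∷ cs) rewrite length-++ (opt a k) {word (suc k) cs ++ opt b (conj k)}
    | length-++ (word (suc k) cs) {opt b (conj k)} | length-word (suc k) cs =
    trans (cong₂ (λ x y → x + (size cs + y)) (length-opt a) (length-opt b))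
      (trans (cong (bit a +_) (+-comm (size cs) (bit b))) (sym (+-assoc (bit a) (bit b) (size cs))))
    where
    length-opt : ∀ a {x} → length (opt a x) ≡ bit a
    length-opt true = refl
    length-opt false = refl

  conj-big : ∀ {k} → k ≤ m → suc m ≤ conj k
  conj-big {k} k≤m = ≤-trans (≤-reflexive (sym (m+n∸n≡m (suc m) m))) (∸-monoʳ-≤ (suc (m + m)) k≤m)

  Within : ℕ → ℕ → Set
  Within k x = k ≤ x × x ≤ conj k

  private
    k≤m : ∀ {k n} → k + suc n ≡ suc m → k ≤ m
    k≤m {k} eq = ≤-pred (≤-trans (≤-trans (≤-reflexive (+-comm 1 k)) (+-monoʳ-≤ k (s≤s z≤n))) (≤-reflexive eq))

    ≤2m : ∀ {k} → k ≤ m → k ≤ m + m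
    ≤2m l = ≤-trans l (m≤m+n m m)

    conj-down : ∀ {k l} → k ≤ l → conj l ≤ conj k
    conj-down = ∸-monoʳ-≤ (suc (m + m))

    within-self : ∀ {k} → k ≤ m → Within k k
    within-self l = ≤-refl , ≤-trans (≤-trans l (n≤1+n m)) (conj-big l)

    within-conj : ∀ {k} → k ≤ m → Within k (conj k)
    within-conj l = proj₂ (within-self l) , ≤-refl

  word-within : ∀ k c → k + length c ≡ suc m → All (Within k) (word k c)
  word-within k [] eq = []
  word-within k ((a , b) ∷ cs) eq = All-++⁺ (lo a) (All-++⁺
      (All.map (λ (l , u) → <⇒≤ l , ≤-trans u (conj-down (n≤1+n k))) (word-within (suc k) cs (shift {k} eq))) (hi b))
    where
    lo : ∀ a → All (Within k) (opt a k)
    lo true = within-self (k≤m eq) ∷ []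
    lo false = []
    hi : ∀ b → All (Within k) (opt b (conj k))
    hi true = within-conj (k≤m eq) ∷ []
    hi false = []

  cnt-outside : ∀ {q w} → All (q ≢_) w → cnt q w ≡ 0
  cnt-outside [] = refl
  cnt-outside {q} (_∷_ {x} n ns) = cong₂ _+_ (is-≢ {q} {x} n) (cnt-outside ns)

  private
    conj-< : ∀ {k l} → k < l → l ≤ m → conj l < conj k
    conj-< lt l = ∸-monoʳ-< lt (≤-trans (≤2m l) (n≤1+n _))

    opt-self : ∀ a x → cnt x (opt a x) ≡ bit a
    opt-self true x = trans (+-identityʳ _) (is-refl x)
    opt-self false x = refl

    opt-other : ∀ a {q x} → q ≢ x → cnt q (opt a x) ≡ 0
    opt-other true n = trans (+-identityʳ _) (is-≢ n)
    opt-other false n = refl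

    cnt-layer : ∀ q k a b cs → cnt q (word k ((a , b) ∷ cs)) ≡ cnt q (opt a k) + (cnt q (word (suc k) cs) + cnt q (opt b (conj k)))
    cnt-layer q k a b cs = trans (cnt-++ q (opt a k) _) (cong (cnt q (opt a k) +_) (cnt-++ q (word (suc k) cs) _))

  cnt-word-pos : ∀ {k c i a b} → Has k c i (a , b) → k + length c ≡ suc m → cnt i (word k c) ≡ bit a
  cnt-word-pos {k} {(a , b) ∷ cs} here eq = trans (cnt-layer k k a b cs) (trans (cong₂ _+_ (opt-self a k)
    (cong₂ _+_ (cnt-outside (All.map (λ (l , _) e → <-irrefl e l) (word-within (suc k) cs (shift {k} eq))))
      (opt-other b (<⇒≢ (≤-trans (s≤s (k≤m eq)) (conj-big (k≤m eq))))))) (+-identityʳ _))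
  cnt-word-pos {k} {(a , b) ∷ cs} {i} (there h) eq = trans (cnt-layer i k a b cs) (trans (cong₂ _+_ (opt-other a (<⇒≢ (has-≥ h) ∘ sym))
    (cong₂ _+_ (cnt-word-pos h (shift {k} eq)) (opt-other b (<⇒≢ (≤-trans i≤ (conj-big (k≤m eq))))))) (+-identityʳ _))
    where
    i≤ : i < suc m
    i≤ = ≤-trans (has-< h) (≤-reflexive (shift {k} eq))

  cnt-word-conj : ∀ {k c i a b} → Has k c i (a , b) → k + length c ≡ suc m → cnt (conj i) (word k c) ≡ bit b
  cnt-word-conj {k} {(a , b) ∷ cs} here eq = trans (cnt-layer (conj k) k a b cs) (cong₂ _+_
    (opt-other a (<⇒≢ (≤-trans (s≤s (k≤m eq)) (conj-big (k≤m eq))) ∘ sym))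
    (cong₂ _+_ (cnt-outside (All.map (λ (_ , u) e → <-irrefl (sym e) (≤-trans (s≤s u) (conj-below (k≤m eq)))) (word-within (suc k) cs (shift {k} eq))))
      (opt-self b (conj k))))
    where
    conj-below : ∀ {k} → k ≤ m → conj (suc k) < conj k
    conj-below {k} l = ∸-monoʳ-< ≤-refl (s≤s (≤2m l))
  cnt-word-conj {k} {(a , b) ∷ cs} {i} (there h) eq = trans (cnt-layer (conj i) k a b cs) (trans (cong₂ _+_
    (opt-other a (<⇒≢ (≤-trans (s≤s (k≤m eq)) (conj-big i≤)) ∘ sym))
    (cong₂ _+_ (cnt-word-conj h (shift {k} eq)) (opt-other b (<⇒≢ (conj-< (has-≥ h) i≤))))) (+-identityʳ _))
    where
    i≤ : i ≤ m
    i≤ = ≤-pred (≤-trans (has-< h) (≤-reflexive (shift {k} eq)))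

  -- Simple reflections and the string property.

  module At (e₀ : ℕ) (e₀<m : e₀ < m) where
    abstract
      i+j' : suc e₀ + (m + m ∸ suc e₀) ≡ m + m
      i+j' = m+[n∸m]≡n (≤-trans e₀<m (m≤m+n m m))

      i≤j' : suc e₀ ≤ m + m ∸ suc e₀
      i≤j' = +-cancelˡ-≤ (suc e₀) _ _ (≤-trans (+-mono-≤ e₀<m e₀<m) (≤-reflexive (sym i+j')))

    open Index (suc e₀) (m + m ∸ suc e₀) i≤j' i+j' public

    ≈ₖ-compat : ∀ {x y} p → x ≈ₖ y → out p x ≡ out p y × E p x ≈ₖ E p y
    ≈ₖ-compat p same = refl , same
    ≈ₖ-compat p (fwd s) = ks-compat e₀ refl s p
    ≈ₖ-compat p (bwd s) = let o , r = ks-compat e₀ refl s p in sym o , ≈ₖ-sym r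

    KC-compat : ∀ {w w'} → KC w w' → KC (E 0 w) (E 0 w')
    KC-compat (kc u {x} {y} v r)
      rewrite E-++ 0 u (x ++ v) | E-++ 0 u (y ++ v)
            | E-++ (out 0 u) x v | E-++ (out 0 u) y v
            | proj₁ (≈ₖ-compat (out 0 u) r) = kc (E 0 u) (E (out (out 0 u) y) v) (proj₂ (≈ₖ-compat (out 0 u) r))

    col : ∀ p c → length c ≡ m → Splits p (word 1 c) (word 1 (Et e₀ p c)) (Eo e₀ p c)
    col p c len = splits-word e₀ p c (s≤s z≤n) refl (cong suc len)

    private
      i j : ℕ
      i = suc e₀
      j = m + m ∸ suc e₀

    Pl-range : ∀ {q} → Pl q → InRange q × InRange (suc q)
    Pl-range (inj₁ refl) = (s≤s z≤n , ≤-trans i≤m (m≤m+n m m)) ,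
      (s≤s z≤n , ≤-trans (+-mono-≤ {1} {m} (≤-trans (s≤s z≤n) e₀<m) e₀<m) ≤-refl)
    Pl-range (inj₂ refl) = (≤-trans (s≤s z≤n) (≤-trans e₀<m m≤j) , m∸n≤m (m + m) (suc e₀)) ,
      (s≤s z≤n , ≤-trans (+-monoˡ-≤ j (s≤s z≤n)) (≤-reflexive i+j'))

    -- Leads to the simple reflection s_i, which exchanges i with i + 1 and j with j + 1.
    swBy : Sg → ℕ → ℕ
    swBy ⊕ c = suc c
    swBy ⊖ c = pred c
    swBy ⊙ c = c

    sw : ℕ → ℕ
    sw c = swBy (sgn c) c

    sw-⊕ : ∀ {c} → Pl c → sw c ≡ suc c
    sw-⊕ p rewrite sgn-≡ (vp p) = refl

    sw-⊖ : ∀ {c} → Pl c → sw (suc c) ≡ c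
    sw-⊖ p rewrite sgn-≡ (vm refl p) = refl

    sw-⊙ : ∀ {c} → View c ⊙ → sw c ≡ c
    sw-⊙ v rewrite sgn-≡ v = refl

    sw-invol : ∀ c → sw (sw c) ≡ c
    sw-invol c with view c
    ... | ⊕ , vp p = sw-⊖ p
    ... | ⊖ , vm refl p = sw-⊕ p
    ... | ⊙ , v = sw-⊙ v

    sw-range : ∀ {c} → InRange c → InRange (sw c)
    sw-range {c} r with view c
    ... | ⊕ , vp p = proj₂ (Pl-range p)
    ... | ⊖ , vm refl p = proj₁ (Pl-range p)
    ... | ⊙ , v = r

    conj-Pl : ∀ {q q'} → q + q' ≡ m + m → conj q ≡ suc q' × conj (suc q) ≡ q'
    conj-Pl {q} {q'} eq = trans (cong (λ x → suc x ∸ q) (trans (sym eq) (+-comm q q'))) (m+n∸n≡m (suc q') q) ,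
      trans (cong (_∸ q) (trans (sym eq) (+-comm q q'))) (m+n∸n≡m q' q)

    mate : ∀ {q} → Pl q → Σ ℕ λ q' → Pl q' × q + q' ≡ m + m
    mate (inj₁ refl) = j , inj₂ refl , i+j'
    mate (inj₂ refl) = i , inj₁ refl , trans (+-comm j i) i+j'

    sw-conj : ∀ {c} → InRange c → sw (conj c) ≡ conj (sw c)
    sw-conj {c} r with view c
    ... | ⊕ , vp p = let q' , p' , eq = mate p ; c₁ , c₂ = conj-Pl eq in
            trans (cong sw c₁) (trans (sw-⊖ p') (sym c₂))
    ... | ⊖ , vm refl p = let q' , p' , eq = mate p ; c₁ , c₂ = conj-Pl eq in
            trans (cong sw c₂) (trans (sw-⊕ p') (sym c₁))
    sw-conj {suc k} (_ , k≤) | ⊙ , v = sw-⊙ (neutral-conj (≤-trans (n≤1+n k) k≤) v)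

    is-sw : ∀ q c → is q (sw c) ≡ is (sw q) c
    is-sw q c = is-⇔ (λ eq → trans (cong sw eq) (sw-invol c)) (λ eq → trans (sym (sw-invol q)) (cong sw eq))

    S : List ℕ → List ℕ
    S = map sw

    cnt-S : ∀ q w → cnt q (S w) ≡ cnt (sw q) w
    cnt-S q [] = refl
    cnt-S q (c ∷ w) = cong₂ _+_ (is-sw q c) (cnt-S q w)

    S-cong : ∀ {x y} → x ≋ y → S x ≋ S y
    S-cong {x} {y} eq c = trans (cnt-S c x) (trans (eq (sw c)) (sym (cnt-S c y)))

    S-invol : ∀ x → S (S x) ≡ x
    S-invol [] = refl
    S-invol (c ∷ x) = cong₂ _∷_ (sw-invol c) (S-invol x)

    geb-sw : ∀ {q} → Pl q → ∀ c → geb (suc q) (sw c) + is (suc q) c ≡ geb (suc q) c + is q c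
    geb-sw {q} P c with view c
    ... | ⊕ , vp p rewrite is-≢ {suc q} {c} (λ { refl → gap P p }) = trans (+-identityʳ _) (geb-suc q c)
    ... | ⊖ , vm {c'} refl p rewrite is-≢ {q} {suc c'} (λ { refl → gap p P }) =
            trans (sym (geb-suc q c')) (sym (+-identityʳ _))
    ... | ⊙ , vz n n' rewrite is-≢ {suc q} {c} (λ eq → n' (sym eq) P) | is-≢ {q} {c} (λ { refl → n P }) = refl

    geb-sw-other : ∀ {t} → (∀ {q} → Pl q → t ≢ suc q) → ∀ c → geb t (sw c) ≡ geb t c
    geb-sw-other {zero} n c = refl
    geb-sw-other {suc t} n c with view c
    ... | ⊕ , vp p = trans (geb-suc t c) (trans (cong (geb (suc t) c +_) (is-≢ {t} {c} λ { refl → n p refl })) (+-identityʳ _))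
    ... | ⊖ , vm {c'} refl p = sym (trans (geb-suc t c') (trans (cong (geb (suc t) c' +_) (is-≢ {t} {c'} λ { refl → n p refl })) (+-identityʳ _)))
    ... | ⊙ , _ = refl

    -- Only the thresholds i + 1 and j + 1 separate exchanged letters; there the count changes by
    -- the difference of their multiplicities.
    ge-S : ∀ {q} → Pl q → ∀ w → ge (suc q) (S w) + cnt (suc q) w ≡ ge (suc q) w + cnt q w
    ge-S P [] = refl
    ge-S {q} P (c ∷ w) = trans (+-interchange (geb (suc q) (sw c)) _ _ _)
      (trans (cong₂ _+_ (geb-sw P c) (ge-S P w)) (+-interchange (geb (suc q) c) _ _ _))

    ge-S-other : ∀ {t} → (∀ {q} → Pl q → t ≢ suc q) → ∀ w → ge t (S w) ≡ ge t w
    ge-S-other n [] = refl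
    ge-S-other n (c ∷ w) = cong₂ _+_ (geb-sw-other n c) (ge-S-other n w)

    -- On signed permutations these say s_i σ > σ and s_i σ < σ, in the form in which they enter the
    -- tableau criterion.
    Asc Desc : List ℕ → Set
    Asc σ = ∀ ℓ q → Pl q → cnt (suc q) (take ℓ σ) ≤ cnt q (take ℓ σ)
    Desc σ = ∀ ℓ q → Pl q → cnt q (take ℓ σ) ≤ cnt (suc q) (take ℓ σ)

    threshold : ∀ t → (Σ ℕ λ q → Pl q × t ≡ suc q) ⊎ (∀ {q} → Pl q → t ≢ suc q)
    threshold zero = inj₂ λ _ ()
    threshold (suc t) with Pl? t
    ... | inj₁ p = inj₁ (t , p , refl)
    ... | inj₂ n = inj₂ λ { p refl → n p }

    S-flag : ∀ {σ} → Flag σ → Flag (S σ)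
    S-flag {σ} F .len = trans (length-map sw σ) (F .len)
    S-flag {σ} F .range = go (F .range)
      where
      go : ∀ {w} → All InRange w → All InRange (S w)
      go [] = []
      go (r ∷ rs) = sw-range r ∷ go rs
    S-flag {σ} F .once k r = trans (cong₂ _+_ (cnt-S k σ) (trans (cnt-S (conj k) σ) (cong (λ c → cnt c σ) (sw-conj r))))
      (F .once (sw k) (sw-range r))

    S-asc : ∀ {σ} → Desc σ → Asc (S σ)
    S-asc {σ} d ℓ q p rewrite take-map {f = sw} ℓ σ =
      subst₂ _≤_ (sym (trans (cnt-S (suc q) (take ℓ σ)) (cong (λ c → cnt c (take ℓ σ)) (sw-⊖ p))))
                 (sym (trans (cnt-S q (take ℓ σ)) (cong (λ c → cnt c (take ℓ σ)) (sw-⊕ p)))) (d ℓ q p)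

    S-desc : ∀ {σ} → Asc σ → Desc (S σ)
    S-desc {σ} d ℓ q p rewrite take-map {f = sw} ℓ σ =
      subst₂ _≤_ (sym (trans (cnt-S q (take ℓ σ)) (cong (λ c → cnt c (take ℓ σ)) (sw-⊕ p))))
                 (sym (trans (cnt-S (suc q) (take ℓ σ)) (cong (λ c → cnt c (take ℓ σ)) (sw-⊖ p)))) (d ℓ q p)

    S-⊑ : ∀ {σ} → Desc σ → S σ ⊑ σ
    S-⊑ {σ} d ℓ t rewrite take-map {f = sw} ℓ σ with threshold t
    ... | inj₂ n = ≤-reflexive (ge-S-other n (take ℓ σ))
    ... | inj₁ (q , p , refl) = +-cancelʳ-≤ (cnt (suc q) (take ℓ σ)) _ _
            (≤-trans (≤-reflexive (ge-S p (take ℓ σ))) (+-monoʳ-≤ _ (d ℓ q p)))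

    -- This and `lift-down` are the two halves of the lifting property. Only the thresholds i + 1
    -- and j + 1 need an argument, and there the multiplicities are at most 1.
    lift-up : ∀ {ρ τ} → Flag ρ → Asc ρ → Desc τ → ρ ⊑ τ → S ρ ⊑ τ
    lift-up {ρ} {τ} F a d le ℓ t rewrite take-map {f = sw} ℓ ρ with threshold t
    ... | inj₂ n = ≤-trans (≤-reflexive (ge-S-other n (take ℓ ρ))) (le ℓ t)
    ... | inj₁ (q , p , refl) = raise-bound (a ℓ q p) (cnt≤1 F ℓ (proj₁ (Pl-range p)))
            (ge-S p (take ℓ ρ)) (ge-suc (suc q) (take ℓ ρ)) (le ℓ (suc q))
            (subst₂ _≤_ (ge-suc q (take ℓ ρ)) (ge-suc q (take ℓ τ)) (le ℓ q))
            (le ℓ (suc (suc q))) (ge-suc (suc q) (take ℓ τ)) (d ℓ q p)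

    lift-down : ∀ {ρ τ} → Flag ρ → Flag τ → Asc ρ → Desc τ → ρ ⊑ τ → ρ ⊑ S τ
    lift-down {ρ} {τ} F G a d le ℓ t rewrite take-map {f = sw} ℓ τ with threshold t
    ... | inj₂ n = ≤-trans (le ℓ t) (≤-reflexive (sym (ge-S-other n (take ℓ τ))))
    ... | inj₁ (q , p , refl) = lower-bound (a ℓ q p) (d ℓ q p) (cnt≤1 G ℓ (proj₂ (Pl-range p)))
            (ge-S p (take ℓ τ)) (ge-suc (suc q) (take ℓ ρ)) (le ℓ (suc q))
            (subst₂ _≤_ (ge-suc q (take ℓ ρ)) (ge-suc q (take ℓ τ)) (le ℓ q))
            (le ℓ (suc (suc q))) (ge-suc (suc q) (take ℓ τ)) (cnt≤1 F ℓ (proj₁ (Pl-range p)))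

    S-mono : ∀ {ρ τ} → Flag ρ → Flag τ → Desc ρ → Desc τ → ρ ⊑ τ → S ρ ⊑ S τ
    S-mono F G d d' le = lift-down (S-flag F) G (S-asc d) d' (⊑-trans (S-⊑ d) le)

    StrictlyDesc : List ℕ → Set
    StrictlyDesc σ = Desc σ × Σ ℕ λ ℓ → Σ ℕ λ q → Pl q × ℓ ≤ length σ × cnt q (take ℓ σ) < cnt (suc q) (take ℓ σ)

    private
      Exclusive : List ℕ → Set
      Exclusive σ = ∀ q q' → Pl q → q + q' ≡ m + m → cnt q σ + cnt (suc q') σ ≤ 1

      mates : ∀ {a b} → Pl a → Pl b → a ≢ b → a + b ≡ m + m
      mates (inj₁ refl) (inj₁ refl) n = ⊥-elim (n refl)
      mates (inj₁ refl) (inj₂ refl) n = i+j'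
      mates (inj₂ refl) (inj₁ refl) n = trans (+-comm j i) i+j'
      mates (inj₂ refl) (inj₂ refl) n = ⊥-elim (n refl)

      -- The first letter of nonneutral sign decides. For its own q it is ahead of the opposite
      -- letter, which occurs at most once. For the mate of q the opposite letter cannot occur,
      -- being the bar of that first letter.
      dichotomy' : ∀ σ → Exclusive σ → Asc σ ⊎ StrictlyDesc σ
      dichotomy' [] H = inj₁ λ { zero q _ → z≤n ; (suc ℓ) q _ → z≤n }
      dichotomy' (c ∷ σ) H with proj₁ (view c) | proj₂ (view c)
      ... | ⊕ | vp pc = inj₁ asc
        where
        asc : Asc (c ∷ σ)
        asc zero q p = z≤n
        asc (suc ℓ) q p rewrite is-≢ {suc q} {c} (λ { refl → gap p pc }) with q ≟ c
        ... | yes refl = let q' , p' , eq = mate p in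
                ≤-trans (cnt-take (suc q) ℓ σ) (≤-trans (≤-trans (m≤n+m _ (cnt q' (q ∷ σ)))
                  (≤-trans (+-monoʳ-≤ (cnt q' (q ∷ σ)) (m≤n+m _ (is (suc q) q))) (H q' q p' (trans (+-comm q' q) eq))))
                  (≤-trans (≤-reflexive (sym (is-refl q))) (m≤m+n _ _)))
        ... | no q≢c = ≤-trans (cnt-take (suc q) ℓ σ) (≤-trans
                (+-cancelˡ-≤ 1 _ _ (≤-trans (+-mono-≤ (≤-trans (≤-reflexive (sym (is-refl c))) (m≤m+n _ (cnt c σ)))
                   (m≤n+m _ (is (suc q) c))) (H c q pc (mates pc p (q≢c ∘ sym))))) z≤n)
      ... | ⊖ | vm {c'} refl pc = inj₂ (desc , 1 , c' , pc , s≤s z≤n , strict)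
        where
        strict : is c' (suc c') + 0 < is c' c' + 0
        strict rewrite is-≢ {c'} {suc c'} (λ ()) | is-refl c' = s≤s z≤n
        desc : Desc (suc c' ∷ σ)
        desc zero q p = z≤n
        desc (suc ℓ) q p rewrite is-≢ {q} {suc c'} (λ { refl → gap pc p }) with q ≟ c'
        ... | yes refl = let q' , p' , eq = mate p in
                ≤-trans (cnt-take q ℓ σ) (≤-trans (≤-trans (m≤n+m _ (is q (suc q)))
                  (≤-trans (m≤m+n _ _) (H q q' p eq))) (≤-trans (≤-reflexive (sym (is-refl q))) (m≤m+n _ _)))
        ... | no q≢c = ≤-trans (cnt-take q ℓ σ) (≤-trans
                (+-cancelʳ-≤ 1 _ _ (≤-trans (+-mono-≤ (m≤n+m _ (is q (suc c')))
                  (≤-trans (≤-reflexive (sym (is-refl c'))) (m≤m+n _ (cnt (suc c') σ))))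
                  (H q c' p (mates p pc q≢c)))) z≤n)
      ... | ⊙ | vz n n' = [ inj₁ ∘ asc , inj₂ ∘ desc ]′ (dichotomy' σ λ q q' p eq →
          ≤-trans (+-mono-≤ (m≤n+m _ (is q c)) (m≤n+m _ (is (suc q') c))) (H q q' p eq))
        where
        drop₁ : ∀ {q} → Pl q → ∀ ℓ → cnt (suc q) (take ℓ σ) ≡ cnt (suc q) (take (suc ℓ) (c ∷ σ))
        drop₁ {q} p ℓ = cong (_+ cnt (suc q) (take ℓ σ)) (sym (is-≢ {suc q} {c} (λ eq → n' (sym eq) p)))
        drop₂ : ∀ {q} → Pl q → ∀ ℓ → cnt q (take ℓ σ) ≡ cnt q (take (suc ℓ) (c ∷ σ))
        drop₂ {q} p ℓ = cong (_+ cnt q (take ℓ σ)) (sym (is-≢ {q} {c} (λ { refl → n p })))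
        asc : Asc σ → Asc (c ∷ σ)
        asc a zero q p = z≤n
        asc a (suc ℓ) q p = subst₂ _≤_ (drop₁ p ℓ) (drop₂ p ℓ) (a ℓ q p)
        desc : StrictlyDesc σ → StrictlyDesc (c ∷ σ)
        desc (d , ℓ₀ , q₀ , p₀ , l₀ , s₀) =
          (λ { zero q p → z≤n ; (suc ℓ) q p → subst₂ _≤_ (drop₂ p ℓ) (drop₁ p ℓ) (d ℓ q p) }) ,
          suc ℓ₀ , q₀ , p₀ , s≤s l₀ , subst₂ _<_ (drop₂ p₀ ℓ₀) (drop₁ p₀ ℓ₀) s₀

    dichotomy : ∀ {σ} → Flag σ → Asc σ ⊎ StrictlyDesc σ
    dichotomy {σ} F = dichotomy' σ λ q q' p eq → ≤-reflexive
      (trans (cong (λ c → cnt q σ + cnt c σ) (sym (proj₁ (conj-Pl eq)))) (F .once q (proj₁ (Pl-range p))))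

    StrictPos StrictNeg : List ℕ → Set
    StrictPos x = Σ ℕ λ q → Pl q × cnt (suc q) x < cnt q x
    StrictNeg x = Σ ℕ λ q → Pl q × cnt q x < cnt (suc q) x

    strictPos-asc : ∀ {ρ x} → Flag ρ → StrictPos x → take (length x) ρ ≋ x → Asc ρ
    strictPos-asc {ρ} {x} F (q , p , lt) eq with dichotomy F
    ... | inj₁ a = a
    ... | inj₂ (d , _) = ⊥-elim (<⇒≱ lt (subst₂ _≤_ (eq q) (eq (suc q)) (d (length x) q p)))

    strictNeg-desc : ∀ {ρ x} → Flag ρ → StrictNeg x → take (length x) ρ ≋ x → Desc ρ
    strictNeg-desc {ρ} {x} F (q , p , lt) eq with dichotomy F
    ... | inj₁ a = ⊥-elim (<⇒≱ lt (subst₂ _≤_ (eq (suc q)) (eq q) (a (length x) q p)))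
    ... | inj₂ (d , _) = d

    -- e_i^max on a sequence of extremal columns; the Boolean tells whether an unmatched ⊕ is pending.
    data Tr : Bool → List (List ℕ) → List (List ℕ) → Set where
      []   : ∀ {b} → Tr b [] []
      tpos : ∀ {b x xs ys} → StrictPos x → Tr true xs ys → Tr b (x ∷ xs) (x ∷ ys)
      tzer : ∀ {b x xs ys} → S x ≋ x → Tr b xs ys → Tr b (x ∷ xs) (x ∷ ys)
      tneg : ∀ {b x xs ys} → StrictNeg x → Tr b xs ys → Tr true (x ∷ xs) (x ∷ ys)
      tflp : ∀ {x y xs ys} → StrictNeg x → y ≋ S x → length y ≡ length x → Tr false xs ys →
             Tr false (x ∷ xs) (y ∷ ys)

    S-take : ∀ {σ x} ℓ → take ℓ σ ≋ x → take ℓ (S σ) ≋ S x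
    S-take {σ} {x} ℓ eq c rewrite take-map {f = sw} ℓ σ = S-cong {take ℓ σ} {x} eq c

    -- The string property, proved along the columns. While no ⊕ is pending, lifting carries the
    -- chain from the bound τ to s_i τ, or back. Once one is pending the columns agree, up to a
    -- negative column that uses it up; the σ starting with that column has a descent at i, so the
    -- first situation applies again with this σ as bound.
    dem-lower : ∀ {xs ys τ} → Tr false xs ys → Flag τ → Desc τ → Dem τ xs → Dem (S τ) ys
    dem-raise : ∀ {xs ys τ} → Tr false xs ys → Flag τ → Desc τ → Dem τ ys → Dem τ xs
    dem-fwd : ∀ {xs ys τ} → Tr true xs ys → Flag τ → Dem τ xs → Dem τ ys
    dem-bwd : ∀ {xs ys τ} → Tr true xs ys → Flag τ → Dem τ ys → Dem τ xs

    dem-lower [] F d D = tt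
    dem-lower {τ = τ} (tpos {x = x} sp T) F d (ρ , G , le , eq , D) =
      ρ , G , lift-down G F (strictPos-asc {ρ} {x} G sp eq) d le , eq , dem-fwd T G D
    dem-lower {τ = τ} (tzer {x = x} {xs} z T) F d (ρ , G , le , eq , D) with dichotomy G
    -- A neutral x does not tell on which side of s_i its ρ lies. For an ascending ρ the rest is
    -- also dominated by s_i ρ, which descends and whose reflection is ρ again.
    ... | inj₁ a = ρ , G , lift-down G F a d le , eq , subst (λ v → Dem v _) (S-invol ρ)
          (dem-lower T (S-flag G) (S-desc a) (Dem-mono xs (subst (_⊑ S ρ) (S-invol ρ) (S-⊑ (S-desc a))) D))
    ... | inj₂ (d' , _) = S ρ , S-flag G , S-mono G F d' d le ,
          (λ c → trans (S-take {ρ} {x} (length x) eq c) (z c)) , dem-lower T G d' D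
    dem-lower (tflp {x = x} {y} sn y≋ ly T) F d (ρ , G , le , eq , D) =
      S ρ , S-flag G , S-mono G F d' d le ,
      (λ c → trans (cong (λ ℓ → cnt c (take ℓ (S ρ))) ly) (trans (S-take {ρ} {x} (length x) eq c) (sym (y≋ c)))) ,
      dem-lower T G d' D
      where d' = strictNeg-desc {ρ} {x} G sn eq

    dem-raise [] F d D = tt
    dem-raise (tpos sp T) F d (ρ , G , le , eq , D) = ρ , G , le , eq , dem-bwd T G D
    dem-raise (tzer {x = x} {ys = ys} z T) F d (ρ , G , le , eq , D) with dichotomy G
    ... | inj₁ a = S ρ , S-flag G , lift-up G a d le , (λ c → trans (S-take {ρ} {x} (length x) eq c) (z c)) ,
          dem-raise T (S-flag G) (S-desc a) (Dem-mono ys (subst (_⊑ S ρ) (S-invol ρ) (S-⊑ (S-desc a))) D)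
    ... | inj₂ (d' , _) = ρ , G , le , eq , dem-raise T G d' D
    dem-raise (tflp {x = x} {y} {ys = ys} sn@(q , p , lt) y≋ ly T) F d (ρ , G , le , eq , D) =
      S ρ , S-flag G , lift-up G a d le ,
      (λ c → trans (cong (λ ℓ → cnt c (take ℓ (S ρ))) (sym ly)) (trans (S-take {ρ} {y} (length y) eq c)
        (trans (S-cong {y} {S x} y≋ c) (cong (cnt c) (S-invol x))))) ,
      dem-raise T (S-flag G) (S-desc a) (Dem-mono ys (subst (_⊑ S ρ) (S-invol ρ) (S-⊑ (S-desc a))) D)
      where
      sp : StrictPos y
      sp = q , p , subst₂ _<_ (sym (trans (y≋ (suc q)) (trans (cnt-S (suc q) x) (cong (λ c → cnt c x) (sw-⊖ p)))))
                              (sym (trans (y≋ q) (trans (cnt-S q x) (cong (λ c → cnt c x) (sw-⊕ p))))) lt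
      a = strictPos-asc {ρ} {y} G sp eq

    dem-fwd [] F D = tt
    dem-fwd (tpos sp T) F (ρ , G , le , eq , D) = ρ , G , le , eq , dem-fwd T G D
    dem-fwd (tzer z T) F (ρ , G , le , eq , D) = ρ , G , le , eq , dem-fwd T G D
    dem-fwd (tneg {true} sn T) F (ρ , G , le , eq , D) = ρ , G , le , eq , dem-fwd T G D
    dem-fwd (tneg {false} {x} {ys = ys} sn T) F (ρ , G , le , eq , D) =
      ρ , G , le , eq , Dem-mono ys (S-⊑ d') (dem-lower T G d' D)
      where d' = strictNeg-desc {ρ} {x} G sn eq

    dem-bwd [] F D = tt
    dem-bwd (tpos sp T) F (ρ , G , le , eq , D) = ρ , G , le , eq , dem-bwd T G D
    dem-bwd (tzer z T) F (ρ , G , le , eq , D) = ρ , G , le , eq , dem-bwd T G D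
    dem-bwd (tneg {true} sn T) F (ρ , G , le , eq , D) = ρ , G , le , eq , dem-bwd T G D
    dem-bwd (tneg {false} {x} sn T) F (ρ , G , le , eq , D) =
      ρ , G , le , eq , dem-raise T G (strictNeg-desc {ρ} {x} G sn eq) D

    record Profile (t₁ t₂ : Ty) (w : List ℕ) : Set where
      constructor profile
      field
        at-i   : cnt i w ≡ bit (proj₁ t₁)
        at-1+i : cnt (suc i) w ≡ bit (proj₁ t₂)
        at-j   : cnt j w ≡ bit (proj₂ t₂)
        at-1+j : cnt (suc j) w ≡ bit (proj₂ t₁)

    sits-profile : ∀ {t₁ t₂ X} → Sits e₀ t₁ t₂ X → length X ≡ m → Profile t₁ t₂ (word 1 X)
    sits-profile {X = X} s l with sits-has {k = 1} s
    ... | h , inj₁ h' = profile (cnt-word-pos h (cong suc l)) (cnt-word-pos h' (cong suc l))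
          (trans (cong (λ q → cnt q (word 1 X)) (sym conj-1+i)) (cnt-word-conj h' (cong suc l)))
          (trans (cong (λ q → cnt q (word 1 X)) (sym conj-i)) (cnt-word-conj h (cong suc l)))
    ... | h , inj₂ (refl , len≡) = profile at-i (trans (cong (λ q → cnt (suc q) (word 1 X)) i≡j) at-1+j)
          (trans (cong (λ q → cnt q (word 1 X)) (sym i≡j)) at-i) at-1+j
      where
      at-i = cnt-word-pos h (cong suc l)
      at-1+j = trans (cong (λ q → cnt q (word 1 X)) (sym conj-i)) (cnt-word-conj h (cong suc l))
      i≡j : i ≡ j
      i≡j = trans (trans (sym len≡) l) (+-cancelˡ-≡ m m j (sym (trans (cong (_+ j) (trans (sym l) len≡)) i+j')))

    diff-neutral : ∀ {e k t₁ t₂ u₁ u₂ X Y q} → Diff e t₁ t₂ u₁ u₂ X Y → View q ⊙ → k + e ≡ i →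
                   cnt q (word k X) ≡ cnt q (word k Y)
    diff-neutral {suc e} {k} {q = q} (there {t = a , b} {X} {Y} d) v k+e =
      trans (cnt-layer q k a b X)
        (trans (cong (λ z → cnt q (opt a k) + (z + cnt q (opt b (conj k)))) (diff-neutral d v (shift {k} k+e)))
        (sym (cnt-layer q k a b Y)))
    diff-neutral {zero} {k} {X = X} {Y} {q} D (vz n n') k+e with trans (sym (+-identityʳ k)) k+e
    ... | refl = go D
      where
      gone : ∀ t cs → cnt q (word i (t ∷ cs)) ≡ cnt q (word (suc i) cs)
      gone (a , d) cs = trans (cnt-layer q i a d cs) (trans (cong₂ _+_ (opt-other a λ eq → n (inj₁ eq))
        (cong (cnt q (word (suc i) cs) +_) (opt-other d λ eq → n' (trans eq conj-i) (inj₂ refl)))) (+-identityʳ _))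
      gone' : ∀ t cs → cnt q (word (suc i) (t ∷ cs)) ≡ cnt q (word (suc (suc i)) cs)
      gone' (b , c) cs = trans (cnt-layer q (suc i) b c cs) (trans (cong₂ _+_ (opt-other b λ eq → n' eq (inj₁ refl))
        (cong (cnt q (word (suc (suc i)) cs) +_) (opt-other c λ eq → n (inj₂ (trans eq conj-1+i))))) (+-identityʳ _))
      go : ∀ {t₁ t₂ u₁ u₂ X Y} → Diff 0 t₁ t₂ u₁ u₂ X Y → cnt q (word i X) ≡ cnt q (word i Y)
      go (here {t₁} {t₂} {u₁} {u₂} {cs}) = trans (trans (gone t₁ (t₂ ∷ cs)) (gone' t₂ cs)) (sym (trans (gone u₁ (u₂ ∷ cs)) (gone' u₂ cs)))
      go (last {t} {u}) = trans (gone t []) (sym (gone u []))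

    private
      bit-lt : ∀ a b → (a ∧ not b) ≡ true → bit b < bit a
      bit-lt true false _ = s≤s z≤n

    profile-pos : ∀ {t₁ t₂ w} → Profile t₁ t₂ w → posT t₁ t₂ ≡ true → StrictPos w
    profile-pos {a , d} {b , c} (profile x y z u) e with ∨-true {a ∧ not b} e
    ... | inj₁ f = i , inj₁ refl , subst₂ _<_ (sym y) (sym x) (bit-lt a b f)
    ... | inj₂ f = j , inj₂ refl , subst₂ _<_ (sym u) (sym z) (bit-lt c d f)

    profile-neg : ∀ {t₁ t₂ w} → Profile t₁ t₂ w → negT t₁ t₂ ≡ true → StrictNeg w
    profile-neg {a , d} {b , c} (profile x y z u) e with ∨-true {b ∧ not a} e
    ... | inj₁ f = i , inj₁ refl , subst₂ _<_ (sym x) (sym y) (bit-lt b a f)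
    ... | inj₂ f = j , inj₂ refl , subst₂ _<_ (sym z) (sym u) (bit-lt d c f)

    profile-swap : ∀ {t₁ t₂ w w'} → Profile t₁ t₂ w → Profile t₂ t₁ w' →
                   (∀ {q} → View q ⊙ → cnt q w ≡ cnt q w') → w' ≋ S w
    profile-swap {w = w} {w'} (profile x y z u) (profile x' y' z' u') f q = trans (go (view q)) (sym (cnt-S q w))
      where
      go : Σ Sg (View q) → cnt q w' ≡ cnt (sw q) w
      go (⊕ , vp P@(inj₁ refl)) rewrite sw-⊕ P = trans x' (sym y)
      go (⊕ , vp P@(inj₂ refl)) rewrite sw-⊕ P = trans z' (sym u)
      go (⊖ , vm refl P@(inj₁ refl)) rewrite sw-⊖ P = trans y' (sym x)
      go (⊖ , vm refl P@(inj₂ refl)) rewrite sw-⊖ P = trans u' (sym z)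
      go (⊙ , v) rewrite sw-⊙ v = sym (f v)

    st-tr : ∀ {b b' t₁ t₂ u₁ u₂ X Y xs ys} → St b t₁ t₂ u₁ u₂ b' → Diff e₀ t₁ t₂ u₁ u₂ X Y → length X ≡ m →
            Tr b' xs ys → Tr b (word 1 X ∷ xs) (word 1 Y ∷ ys)
    st-tr {X = X} {Y} st D len T with sits-profile (proj₁ (diff-sits D)) len
                      | sits-profile (proj₂ (diff-sits D)) (trans (sym (diff-length D)) len)
    st-tr (spos e) D len T | P | Q rewrite diff-refl D = tpos (profile-pos Q e) T
    st-tr {X = X} szer D len T | P | Q rewrite diff-refl D = tzer (λ c → sym (profile-swap Q Q (λ _ → refl) c)) T
    st-tr (sneg e) D len T | P | Q rewrite diff-refl D = tneg (profile-neg Q e) T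
    st-tr {X = X} {Y} (sflp e) D len T | P | Q = tflp (profile-neg P e)
      (profile-swap P Q (λ v → diff-neutral D v refl))
      (trans (length-word 1 Y) (trans (sym (swap-size D)) (sym (length-word 1 X)))) T

    cols-tr : ∀ p cs → All (λ c → length c ≡ m) cs →
              Tr (pos? p) (exts cs) (exts (Ecols e₀ p cs))
    cols-tr p [] [] = []
    cols-tr p (c ∷ cs) (l ∷ ls) with column-steps e₀ p c (≤-trans e₀<m (≤-reflexive (sym l)))
    ... | steps b r s dr dl = st-tr r dr (trans (length-resolve rTy c) l) (st-tr s dl (trans (length-resolve lTy c) l)
            (cols-tr (Eo e₀ p c) cs ls))

  -- What is kept of Knuth equivalence: weights after sequences of raisings.

  Ix : Set
  Ix = Σ ℕ (_< m)

  raise : Ix → List ℕ → List ℕ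
  raise (e , l) = At.E e l 0

  raises : List Ix → List ℕ → List ℕ
  raises [] w = w
  raises (x ∷ J) w = raises J (raise x w)

  -- Equality of weights, as the invariance of 2 (sum of codes) − (2m + 1) (length).
  Bal : List ℕ → List ℕ → Set
  Bal w w' = (sum w + sum w) + suc (m + m) * length w' ≡ (sum w' + sum w') + suc (m + m) * length w

  bal-trans : ∀ {u v w} → Bal u v → Bal v w → Bal u w
  bal-trans {u} {v} {w} p q = go (sum u + sum u) (sum v + sum v) (sum w + sum w)
      (suc (m + m) * length u) (suc (m + m) * length v) (suc (m + m) * length w) p q
    where
    go : ∀ a b c x y z → a + y ≡ b + x → b + z ≡ c + y → a + z ≡ c + x
    go a b c x y z e f = +-cancelʳ-≡ (b + y) (a + z) (c + x)
      (trans (r₁ a b y z) (trans (cong₂ _+_ e f) (r₂ b c x y)))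
      where
      r₁ : ∀ a b y z → (a + z) + (b + y) ≡ (a + y) + (b + z)
      r₁ = solve-∀
      r₂ : ∀ b c x y → (b + x) + (c + y) ≡ (c + x) + (b + y)
      r₂ = solve-∀

  infix 4 _≈_
  -- Besides the column lengths, this is all that the transfer of domination needs to know about two
  -- words.
  _≈_ : List ℕ → List ℕ → Set
  w ≈ w' = ∀ J → Bal (raises J w) (raises J w')

  ≈-sym : ∀ {w w'} → w ≈ w' → w' ≈ w
  ≈-sym p J = sym (p J)

  ≈-trans : ∀ {u v w} → u ≈ v → v ≈ w → u ≈ w
  ≈-trans {u} {v} {w} p q J = bal-trans {raises J u} {raises J v} {raises J w} (p J) (q J)

  bal-same : ∀ {w w'} → sum w ≡ sum w' → length w ≡ length w' → Bal w w'
  bal-same e f rewrite e | f = refl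

  -- The removed letters k and `conj k` have sum 2m + 1 and length 2; hence the factor 2m + 1 of the
  -- lengths in `Bal`.
  bal-word : ∀ {d k c c'} → Contract d c c' → k + length c ≡ suc m → 1 ≤ k →
             sum (word k c) ≡ suc (m + m) + sum (word k c') × length (word k c) ≡ 2 + length (word k c')
  bal-word {k = k} (hit {cs} _) eq _ =
    (trans (cong (k +_) (sum-++ (word (suc k) cs) (conj k ∷ [])))
      (trans (cong (λ x → k + (sum (word (suc k) cs) + x)) (+-identityʳ (conj k)))
      (trans (cong (k +_) (+-comm _ (conj k))) (trans (sym (+-assoc k (conj k) _))
        (cong₂ _+_ (conj-sum (≤-trans (≤-trans (m≤m+n k _) (≤-reflexive eq)) (s≤s (m≤m+n m m)))) (cong sum (sym (++-identityʳ (word (suc k) cs))))))))) ,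
    cong suc (trans (length-++ (word (suc k) cs)) (trans (+-comm _ 1) (cong suc (cong length (sym (++-identityʳ (word (suc k) cs)))))))
  bal-word {k = k} (none {cs = cs} {cs'} x) eq l with bal-word x (shift {k} eq) (s≤s z≤n)
  ... | s , n rewrite ++-identityʳ (word (suc k) cs) | ++-identityʳ (word (suc k) cs') = s , n
  bal-word {k = k} (bar₁ {cs = cs} {cs'} x) eq l with bal-word x (shift {k} eq) (s≤s z≤n)
  ... | s , n rewrite sum-++ (word (suc k) cs) (conj k ∷ []) | sum-++ (word (suc k) cs') (conj k ∷ [])
                    | length-++ (word (suc k) cs) {conj k ∷ []} | length-++ (word (suc k) cs') {conj k ∷ []} | s | n =
    +-assoc (suc (m + m)) _ _ , refl
  bal-word {k = k} (pos₁ {cs = cs} {cs'} x) eq l with bal-word x (shift {k} eq) (s≤s z≤n)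
  ... | s , n rewrite ++-identityʳ (word (suc k) cs) | ++-identityʳ (word (suc k) cs') | s | n =
    trans (sym (+-assoc k (suc (m + m)) _)) (trans (cong (_+ sum (word (suc k) cs')) (+-comm k (suc (m + m)))) (+-assoc (suc (m + m)) k _)) , refl
  bal-word {k = k} (both {cs = cs} {cs'} x) eq l with bal-word x (shift {k} eq) (s≤s z≤n)
  ... | s , n rewrite sum-++ (word (suc k) cs) (conj k ∷ []) | sum-++ (word (suc k) cs') (conj k ∷ [])
                    | length-++ (word (suc k) cs) {conj k ∷ []} | length-++ (word (suc k) cs') {conj k ∷ []} | s | n =
    r k (suc (m + m)) (sum (word (suc k) cs')) (conj k + 0) , refl
    where
    r : ∀ k n a b → k + (n + a + b) ≡ n + (k + (a + b))
    r = solve-∀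

  bal-KS : ∀ {x y} → KS x y → Bal x y
  bal-KS (ks1 {α} {β} {γ} _ _ _) = bal-same {γ ∷ β ∷ α ∷ []} {β ∷ γ ∷ α ∷ []} (r γ β α) refl
    where
    r : ∀ a b c → a + (b + (c + 0)) ≡ b + (a + (c + 0))
    r = solve-∀
  bal-KS (ks2 {α} {β} {γ} _ _ _) = bal-same {α ∷ β ∷ γ ∷ []} {α ∷ γ ∷ β ∷ []} (r α β γ) refl
    where
    r : ∀ a b c → a + (b + (c + 0)) ≡ a + (c + (b + 0))
    r = solve-∀
  bal-KS (ks3 {y} {y'} {β} _ _ _) = bal-same {suc y ∷ y' ∷ β ∷ []} {suc y' ∷ y ∷ β ∷ []} (r y y' β) refl
    where
    r : ∀ a b c → suc a + (b + (c + 0)) ≡ suc b + (a + (c + 0))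
    r = solve-∀
  bal-KS (ks4 {y} {y'} {β} _ _ _) = bal-same {β ∷ suc y' ∷ y ∷ []} {β ∷ suc y ∷ y' ∷ []} (r y y' β) refl
    where
    r : ∀ a b c → c + (suc b + (a + 0)) ≡ c + (suc a + (b + 0))
    r = solve-∀
  bal-KS (ks5 {c} {c'} x len) with bal-word x (cong suc len) (s≤s z≤n)
  ... | s , n rewrite s | n = r (suc (m + m)) (sum (word 1 c')) (length (word 1 c'))
    where
    r : ∀ N a b → (N + a) + (N + a) + N * b ≡ a + a + N * (2 + b)
    r = solve-∀

  bal-ctx : ∀ u v {x y} → Bal x y → Bal (u ++ x ++ v) (u ++ y ++ v)
  bal-ctx u v {x} {y} b
    rewrite sum-++ u (x ++ v) | sum-++ x v | sum-++ u (y ++ v) | sum-++ y v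
          | length-++ u {x ++ v} | length-++ x {v} | length-++ u {y ++ v} | length-++ y {v} =
    trans (r (sum u) (sum v) (sum x) (suc (m + m)) (length u) (length v) (length y))
      (trans (cong (((sum u + sum v) + (sum u + sum v) + suc (m + m) * (length u + length v)) +_) b)
        (sym (r (sum u) (sum v) (sum y) (suc (m + m)) (length u) (length v) (length x))))
    where
    r : ∀ U V X N a b c → (U + (X + V)) + (U + (X + V)) + N * (a + (c + b)) ≡
                          ((U + V) + (U + V) + N * (a + b)) + (X + X + N * c)
    r = solve-∀

  KC-bal : ∀ {w w'} → KC w w' → Bal w w'
  KC-bal (kc u v same) = refl
  KC-bal (kc u v (fwd s)) = bal-ctx u v (bal-KS s)
  KC-bal (kc u {x} {y} v (bwd s)) = sym (bal-ctx u v {y} {x} (bal-KS s))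

  KC-≈ : ∀ {w w'} → KC w w' → w ≈ w'
  KC-≈ k [] = KC-bal k
  KC-≈ k ((e , l) ∷ J) = KC-≈ (At.KC-compat e l k) J

  -- Raising on words of columns, and a length for signed permutations.

  record Good (c : List Ty) : Set where
    constructor good
    field
      length≡ : length c ≡ m
      pending≡ : pending c ≡ 0
  open Good public

  reading : List (List Ty) → List ℕ
  reading cs = concat (map (word 1) cs)

  sizes : List (List Ty) → List ℕ
  sizes = map size

  size-Et : ∀ e (l : e < m) p c → length c ≡ m → size (Et e p c) ≡ size c
  size-Et e l p c len = trans (sym (length-word 1 (Et e p c)))
    (trans (cong length (sym (proj₁ (At.col e l p c len)))) (trans (At.length-E e l p (word 1 c)) (length-word 1 c)))

  sizes-Ecols : ∀ e (l : e < m) p {cs} → All Good cs → sizes (Ecols e p cs) ≡ sizes cs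
  sizes-Ecols e l p [] = refl
  sizes-Ecols e l p {c ∷ cs} (g ∷ gs) = cong₂ _∷_ (size-Et e l p c (length≡ g)) (sizes-Ecols e l (Eo e p c) gs)

  good-Ecols : ∀ e (l : e < m) p {cs} → All Good cs → All Good (Ecols e p cs)
  good-Ecols e l p [] = []
  good-Ecols e l p {c ∷ cs} (good len h ∷ gs) =
    good (trans (length-Et e p c) len) (trans (pending-Et e p c (≤-trans (s≤s z≤n) (≤-trans l (≤-reflexive (sym len))))) h)
    ∷ good-Ecols e l (Eo e p c) gs

  reading-Ecols : ∀ e (l : e < m) p {cs} → All Good cs → At.E e l p (reading cs) ≡ reading (Ecols e p cs)
  reading-Ecols e l p [] = refl
  reading-Ecols e l p {c ∷ cs} (good len _ ∷ gs) with At.col e l p c len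
  ... | E≡ , o≡ = trans (At.E-++ e l p (word 1 c) (reading cs))
        (cong₂ _++_ E≡ (trans (cong (λ q → At.E e l q (reading cs)) o≡) (reading-Ecols e l (Eo e p c) gs)))

  -- A strictly monotone function on the Bruhat order, used like the Coxeter length. The ranges
  -- contain every prefix length and every threshold up to 2m + 1, so that comparable permutations
  -- of equal `μ` have the same letters in all prefixes.
  μ : List ℕ → ℕ
  μ σ = sumTo (suc m) λ ℓ → sumTo (suc (suc (m + m))) λ t → ge t (take ℓ σ)

  μ-mono : ∀ {σ τ} → σ ⊑ τ → μ σ ≤ μ τ
  μ-mono le = sumTo-mono (suc m) λ ℓ → sumTo-mono (suc (suc (m + m))) (le ℓ)

  μ-strict : ∀ {σ τ ℓ t} → σ ⊑ τ → ℓ ≤ m → t ≤ suc (m + m) → ge t (take ℓ σ) < ge t (take ℓ τ) → μ σ < μ τ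
  μ-strict {ℓ = ℓ} le l u lt = sumTo-strict (suc m) (λ ℓ → sumTo-mono (suc (suc (m + m))) (le ℓ)) (s≤s l)
    (sumTo-strict (suc (suc (m + m))) (le ℓ) (s≤s u) lt)

  μ-≡ : ∀ {σ τ ℓ q} → σ ⊑ τ → μ σ ≡ μ τ → ℓ ≤ m → q ≤ m + m → cnt q (take ℓ σ) ≡ cnt q (take ℓ τ)
  μ-≡ {σ} {τ} {ℓ} {q} le eq l u = +-cancelˡ-≡ (ge (suc q) (take ℓ σ)) _ _
    (trans (sym (ge-suc q (take ℓ σ))) (trans (ges (≤-trans u (n≤1+n _)))
      (trans (ge-suc q (take ℓ τ)) (cong (_+ cnt q (take ℓ τ)) (sym (ges (s≤s u)))))))
    where
    ges : ∀ {t} → t ≤ suc (m + m) → ge t (take ℓ σ) ≡ ge t (take ℓ τ)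
    ges t≤ = sumTo-≡ (suc (suc (m + m))) (le ℓ)
      (sumTo-≡ (suc m) (λ ℓ → sumTo-mono (suc (suc (m + m))) (le ℓ)) eq (s≤s l)) (s≤s t≤)

  -- The identity, and the words it dominates.

  Ascending : List ℕ → Set
  Ascending σ = ∀ e (l : e < m) → At.Asc e l σ

  search : ∀ {σ} → Flag σ → Ascending σ ⊎ Σ Ix λ (e , l) → At.StrictlyDesc e l σ
  search {σ} F = [ (λ f → inj₁ λ e l → f e l l) , inj₂ ]′ (go m ≤-refl)
    where
    go : ∀ k → k ≤ m → (∀ e → e < k → (l : e < m) → At.Asc e l σ) ⊎ Σ Ix λ (e , l) → At.StrictlyDesc e l σ
    go zero _ = inj₁ λ e ()
    go (suc k) k<m with At.dichotomy k k<m F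
    ... | inj₂ d = inj₂ ((k , k<m) , d)
    ... | inj₁ a with go k (≤-trans (n≤1+n k) k<m)
    ... | inj₂ r = inj₂ r
    ... | inj₁ f = inj₁ λ e e<k l → case m≤n⇒m<n∨m≡n (≤-pred e<k) of λ
          { (inj₁ lt) → f e lt l ; (inj₂ refl) → subst (λ z → At.Asc k z σ) (≤-irrelevant k<m l) a }

  -- For q > m the letters q, q + 1 are j, j + 1 for the index 2m - q.
  ascending-pred : ∀ {σ} → Ascending σ → ∀ ℓ {q} → 1 ≤ q → suc q ≤ m + m → cnt (suc q) (take ℓ σ) ≤ cnt q (take ℓ σ)
  ascending-pred {σ} A ℓ {suc e} _ u with suc e ≤? m
  ... | yes l = A e l ℓ (suc e) (inj₁ refl)
  ... | no l = A e' e'<m ℓ (suc e) (inj₂ (sym eq))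
    where
    e' = m + m ∸ suc (suc e)
    s≡ : suc e' + suc e ≡ m + m
    s≡ = trans (sym (+-suc e' (suc e))) (m∸n+n≡m u)
    e'<m : suc e' ≤ m
    e'<m = +-cancelʳ-≤ (suc e) (suc e') m (≤-trans (≤-reflexive s≡) (+-monoʳ-≤ m (<⇒≤ (≰⇒> l))))
    eq : m + m ∸ suc e' ≡ suc e
    eq = trans (cong (_∸ suc e') (trans (sym s≡) (+-comm (suc e') (suc e)))) (m+n∸n≡m (suc e) (suc e'))

  -- After 1, ..., k the next letter c exceeds k because letters do not repeat. If c > 1, then c - 1
  -- also occurs in the prefix, as its count bounds that of c, so c - 1 is at most k.
  ascending-top : ∀ {σ} → Flag σ → Ascending σ → σ ≡ run 1 m
  ascending-top {σ} F A = trans (go 0 σ refl (F .len)) (cong (run 1) (F .len))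
    where
    go : ∀ k rest → σ ≡ run 1 k ++ rest → k + length rest ≡ m → rest ≡ run (suc k) (length rest)
    go k [] eq len = refl
    go k (c ∷ rest) eq len = cong₂ _∷_ c≡ (go (suc k) rest
        (trans eq (trans (cong (λ x → run 1 k ++ x ∷ rest) c≡) (run-snoc 1 k rest)))
        (trans (sym (+-suc k _)) len))
      where
      c-range : InRange c
      c-range = at (run 1 k) (subst (All InRange) eq (F .range))
        where
        at : ∀ u → All InRange (u ++ c ∷ rest) → InRange c
        at [] (r ∷ _) = r
        at (_ ∷ u) (_ ∷ rs) = at u rs

      prefix : take (suc k) σ ≡ run 1 k ++ c ∷ []
      prefix = trans (cong (take (suc k)) eq) (at 1 k)
        where
        at : ∀ a k → take (suc k) (run a k ++ c ∷ rest) ≡ run a k ++ c ∷ []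
        at a zero = refl
        at a (suc k) = cong (a ∷_) (at (suc a) k)

      cnt-prefix : ∀ q → cnt q (take (suc k) σ) ≡ cnt q (run 1 k) + is q c
      cnt-prefix q = trans (cong (cnt q) prefix) (trans (cnt-++ q (run 1 k) (c ∷ [])) (cong (cnt q (run 1 k) +_) (+-identityʳ _)))

      lower : suc k ≤ c
      lower with suc k ≤? c
      ... | yes l = l
      ... | no l = ⊥-elim (<⇒≱ ≤-refl (≤-trans (≤-reflexive (trans
              (sym (cong₂ _+_ (cnt-run 1 k (proj₁ c-range) (≰⇒> l)) (is-refl c))) (sym (cnt-prefix c))))
              (cnt≤1 F (suc k) c-range)))

      upper : ∀ {c'} → c ≡ suc c' → c' ≤ k
      upper {zero} _ = z≤n
      upper {suc c'} refl = ≤-pred (cnt-run-bound 1 k (≤-trans (≤-trans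
          (≤-trans (≤-reflexive (sym (is-refl c))) (m≤n+m _ (cnt c (run 1 k))))
          (≤-trans (≤-reflexive (sym (cnt-prefix c))) (ascending-pred A (suc k) (s≤s z≤n) (proj₂ c-range))))
          (≤-reflexive (trans (cnt-prefix (suc c')) (trans (cong (cnt (suc c') (run 1 k) +_) (is-≢ {suc c'} {c} (λ ()))) (+-identityʳ _))))))

      c≡ : c ≡ suc k
      c≡ = squeeze lower upper
        where
        squeeze : ∀ {c} → suc k ≤ c → (∀ {c'} → c ≡ suc c' → c' ≤ k) → c ≡ suc k
        squeeze {suc c'} l u = cong suc (≤-antisym (u refl) (≤-pred l))

  cnt-word-bar : ∀ k a cs → 0 < cnt (conj k) (word k ((a , true) ∷ cs))
  cnt-word-bar k a cs rewrite cnt-++ (conj k) (opt a k) (word (suc k) cs ++ conj k ∷ [])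
    | cnt-++ (conj k) (word (suc k) cs) (conj k ∷ []) | is-refl (conj k) =
    ≤-trans (m≤n+m 1 (cnt (conj k) (word (suc k) cs))) (m≤n+m _ (cnt (conj k) (opt a k)))

  cnt-word-mid : ∀ q k t cs → cnt q (word (suc k) cs) ≤ cnt q (word k (t ∷ cs))
  cnt-word-mid q k (a , b) cs rewrite cnt-++ q (opt a k) (word (suc k) cs ++ opt b (conj k))
    | cnt-++ q (word (suc k) cs) (opt b (conj k)) =
    ≤-trans (m≤m+n _ (cnt q (opt b (conj k)))) (m≤n+m _ (cnt q (opt a k)))

  low-noBars : ∀ k c → k + length c ≡ suc m → (∀ q → suc m ≤ q → cnt q (word k c) ≡ 0) → NoBars c
  low-noBars k [] eq low = []
  low-noBars k ((a , false) ∷ cs) eq low = refl ∷ low-noBars (suc k) cs (shift {k} eq)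
    λ q l → n≤0⇒n≡0 (≤-trans (cnt-word-mid q k (a , false) cs) (≤-reflexive (low q l)))
  low-noBars k ((a , true) ∷ cs) eq low = ⊥-elim (<⇒≢ (cnt-word-bar k a cs) (sym (low (conj k) (conj-big (k≤m eq)))))

  -- Distinct unbarred letters from k on, all below k + `size c`, leave no room for a gap.
  noBars-run : ∀ k {c} → NoBars c → (∀ q → k + size c ≤ q → cnt q (word k c) ≡ 0) → word k c ≡ run k (size c)
  noBars-run k [] _ = refl
  noBars-run k {(true , false) ∷ c} (refl ∷ nb) low rewrite ++-identityʳ (word (suc k) c) =
    cong (k ∷_) (noBars-run (suc k) nb λ q l → n≤0⇒n≡0 (≤-trans (m≤n+m _ (is q k)) (≤-reflexive (low q (≤-trans (≤-reflexive (+-suc k _)) l)))))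
  noBars-run k {(false , false) ∷ c} (refl ∷ nb) low rewrite ++-identityʳ (word (suc k) c)
    with noBars-run (suc k) nb (λ q l → low q (≤-trans (n≤1+n _) l))
  ... | eq with size c
  ... | zero = eq
  ... | suc s = ⊥-elim (case trans (sym (low (suc k + s) (≤-reflexive (+-suc k s))))
                  (trans (cong (cnt (suc k + s)) eq) (cnt-run (suc k) (suc s) (m≤m+n _ s) (≤-reflexive (sym (+-suc (suc k) s))))) of λ ())

  sum-run : ∀ k s → sum (run (suc k) s) ≡ s + sum (run k s)
  sum-run k zero = refl
  sum-run k (suc s) rewrite sum-run (suc k) s = r k s (sum (run (suc k) s))
    where
    r : ∀ k s a → suc k + (s + a) ≡ suc (s + (k + a))
    r = solve-∀

  sum-run-snoc : ∀ k s → sum (run k (suc s)) ≡ sum (run k s) + (k + s)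
  sum-run-snoc k s = trans (cong sum (sym (trans (run-snoc k s []) (++-identityʳ (run k (suc s))))))
    (trans (sum-++ (run k s) ((k + s) ∷ [])) (cong (sum (run k s) +_) (+-identityʳ _)))

  -- Runs are recognised by weight: every letter is at least its counterpart in the run, so a sum no
  -- larger than that of the run leaves no slack anywhere.
  least-sum : ∀ k c → k + length c ≡ suc m →
    sum (run k (size c)) ≤ sum (word k c) × (sum (word k c) ≤ sum (run k (size c)) → word k c ≡ run k (size c))
  least-sum k [] eq = z≤n , λ _ → refl
  least-sum k ((a , b) ∷ cs) eq with least-sum (suc k) cs (shift {k} eq)
  least-sum k ((false , false) ∷ cs) eq | l , f rewrite ++-identityʳ (word (suc k) cs) =
    ≤-trans up l , λ u → tight (≤-trans (≤-trans (≤-reflexive (sym (sum-run k (size cs)))) l) u) (f (≤-trans u up))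
    where
    up : sum (run k (size cs)) ≤ sum (run (suc k) (size cs))
    up = ≤-trans (m≤n+m _ (size cs)) (≤-reflexive (sym (sum-run k (size cs))))
    tight : ∀ {s w} → s + sum (run k s) ≤ sum (run k s) → w ≡ run (suc k) s → w ≡ run k s
    tight {zero} _ e = e
    tight {suc s} h _ = ⊥-elim (<⇒≱ (s≤s (m≤n+m _ s)) h)
  least-sum k ((true , false) ∷ cs) eq | l , f rewrite ++-identityʳ (word (suc k) cs) =
    +-monoʳ-≤ k l , λ u → cong (k ∷_) (f (+-cancelˡ-≤ k _ _ u))
  least-sum k ((false , true) ∷ cs) eq | l , f rewrite sum-++ (word (suc k) cs) (conj k ∷ []) =
    <⇒≤ lt , λ u → ⊥-elim (<⇒≱ lt u)
    where
    lt : k + sum (run (suc k) (size cs)) < sum (word (suc k) cs) + (conj k + 0)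
    lt = ≤-trans (≤-reflexive (cong suc (+-comm k _))) (≤-trans (≤-reflexive (sym (+-suc _ k)))
      (+-mono-≤ l (≤-trans (≤-trans (s≤s (k≤m eq)) (conj-big (k≤m eq))) (≤-reflexive (sym (+-identityʳ _))))))
  least-sum k ((true , true) ∷ cs) eq | l , f rewrite sum-++ (word (suc k) cs) (conj k ∷ []) | +-identityʳ (conj k) =
    +-monoʳ-≤ k bound , λ u → cong (k ∷_) (tight (+-cancelˡ-≤ k _ _ u))
    where
    s = size cs
    -- Exactly 2 `length cs` codes lie strictly between k and `conj k`.
    k+s : suc k + s ≤ conj k
    k+s = +-cancelˡ-≤ k _ _ (≤-trans (≤-reflexive (r₁ k s)) (≤-trans (s≤s (+-monoʳ-≤ (k + k) (size-twice cs)))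
          (≤-trans (≤-reflexive (r₂ k (length cs))) (≤-trans (≤-reflexive (cong (λ x → suc (x + x)) (suc-injective (shift {k} eq))))
          (≤-reflexive (sym (conj-sum (≤-trans (≤-trans (m≤m+n k _) (≤-reflexive eq)) (s≤s (m≤m+n m m))))))))))
      where
      r₁ : ∀ k s → k + (suc k + s) ≡ suc (k + k + s)
      r₁ = solve-∀
      r₂ : ∀ k n → suc (k + k + (n + n)) ≡ suc ((k + n) + (k + n))
      r₂ = solve-∀
    bound : sum (run (suc k) (suc s)) ≤ sum (word (suc k) cs) + conj k
    bound = ≤-trans (≤-reflexive (sum-run-snoc (suc k) s)) (+-mono-≤ l k+s)
    tight : sum (word (suc k) cs) + conj k ≤ sum (run (suc k) (suc s)) → word (suc k) cs ++ conj k ∷ [] ≡ run (suc k) (suc s)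
    tight u = trans (cong₂ (λ x y → x ++ y ∷ []) (f (+-cancelʳ-≤ (suc k + s) _ _ (≤-trans (+-monoʳ-≤ _ k+s) u')))
                 (≤-antisym (+-cancelˡ-≤ (sum (run (suc k) s)) _ _ (≤-trans (+-monoˡ-≤ (conj k) l) u')) k+s))
                 (trans (run-snoc (suc k) s []) (++-identityʳ _))
      where
      u' = ≤-trans u (≤-reflexive (sum-run-snoc (suc k) s))

  sum-reading : ∀ cs → sum (reading cs) ≡ sum (map (sum ∘ word 1) cs)
  sum-reading [] = refl
  sum-reading (c ∷ cs) = trans (sum-++ (word 1 c) (reading cs)) (cong (sum (word 1 c) +_) (sum-reading cs))

  length-reading : ∀ cs → length (reading cs) ≡ sum (sizes cs)
  length-reading [] = refl
  length-reading (c ∷ cs) = trans (length-++ (word 1 c)) (cong₂ _+_ (length-word 1 c) (length-reading cs))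

  least : List (List Ty) → ℕ
  least cs = sum (map (λ c → sum (run 1 (size c))) cs)

  least-≡ : ∀ {cs cs'} → sizes cs ↭ sizes cs' → least cs ≡ least cs'
  least-≡ {cs} {cs'} p = trans (sym (eq cs)) (trans (sum-↭ (↭-map⁺ (λ s → sum (run 1 s)) p)) (eq cs'))
    where
    eq : ∀ cs → sum (map (λ s → sum (run 1 s)) (sizes cs)) ≡ least cs
    eq [] = refl
    eq (c ∷ cs) = cong (_ +_) (eq cs)

  least-≤ : ∀ {cs} → All Good cs → least cs ≤ sum (reading cs)
  least-≤ [] = z≤n
  least-≤ {c ∷ cs} (good len _ ∷ gs) rewrite sum-++ (word 1 c) (reading cs) =
    +-mono-≤ (proj₁ (least-sum 1 c (cong suc len))) (least-≤ gs)

  least-runs : ∀ {cs} → All Good cs → sum (reading cs) ≤ least cs → All (λ c → word 1 c ≡ run 1 (size c)) cs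
  least-runs [] _ = []
  least-runs {c ∷ cs} (good len _ ∷ gs) le rewrite sum-++ (word 1 c) (reading cs) =
    proj₂ (least-sum 1 c (cong suc len)) (+-cancelʳ-≤ (least cs) _ _ (≤-trans (+-monoʳ-≤ _ (least-≤ gs)) le)) ∷
    least-runs gs (+-cancelˡ-≤ (sum (run 1 (size c))) _ _
      (≤-trans (+-monoˡ-≤ _ (proj₁ (least-sum 1 c (cong suc len)))) le))

  bal-sum : ∀ {w w'} → length w ≡ length w' → Bal w w' → sum w ≡ sum w'
  bal-sum {w} {w'} l b = halve (sum w) (sum w')
    (+-cancelʳ-≡ (suc (m + m) * length w') _ _ (trans b (cong (λ x → sum w' + sum w' + suc (m + m) * x) l)))
    where
    halve : ∀ a b → a + a ≡ b + b → a ≡ b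
    halve zero zero e = refl
    halve (suc a) (suc b) e = cong suc (halve a b (suc-injective (trans (sym (+-suc a a)) (trans (suc-injective e) (+-suc b b)))))

  size≤m : ∀ {c} → Good c → size c ≤ m
  size≤m {c} (good len h) = ≤-trans (size-bound c) (≤-reflexive (trans (cong₂ _+_ len h) (+-identityʳ m)))

  run-noBars : ∀ {c} → Good c → word 1 c ≡ run 1 (size c) → NoBars c
  run-noBars {c} g@(good len _) eq = low-noBars 1 c (cong suc len) λ q l →
    n≤0⇒n≡0 (≮⇒≥ λ lt → <⇒≱ (cnt-run-bound 1 (size c) (subst (λ w → 0 < cnt q w) eq lt)) (≤-trans (s≤s (size≤m g)) l))

  -- Below 1 2 ... m the prefixes have no letter larger than their length. So rC contains no bar,
  -- hence neither does C, and C = rC is a run. The bound stays the same for the columns that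
  -- follow.
  dem-top-runs : ∀ {cs} → Flag (run 1 m) → All Good cs → Dem (run 1 m) (exts cs) → All (λ c → word 1 c ≡ run 1 (size c)) cs
  dem-top-runs F [] D = []
  dem-top-runs {c ∷ cs} F (g@(good len h) ∷ gs) (σ , G , le , eq , (σ' , G' , le' , eq' , D)) =
    subst (λ c → word 1 c ≡ run 1 (size c)) r≡c
      (noBars-run 1 nb (λ q l → low q (≤-trans (≤-reflexive (cong suc (length-word 1 (rT c)))) l)))
    ∷ dem-top-runs F gs (Dem-mono (exts cs) (⊑-trans le' le) D)
    where
    x = word 1 (rT c)
    x≤m : length x ≤ m
    x≤m = ≤-trans (≤-reflexive (length-word 1 (rT c))) (≤-trans (≤-reflexive (resolve-size rRes c h)) (size≤m g))
    low : ∀ q → suc (length x) ≤ q → cnt q x ≡ 0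
    low q l = n≤0⇒n≡0 (≤-trans (≤-reflexive (sym (eq q))) (≤-trans (cnt≤ge q (take (length x) σ)) (≤-trans (ge-antitone (take (length x) σ) l)
      (≤-trans (le (length x) _) (≤-reflexive (trans (cong (ge (suc (length x))) (take-run 1 x≤m)) (ge-run 1 (length x))))))))
    nb : NoBars (rT c)
    nb = low-noBars 1 (rT c) (cong suc (trans (length-resolve rTy c) len)) λ q l → low q (≤-trans (s≤s x≤m) l)
    r≡c : rT c ≡ c
    r≡c = resolve-fixed rRes (noBars⇒noPairs (rT-noBars h nb))

  dem-runs : ∀ {cs} → Flag (run 1 m) → All Good cs → All (λ c → word 1 c ≡ run 1 (size c)) cs → Dem (run 1 m) (exts cs)
  dem-runs F [] [] = tt
  dem-runs {c ∷ cs} F (g ∷ gs) (e ∷ es) =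
    subst₂ (λ x y → Dem (run 1 m) (word 1 x ∷ word 1 y ∷ exts cs)) (sym (resolve-fixed rRes np)) (sym (resolve-fixed lRes np))
      (run 1 m , F , ⊑-refl {run 1 m} , at , run 1 m , F , ⊑-refl {run 1 m} , at , dem-runs F gs es)
    where
    np : NoPairs c
    np = noBars⇒noPairs (run-noBars g e)
    at : take (length (word 1 c)) (run 1 m) ≋ word 1 c
    at q = cong (cnt q) (trans (take-run 1 (≤-trans (≤-reflexive (length-word 1 c)) (size≤m g)))
      (trans (cong (run 1) (length-word 1 c)) (sym e)))

  -- Transfer of domination between words, and nested first columns.

  S-μ : ∀ e (l : e < m) {v ℓ q} → Flag v → At.Desc e l v → At.Pl e l q → ℓ ≤ length v →
        cnt q (take ℓ v) < cnt (suc q) (take ℓ v) → μ (At.S e l v) < μ v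
  S-μ e l {v} {ℓ} {q} F d P ℓ≤ lt = μ-strict {At.S e l v} {v} {ℓ} {suc q} (At.S-⊑ e l d) (≤-trans ℓ≤ (≤-reflexive (F .len)))
    (≤-trans (proj₂ (proj₂ (At.Pl-range e l P))) (n≤1+n _))
    (subst (λ w → ge (suc q) w < ge (suc q) (take ℓ v)) (sym (take-map {f = At.sw e l} ℓ v))
      (+-cancelʳ-< (cnt (suc q) (take ℓ v)) _ _ (≤-trans (≤-reflexive (cong suc (At.ge-S e l P (take ℓ v)))) (+-monoʳ-< _ lt))))

  -- Induction on `μ v`. At a descent of v both words are raised and v is lowered. Without descents
  -- v is the identity, so the columns of the first word are runs and its sum is the least one; the
  -- second word has the same sum and column lengths, hence also consists of runs.
  transfer : ∀ N {v cs cs'} → μ v ≤ N → Flag v → All Good cs → All Good cs' → sizes cs ↭ sizes cs' →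
             reading cs ≈ reading cs' → Dem v (exts cs) → Dem v (exts cs')
  transfer-down : ∀ N {v cs cs'} (x : Ix) → At.StrictlyDesc (proj₁ x) (proj₂ x) v →
             μ v ≤ N → Flag v → All Good cs → All Good cs' → sizes cs ↭ sizes cs' →
             reading cs ≈ reading cs' → Dem v (exts cs) → Dem v (exts cs')

  transfer N {v} {cs} {cs'} le F gs gs' p ev D with search F
  ... | inj₂ (x , sd) = transfer-down N x sd le F gs gs' p ev D
  ... | inj₁ A with ascending-top F A
  ... | refl = dem-runs F gs' (least-runs gs' (≤-reflexive (trans (sym sums) (trans tops (least-≡ {cs} {cs'} p)))))
    where
    runs' = dem-top-runs F gs D
    tops : sum (reading cs) ≡ least cs
    tops = trans (sum-reading cs) (at runs')
      where
      at : ∀ {cs} → All (λ c → word 1 c ≡ run 1 (size c)) cs → sum (map (sum ∘ word 1) cs) ≡ least cs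
      at [] = refl
      at (e ∷ es) = cong₂ _+_ (cong sum e) (at es)
    sums : sum (reading cs) ≡ sum (reading cs')
    sums = bal-sum {reading cs} {reading cs'} (trans (length-reading cs) (trans (sum-↭ p) (sym (length-reading cs')))) (ev [])

  transfer-down N (e , l) (d , ℓ , q , P , ℓ≤ , lt) le F gs gs' p ev D with ≤-trans (S-μ e l F d P ℓ≤ lt) le
  transfer-down (suc N) {v} {cs} {cs'} (e , l) (d , _) le F gs gs' p ev D | s≤s μ≤ =
    -- The raised second word is dominated by s_i v, hence by v, and `dem-raise` undoes the raising.
    At.dem-raise e l (At.cols-tr e l 0 cs' (All.map length≡ gs')) F d
      (Dem-mono (exts (Ecols e 0 cs')) (At.S-⊑ e l d) (transfer N μ≤ (At.S-flag e l F) (good-Ecols e l 0 gs) (good-Ecols e l 0 gs')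
        (subst₂ _↭_ (sym (sizes-Ecols e l 0 gs)) (sym (sizes-Ecols e l 0 gs')) p)
        (λ J → subst₂ (λ w w' → Bal (raises J w) (raises J w')) (reading-Ecols e l 0 gs) (reading-Ecols e l 0 gs') (ev ((e , l) ∷ J)))
        (At.dem-lower e l (At.cols-tr e l 0 cs (All.map length≡ gs)) F d D)))

  -- The first σ of the chain starts with rC and dominates the whole word. Transferred, it gives τ ⊑
  -- σ starting with the r-column of c'. If `μ` does not drop, σ and τ have the same prefix counts
  -- and the shorter prefix lies in the longer one. Otherwise τ is transferred back and takes the
  -- place of v.
  nested : ∀ N {v c c' cs cs'} → μ v ≤ N → Flag v → All Good (c ∷ cs) → All Good (c' ∷ cs') →
           sizes (c ∷ cs) ↭ sizes (c' ∷ cs') → reading (c ∷ cs) ≈ reading (c' ∷ cs') → size c ≤ size c' →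
           Dem v (exts (c ∷ cs)) → ∀ {q} → q ≤ m + m → cnt q (word 1 (rT c)) ≤ cnt q (word 1 (rT c'))
  nested N {v} {c} {c'} {cs} {cs'} le F gs gs' p ev s (σ , G , σ⊑v , eq , D) {q} q≤
    with transfer (μ σ) {cs = c ∷ cs} {c' ∷ cs'} ≤-refl G gs gs' p ev (σ , G , ⊑-refl {σ} , eq , D)
  ... | τ , H , τ⊑σ , eq' , D' with m≤n⇒m<n∨m≡n (μ-mono {τ} {σ} τ⊑σ)
  ... | inj₂ e = begin
        cnt q (word 1 (rT c))                         ≡⟨ sym (eq q) ⟩
        cnt q (take (length (word 1 (rT c))) σ)       ≤⟨ cnt-take-mono q σ x≤x' ⟩
        cnt q (take (length (word 1 (rT c'))) σ)      ≡⟨ sym (μ-≡ {τ} {σ} τ⊑σ e x'≤m q≤) ⟩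
        cnt q (take (length (word 1 (rT c'))) τ)      ≡⟨ eq' q ⟩
        cnt q (word 1 (rT c'))                        ∎
    where
    open ≤-Reasoning
    len-r : ∀ {c} → Good c → length (word 1 (rT c)) ≡ size c
    len-r {c} (good _ h) = trans (length-word 1 (rT c)) (resolve-size rRes c h)
    x≤x' : length (word 1 (rT c)) ≤ length (word 1 (rT c'))
    x≤x' = subst₂ _≤_ (sym (len-r (All.head gs))) (sym (len-r (All.head gs'))) s
    x'≤m : length (word 1 (rT c')) ≤ m
    x'≤m = ≤-trans (≤-reflexive (len-r (All.head gs'))) (size≤m (All.head gs'))
  nested zero {v} le F gs gs' p ev s (σ , G , σ⊑v , eq , D) q≤ | τ , H , τ⊑σ , eq' , D' | inj₁ lt =
    ⊥-elim (n≮0 (≤-trans lt (≤-trans (μ-mono {σ} {v} σ⊑v) le)))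
  nested (suc N) {v} {c} {c'} {cs} {cs'} le F gs gs' p ev s (σ , G , σ⊑v , eq , D) q≤ | τ , H , τ⊑σ , eq' , D' | inj₁ lt =
    nested N (≤-pred (≤-trans lt (≤-trans (μ-mono {σ} {v} σ⊑v) le))) H gs gs' p ev s
      (transfer (μ τ) {cs = c' ∷ cs'} {c ∷ cs} ≤-refl H gs' gs (↭-sym p) (λ J → sym (ev J)) (τ , H , ⊑-refl {τ} , eq' , D')) q≤

  -- From Knuth steps on letters to Knuth steps on codes.

  code : L → ℕ
  code (pos i) = i
  code (bar i) = conj i

  code-word : ∀ k c → map code (wordL k c) ≡ word k c
  code-word k [] = refl
  code-word k ((a , b) ∷ cs) = trans (map-++ code (optP a k) _) (cong₂ _++_ (oP a)
      (trans (map-++ code (wordL (suc k) cs) _) (cong₂ _++_ (code-word (suc k) cs) (oB b))))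
    where
    oP : ∀ a → map code (optP a k) ≡ opt a k
    oP true = refl
    oP false = refl
    oB : ∀ b → map code (optB b k) ≡ opt b (conj k)
    oB true = refl
    oB false = refl

  code-< : ∀ {x y} → ValidL m x → ValidL m y → x <ᴸ y → code x < code y
  code-< v w (pp l) = l
  code-< {pos i} {bar j} (_ , v) (_ , w) pb = ≤-trans (s≤s v) (conj-big w)
  code-< {bar i} {bar j} (_ , v) (_ , w) (bb l) = ∸-monoʳ-< l (≤-trans v (≤-trans (m≤m+n m m) (n≤1+n _)))

  code-≤ : ∀ {x y} → ValidL m x → ValidL m y → x ≤ᴸ y → code x ≤ code y
  code-≤ v w (inj₁ l) = <⇒≤ (code-< v w l)
  code-≤ v w (inj₂ refl) = ≤-refl

  notBar-code : ∀ {γ β} → ValidL m γ → ValidL m β → γ <ᴸ β → NotBarPair β γ → code β + code γ ≢ suc (m + m)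
  notBar-code {pos g} {pos b} (_ , v) (_ , w) _ nb e = <-irrefl (trans e refl) (s≤s (+-mono-≤ w v))
  notBar-code {pos g} {bar b} (_ , v) (_ , w) _ nb e = nb (b , refl , cong pos
    (+-cancelˡ-≡ (conj b) g b (trans e (sym (trans (+-comm (conj b) b) (conj-sum (≤-trans w (≤-trans (m≤m+n m m) (n≤1+n _)))))))))
  notBar-code {bar g} {bar b} (_ , v) (_ , w) _ nb e =
    1+n≰n (≤-trans (≤-reflexive (cong suc (sym (+-suc m m)))) (≤-trans (+-mono-≤ (conj-big w) (conj-big v)) (≤-reflexive e)))

  between : ∀ {y β} → suc y ≤ m → ValidL m β → pos y <ᴸ β → β <ᴸ bar y → y < code β × code β ≤ m + m ∸ y
  between {y} {pos b} l (_ , v) (pp lt) _ = lt , ≤-trans v (≤-trans (≤-reflexive (sym (m+n∸n≡m m m))) (∸-monoʳ-≤ (m + m) (≤-trans (n≤1+n y) l)))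
  between {y} {bar b} l (_ , v) _ (bb lt) = ≤-trans l (≤-trans (n≤1+n m) (conj-big v)) , ∸-monoʳ-≤ (suc (m + m)) lt

  conj-suc : ∀ {y} → suc y ≤ m → conj y ≡ suc (m + m ∸ y)
  conj-suc {y} l = +-∸-assoc 1 (≤-trans (≤-trans (n≤1+n y) l) (m≤m+n m m))

  kstep-KS : ∀ {n x y} → n ≤ m → ValidW m x → KStep n x y → KS (map code x) (map code y)
  kstep-KS n≤m (g ∷ b ∷ a ∷ []) (k1 γ<α α≤β nb) = ks1 (code-< g a γ<α) (code-≤ a b α≤β) (notBar-code g b (lt α≤β) nb)
    where
    lt : _ ≤ᴸ _ → _ <ᴸ _
    lt (inj₁ l) = <ᴸ-trans γ<α l
    lt (inj₂ refl) = γ<α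
  kstep-KS n≤m (a ∷ b ∷ g ∷ []) (k2 γ≤α α<β nb) = ks2 (code-≤ g a γ≤α) (code-< a b α<β) (notBar-code g b (lt γ≤α) nb)
    where
    lt : _ ≤ᴸ _ → _ <ᴸ _
    lt (inj₁ l) = <ᴸ-trans l α<β
    lt (inj₂ refl) = α<β
  kstep-KS n≤m (_ ∷ _ ∷ b ∷ []) (k3 {y} {β} _ y<n l u) =
    let l' , u' = between (≤-trans y<n n≤m) b l u in
    subst (λ z → KS (suc y ∷ m + m ∸ y ∷ code β ∷ []) (z ∷ y ∷ code β ∷ [])) (sym (conj-suc (≤-trans y<n n≤m)))
      (ks3 (m+[n∸m]≡n (≤-trans (≤-trans (n≤1+n y) (≤-trans y<n n≤m)) (m≤m+n m m))) l' u')
  kstep-KS n≤m (b ∷ _ ∷ _ ∷ []) (k4 {y} {β} _ y<n l u) =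
    let l' , u' = between (≤-trans y<n n≤m) b l u in
    subst (λ z → KS (code β ∷ z ∷ y ∷ []) (code β ∷ suc y ∷ m + m ∸ y ∷ [])) (sym (conj-suc (≤-trans y<n n≤m)))
      (ks4 (m+[n∸m]≡n (≤-trans (≤-trans (n≤1+n y) (≤-trans y<n n≤m)) (m≤m+n m m))) l' u')
  kstep-KS n≤m v (k5 {w} {z} s _ factors M@((_ , pz , bz , _) , _)) =
    subst₂ KS (trans (sym (code-word 1 c)) (cong (map code) w≡))
              (trans (sym (code-word 1 c')) (cong (map code) (trans e (cong (removeZ z) w≡))))
      (ks5 (hit-dropFirst H (admissible-adm admissible-tail)) (length-types 1 m w))
    where
    c = types m w
    w≡ : wordL 1 c ≡ w
    w≡ = types-word s v
    z-has : Has 1 c z (true , true)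
    z-has with pos⁻ {1} {c} (subst (pos z ∈_) (sym w≡) pz) | bar⁻ {1} {c} (subst (bar z ∈_) (sym w≡) bz)
    ... | b , h | a , h' = subst (λ t → Has 1 c z (true , t)) (cong proj₂ (has-unique h h')) h
    found = find-hit [] [] 0 z-has refl [] [] (subst (λ w → MinBadZ w z) (sym (trans (++-identityʳ _) w≡)) M)
    c' = proj₁ found
    H = proj₁ (proj₂ found)
    e = proj₂ (proj₂ found)
    dropped = wordL-dropFirst z-has
    w-cons : w ≡ (proj₁ dropped ∷ []) ++ wordL 1 (dropFirst c) ++ []
    w-cons = trans (sym w≡) (trans (proj₂ dropped) (cong (proj₁ dropped ∷_) (sym (++-identityʳ _))))
    admissible-tail : Admissible (wordL 1 (dropFirst c))
    admissible-tail = factors (proj₁ dropped ∷ []) (wordL 1 (dropFirst c)) [] w-cons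
      (≤-reflexive (sym (trans (cong length (sym w≡)) (cong length (proj₂ dropped)))))

  ctx-KC : ∀ {n w w'} → n ≤ m → ValidW m w → KCtx n w w' → KC (map code w) (map code w')
  ctx-KC n≤m V (ctx {x} {y} u v s) = subst₂ KC (sym (map-ctx x)) (sym (map-ctx y))
      (kc (map code u) (map code v) (fwd (kstep-KS n≤m (context-middle u v V) s)))
    where
    map-ctx : ∀ x → map code (u ++ x ++ v) ≡ map code u ++ map code x ++ map code v
    map-ctx x = trans (map-++ code u (x ++ v)) (cong (map code u ++_) (map-++ code x v))

  -- The reading of a KN tableau is dominated by some signed permutation.

  -- Appended to an extremal column, the bars of the absent values in decreasing order give the
  -- largest signed permutation among those starting with its least letters in increasing order.
  fill : ℕ → List Ty → List ℕ
  fill k [] = []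
  fill k ((false , false) ∷ cs) = conj k ∷ fill (suc k) cs
  fill k ((true , _) ∷ cs) = fill (suc k) cs
  fill k ((false , true) ∷ cs) = fill (suc k) cs

  empty : Ty → ℕ
  empty (false , false) = 1
  empty (true , _) = 0
  empty (false , true) = 0

  fill-bounds : ∀ k c → k + length c ≡ suc m → All (λ x → suc m ≤ x × x ≤ conj k) (fill k c)
  fill-bounds k [] eq = []
  fill-bounds k (t ∷ cs) eq with All.map (λ (l , u) → l , ≤-trans u (conj-down (n≤1+n k))) (fill-bounds (suc k) cs (shift {k} eq))
  fill-bounds k ((false , false) ∷ cs) eq | r = (conj-big (k≤m eq) , ≤-refl) ∷ r
  fill-bounds k ((true , _) ∷ cs) eq | r = r
  fill-bounds k ((false , true) ∷ cs) eq | r = r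

  cnt-fill-pos : ∀ {i} k c → k + length c ≡ suc m → i ≤ m → cnt i (fill k c) ≡ 0
  cnt-fill-pos k c eq l = cnt-outside (All.map (λ (lo , _) e → <⇒≱ lo (≤-trans (≤-reflexive (sym e)) l)) (fill-bounds k c eq))

  cnt-fill-conj : ∀ {k c i t} → Has k c i t → k + length c ≡ suc m → cnt (conj i) (fill k c) ≡ empty t
  cnt-fill-conj {k} {t ∷ cs} here eq = go t
    where
    rest : cnt (conj k) (fill (suc k) cs) ≡ 0
    rest = cnt-outside (All.map (λ (_ , u) e → <-irrefl (sym e) (≤-trans (s≤s u) (∸-monoʳ-< ≤-refl (s≤s (≤2m (k≤m eq))))))
      (fill-bounds (suc k) cs (shift {k} eq)))
    go : ∀ t → cnt (conj k) (fill k (t ∷ cs)) ≡ empty t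
    go (false , false) = cong₂ _+_ (is-refl (conj k)) rest
    go (true , _) = rest
    go (false , true) = rest
  cnt-fill-conj {k} {s ∷ cs} {i} (there h) eq = trans (go s) (cnt-fill-conj h (shift {k} eq))
    where
    i≤ : i ≤ m
    i≤ = ≤-pred (≤-trans (has-< h) (≤-reflexive (shift {k} eq)))
    go : ∀ s → cnt (conj i) (fill k (s ∷ cs)) ≡ cnt (conj i) (fill (suc k) cs)
    go (false , false) = cong (_+ cnt (conj i) (fill (suc k) cs)) (is-≢ (<⇒≢ (conj-< (has-≥ h) i≤)))
    go (true , _) = refl
    go (false , true) = refl

  flagOf : List Ty → List ℕ
  flagOf c = word 1 c ++ fill 1 c

  size-fill : ∀ k {c} → NoPairs c → size c + length (fill k c) ≡ length c
  size-fill k [] = refl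
  size-fill k {(true , true) ∷ c} (n ∷ ns) = ⊥-elim (n refl)
  size-fill k {(true , false) ∷ c} (n ∷ ns) = cong suc (size-fill (suc k) ns)
  size-fill k {(false , true) ∷ c} (n ∷ ns) = cong suc (size-fill (suc k) ns)
  size-fill k {(false , false) ∷ c} (n ∷ ns) = trans (+-suc _ _) (cong suc (size-fill (suc k) ns))

  conj-conj : ∀ {k} → k ≤ suc (m + m) → conj (conj k) ≡ k
  conj-conj = m∸[m∸n]≡n

  has-noPair : ∀ {k c i t} → NoPairs c → Has k c i t → t ≢ (true , true)
  has-noPair (n ∷ _) here = n
  has-noPair (_ ∷ ns) (there h) = has-noPair ns h

  flagOf-once : ∀ {c} → length c ≡ m → NoPairs c → ∀ k → 1 ≤ k → k ≤ m → cnt k (flagOf c) + cnt (conj k) (flagOf c) ≡ 1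
  flagOf-once {c} l np k l₁ l₂ with has-at {1} {c} {k} l₁ (≤-trans (s≤s l₂) (≤-reflexive (cong suc (sym l))))
  ... | (a , b) , h = trans (cong₂ _+_
        (trans (cnt-++ k (word 1 c) _) (cong₂ _+_ (cnt-word-pos h (cong suc l)) (cnt-fill-pos 1 c (cong suc l) l₂)))
        (trans (cnt-++ (conj k) (word 1 c) _) (cong₂ _+_ (cnt-word-conj h (cong suc l)) (cnt-fill-conj h (cong suc l)))))
        (total a b (has-noPair np h))
    where
    total : ∀ a b → (a , b) ≢ (true , true) → (bit a + 0) + (bit b + empty (a , b)) ≡ 1
    total true true n = ⊥-elim (n refl)
    total true false n = refl
    total false true n = refl
    total false false n = refl

  flagOf-flag : ∀ {c} → length c ≡ m → NoPairs c → Flag (flagOf c)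
  flagOf-flag {c} l np .len = trans (length-++ (word 1 c)) (trans (cong (_+ length (fill 1 c)) (length-word 1 c)) (trans (size-fill 1 np) l))
  flagOf-flag {c} l np .range = All-++⁺ (word-within 1 c (cong suc l))
    (All.map (λ (lo , u) → ≤-trans (s≤s z≤n) lo , u) (fill-bounds 1 c (cong suc l)))
  flagOf-flag {c} l np .once k (k≥1 , k≤2m) with k ≤? m
  ... | yes k≤m' = flagOf-once l np k k≥1 k≤m'
  ... | no k>m = trans (+-comm (cnt k (flagOf c)) _)
          (subst (λ x → cnt (conj k) (flagOf c) + cnt x (flagOf c) ≡ 1) (conj-conj (≤-trans k≤2m (n≤1+n _)))
            (flagOf-once l np (conj k) (m<n⇒0<n∸m (s≤s k≤2m)) (≤-trans (conj-down (≰⇒> k>m)) (≤-reflexive (m+n∸m≡n m m)))))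

  -- Of each pair j, conj j exactly one lies in a flag, so the letters ≥ conj j and the
  -- letters ≤ j are j altogether.
  flag-ge : ∀ {σ} → Flag σ → ∀ j → j ≤ m → ge (conj j) σ + m ≡ j + ge (suc j) σ
  flag-ge {σ} F zero _ = trans (cong (_+ m) (ge-none (All.map (λ (_ , u) → s≤s u) (F .range))))
    (sym (trans (ge-all (All.map proj₁ (F .range))) (F .len)))
  flag-ge {σ} F (suc j) l = begin
    ge (conj (suc j)) σ + m                       ≡⟨ cong (_+ m) (ge-suc (conj (suc j)) σ) ⟩
    ge (suc (conj (suc j))) σ + y + m             ≡⟨ cong (λ t → ge t σ + y + m) (sym (+-∸-assoc 1 (≤2m (≤-trans (n≤1+n j) l)))) ⟩
    ge (conj j) σ + y + m                         ≡⟨ r₁ (ge (conj j) σ) y m ⟩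
    ge (conj j) σ + m + y                         ≡⟨ cong (_+ y) (flag-ge F j (≤-trans (n≤1+n j) l)) ⟩
    j + ge (suc j) σ + y                          ≡⟨ cong (λ z → j + z + y) (ge-suc (suc j) σ) ⟩
    j + (ge (suc (suc j)) σ + x) + y              ≡⟨ r₂ j _ x y ⟩
    j + ge (suc (suc j)) σ + (x + y)              ≡⟨ cong (j + ge (suc (suc j)) σ +_) (F .once (suc j) (s≤s z≤n , ≤2m l)) ⟩
    j + ge (suc (suc j)) σ + 1                    ≡⟨ +-comm _ 1 ⟩
    suc j + ge (suc (suc j)) σ                    ∎
    where
    open ≡-Reasoning
    x = cnt (suc j) σ
    y = cnt (conj (suc j)) σ
    r₁ : ∀ a y m → a + y + m ≡ a + m + y
    r₁ = solve-∀
    r₂ : ∀ j a x y → j + (a + x) + y ≡ j + a + (x + y)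
    r₂ = solve-∀

  -- As `fill` decreases, a prefix of it either lies entirely at or above t or already contains
  -- every letter that does.
  fill-take : ∀ t u k c → k + length c ≡ suc m →
              ge t (take u (fill k c)) ≡ length (take u (fill k c)) ⊎ ge t (take u (fill k c)) ≡ ge t (fill k c)
  fill-take t zero k c eq = inj₁ refl
  fill-take t (suc u) k [] eq = inj₁ refl
  fill-take t (suc u) k ((true , _) ∷ cs) eq = fill-take t (suc u) (suc k) cs (shift {k} eq)
  fill-take t (suc u) k ((false , true) ∷ cs) eq = fill-take t (suc u) (suc k) cs (shift {k} eq)
  fill-take t (suc u) k ((false , false) ∷ cs) eq with t ≤? conj k
  ... | no l = inj₂ (cong (geb t (conj k) +_) (trans (ge-none (take-all u below)) (sym (ge-none below))))
    where
    below : All (_< t) (fill (suc k) cs)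
    below = All.map (λ (_ , h) → ≤-trans (s≤s (≤-trans h (conj-down (n≤1+n k)))) (≰⇒> l)) (fill-bounds (suc k) cs (shift {k} eq))
  ... | yes l with fill-take t u (suc k) cs (shift {k} eq)
  ... | inj₁ e = inj₁ (cong₂ _+_ (geb-1 l) e)
  ... | inj₂ e = inj₂ (cong (geb t (conj k) +_) e)

  -- A bound on the prefixes within the column extends to all prefixes. Where the part of `fill` in
  -- the prefix lies at or above t, counting letters is enough. Otherwise that part holds all
  -- letters of `fill` from t on, and whole permutations are compared: small thresholds by counting,
  -- large ones from these by `flag-ge`.
  module Complete {σ c} (F : Flag σ) (l : length c ≡ m) (np : NoPairs c)
      (below : ∀ ℓ t → ℓ ≤ size c → ge t (take ℓ σ) ≤ ge t (take ℓ (word 1 c))) where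
    private
      s : ℕ
      s = size c
      A : List ℕ
      A = fill 1 c
      |W| : length (word 1 c) ≡ s
      |W| = length-word 1 c

      lengths : ∀ u → length (take u (drop s σ)) ≡ length (take u A)
      lengths u = trans (length-take u (drop s σ)) (trans (cong (u ⊓_) (trans (length-drop s σ)
        (trans (cong (_∸ s) (trans (F .len) (trans (sym l) (sym (size-fill 1 np))))) (m+n∸m≡n s (length A))))) (sym (length-take u A)))

      head-bound : ∀ t → ge t (take s σ) ≤ ge t (word 1 c)
      head-bound t = ≤-trans (below s t ≤-refl) (ge-take t s (word 1 c))

      crude : ∀ t u → ge t (take u A) ≡ length (take u A) → ge t (take (s + u) σ) ≤ ge t (word 1 c) + ge t (take u A)
      crude t u e rewrite take-+ s u σ | ge-++ t (take s σ) (take u (drop s σ)) =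
        +-mono-≤ (head-bound t) (≤-trans (ge≤length t (take u (drop s σ))) (≤-reflexive (trans (lengths u) (sym e))))

      take-whole : ∀ (w : List ℕ) k → length w ≤ k → take k w ≡ w
      take-whole [] zero _ = refl
      take-whole [] (suc k) _ = refl
      take-whole (x ∷ w) (suc k) (s≤s l) = cong (x ∷_) (take-whole w k l)

      s+m : ∀ {w : List ℕ} → length w ≤ m → take (s + m) w ≡ w
      s+m {w} h = take-whole w (s + m) (≤-trans h (m≤n+m m s))

      small : ∀ t → t ≤ suc m → All (t ≤_) A
      small t h = All.map (λ (lo , _) → ≤-trans h lo) (fill-bounds 1 c (cong suc l))

      whole : ∀ t → t ≤ suc m → ge t σ ≤ ge t (flagOf c)
      whole t h = ≤-trans (≤-reflexive (cong (ge t) (sym (s+m (≤-reflexive (F .len))))))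
        (≤-trans (crude t m (ge-all (take-all m (small t h)))) (≤-trans (+-monoʳ-≤ _ (ge-take t m A)) (≤-reflexive (sym (ge-++ t (word 1 c) A)))))

      whole-big : ∀ j → j ≤ m → ge (conj j) σ ≤ ge (conj j) (flagOf c)
      whole-big j h = +-cancelʳ-≤ m _ _ (≤-trans (≤-reflexive (flag-ge F j h))
        (≤-trans (+-monoʳ-≤ j (whole (suc j) (s≤s h))) (≤-reflexive (sym (flag-ge (flagOf-flag l np) j h)))))

      beyond : ∀ t u → ge t (take (s + u) σ) ≤ ge t (word 1 c) + ge t (take u A)
      beyond t u with t ≤? suc m
      ... | yes h = crude t u (ge-all (take-all u (small t h)))
      ... | no h with t ≤? suc (m + m)
      ... | no h' = ≤-trans (≤-reflexive (ge-none (take-all (s + u) (All.map (λ (_ , hi) → ≤-trans (s≤s hi) (<⇒≤ (≰⇒> h'))) (F .range))))) z≤n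
      ... | yes h' with fill-take t u 1 c (cong suc l)
      ... | inj₁ e = crude t u e
      ... | inj₂ e = ≤-trans (ge-take t (s + u) σ) (≤-trans
            (subst (λ x → ge x σ ≤ ge x (flagOf c)) (conj-conj h')
              (whole-big (conj t) (≤-trans (conj-down (<⇒≤ (≰⇒> h))) (≤-reflexive (m+n∸m≡n m m)))))
            (≤-reflexive (trans (ge-++ t (word 1 c) A) (cong (ge t (word 1 c) +_) (sym e)))))

    complete : σ ⊑ flagOf c
    complete ℓ t with ≤-total ℓ s
    ... | inj₁ h = ≤-trans (below ℓ t h) (≤-reflexive (cong (ge t) (sym (take-++-≤ (word 1 c) A (≤-trans h (≤-reflexive (sym |W|)))))))
    ... | inj₂ h = subst (λ ℓ → ge t (take ℓ σ) ≤ ge t (take ℓ (flagOf c))) (m+[n∸m]≡n h)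
        (≤-trans (beyond t (ℓ ∸ s)) (≤-reflexive (trans (sym (ge-++ t (word 1 c) _)) (cong (ge t) (trans (sym (take-++-+ (word 1 c) A (ℓ ∸ s)))
          (cong (λ x → take (x + (ℓ ∸ s)) (flagOf c)) |W|))))))

  ge-rows : ∀ t ℓ (ys xs : Word) → ValidW m ys → ValidW m xs → length xs ≤ length ys →
            (∀ r a b → At ys r a → At xs r b → a ≤ᴸ b) → ge t (take ℓ (map code ys)) ≤ ge t (take ℓ (map code xs))
            ⊎ length xs < ℓ
  ge-rows t zero ys xs _ _ _ _ = inj₁ z≤n
  ge-rows t (suc ℓ) ys [] _ _ _ _ = inj₂ (s≤s z≤n)
  ge-rows t (suc ℓ) (y ∷ ys) (x ∷ xs) (v ∷ vs) (w ∷ ws) (s≤s l) R with ge-rows t ℓ ys xs vs ws l (λ r → R (suc r))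
  ... | inj₁ h = inj₁ (+-mono-≤ (geb-mono t (code-≤ v w (R 0 y x refl refl))) h)
  ... | inj₂ h = inj₂ (s≤s h)

  -- The rows control only prefixes up to the shorter column x; the maximality of `flagOf x` takes
  -- care of the longer ones.
  rows-⊑ : ∀ {x y} → length x ≡ m → NoPairs x → length y ≡ m → NoPairs y → size x ≤ size y →
           ValidW m (wordL 1 x) → ValidW m (wordL 1 y) →
           (∀ r a b → At (wordL 1 y) r a → At (wordL 1 x) r b → a ≤ᴸ b) → flagOf y ⊑ flagOf x
  rows-⊑ {x} {y} lx nx ly ny s vx vy R = Complete.complete (flagOf-flag ly ny) lx nx λ ℓ t h →
    ≤-trans (≤-reflexive (cong (ge t) (take-++-≤ (word 1 y) (fill 1 y) (≤-trans h (≤-trans s (≤-reflexive (sym (length-word 1 y))))))))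
      (subst₂ (λ u w → ge t (take ℓ u) ≤ ge t (take ℓ w)) (code-word 1 y) (code-word 1 x)
        ([ (λ e → e) , (λ e → ⊥-elim (<⇒≱ e (≤-trans h (≤-reflexive (sym (length-wordL 1 x)))))) ]′
          (ge-rows t ℓ (wordL 1 y) (wordL 1 x) vy vx (subst₂ _≤_ (sym (length-wordL 1 x)) (sym (length-wordL 1 y)) s) R)))

  take-flagOf : ∀ c → take (length (word 1 c)) (flagOf c) ≋ word 1 c
  take-flagOf c q = cong (cnt q) (trans (cong (λ k → take k (flagOf c)) (sym (+-identityʳ (length (word 1 c)))))
    (trans (take-++-+ (word 1 c) (fill 1 c) 0) (++-identityʳ (word 1 c))))

  ty : Word → List Ty
  ty = types m

  module _ {n} (n≤m : n ≤ m) {C} (ok : ColOK n C) where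
    ty-word : wordL 1 (ty C) ≡ C
    ty-word = types-word (ok .increasing) (valid-mono n≤m (ok .letters))

    ty-pending : pending (ty C) ≡ 0
    ty-pending = n≤0⇒n≡0 (pending-≤ (admissible-adm {ty C} (subst Admissible (sym ty-word) (ok .admissible))))

    ty-good : Good (ty C)
    ty-good = good (length-types 1 m C) ty-pending

    ty-size : size (ty C) ≡ length C
    ty-size = trans (sym (length-wordL 1 (ty C))) (cong length ty-word)

    rCol-ty : rCol C ≡ wordL 1 (rT (ty C))
    rCol-ty = trans (cong rCol (sym ty-word)) (Extremal.rCol-word (ty C) ty-pending (subst (StrictInc ∘ rCol) (sym ty-word) (ok .rStrict)))

    lCol-ty : lCol C ≡ wordL 1 (lT (ty C))
    lCol-ty = trans (cong lCol (sym ty-word)) (Extremal.lCol-word (ty C) ty-pending (subst (StrictInc ∘ lCol) (sym ty-word) (ok .lStrict)))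

    ty-resolve-size : ∀ {f} → Resolution f → size (resolve f (ty C)) ≡ length C
    ty-resolve-size R = trans (resolve-size R (ty C) ty-pending) ty-size

  ty-length : ∀ f C → length (resolve f (ty C)) ≡ m
  ty-length f C = trans (length-resolve f (ty C)) (length-types 1 m C)

  rows-flags : ∀ {x y X Y} → length x ≡ m → NoPairs x → length y ≡ m → NoPairs y → size x ≤ size y →
               X ≡ wordL 1 x → Y ≡ wordL 1 y → RowsOK (0 , Y) (0 , X) → flagOf y ⊑ flagOf x
  rows-flags {x} {y} lx nx ly ny s refl refl R = rows-⊑ lx nx ly ny s
    (subst (λ k → ValidW k (wordL 1 x)) lx (wordL-valid x)) (subst (λ k → ValidW k (wordL 1 y)) ly (wordL-valid y))
    λ r a b p q → R r a b z≤n z≤n p q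

  module _ {n} (n≤m : n ≤ m) where
    dem-column : ∀ {C} cs → ColOK n C → RowsOK (0 , lCol C) (0 , rCol C) →
                 Dem (flagOf (lT (ty C))) (exts cs) → Dem (flagOf (rT (ty C))) (exts (ty C ∷ cs))
    dem-column {C} cs ok R D =
      flagOf r , flagOf-flag (ty-length rTy C) (resolve-noPairs rRes (ty C)) , ⊑-refl {flagOf r} , take-flagOf r ,
      flagOf l , flagOf-flag (ty-length lTy C) (resolve-noPairs lRes (ty C)) ,
      rows-flags (ty-length rTy C) (resolve-noPairs rRes (ty C)) (ty-length lTy C) (resolve-noPairs lRes (ty C))
        (≤-reflexive (trans (ty-resolve-size n≤m ok rRes) (sym (ty-resolve-size n≤m ok lRes)))) (rCol-ty n≤m ok) (lCol-ty n≤m ok) R ,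
      take-flagOf l , D
      where
      r = rT (ty C)
      l = lT (ty C)

    -- Rows of the split tableau weakly increase to the right, so the permutations of its columns
    -- form a Bruhat chain, and the reading from right to left descends along it. The accumulator
    -- holds the columns already passed, in reading order.
    dem-chain : ∀ {c} ds acc → All (ColOK n) (c ∷ ds) → Linked RowsOK (split (asSkew (c ∷ ds))) →
                Linked (λ c d → length d ≤ length c) (c ∷ ds) → Dem (flagOf (rT (ty c))) (exts (map ty (c ∷ acc))) →
                Σ (List ℕ) λ v → Flag v × Dem v (exts (map ty (ds ʳ++ (c ∷ acc))))
    dem-chain {c} [] acc (o ∷ _) _ _ D = flagOf (rT (ty c)) , flagOf-flag (ty-length rTy c) (resolve-noPairs rRes (ty c)) , D
    dem-chain {c} (d ∷ ds) acc (o ∷ o' ∷ os) (_ ∷ r₂ ∷ r₃ ∷ rs) (l ∷ ls) D =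
      dem-chain ds (c ∷ acc) (o' ∷ os) (r₃ ∷ rs) ls
        (dem-column (map ty (c ∷ acc)) o' r₃ (Dem-mono (exts (map ty (c ∷ acc)))
          (rows-flags (ty-length lTy d) (resolve-noPairs lRes (ty d)) (ty-length rTy c) (resolve-noPairs rRes (ty c))
            (subst₂ _≤_ (sym (ty-resolve-size n≤m o' lRes)) (sym (ty-resolve-size n≤m o rRes)) l) (lCol-ty n≤m o') (rCol-ty n≤m o) r₂) D))

    dem-tableau : ∀ {T c ds} → T ≡ c ∷ ds → KNTab n T → Σ (List ℕ) λ v → Flag v × Dem v (exts (map ty (reverse T)))
    dem-tableau {c = c} {ds} refl ((_ , ls) , K@(_ , _ , _ , (_ , _ , rs@(r ∷ _)))) =
      dem-chain ds [] oks rs ls (dem-column [] (All.head oks) r tt)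
      where
      oks : All (ColOK n) (c ∷ ds)
      oks = subst (All (ColOK n)) (proj₂-asSkew (c ∷ ds)) (columns-ok (asSkew (c ∷ ds)) K)

    goods : ∀ {Cs} → All (ColOK n) Cs → All Good (map ty Cs)
    goods [] = []
    goods (o ∷ os) = ty-good n≤m o ∷ goods os

    reading-ty : ∀ {Cs} → All (ColOK n) Cs → reading (map ty Cs) ≡ map code (concat Cs)
    reading-ty [] = refl
    reading-ty {C ∷ Cs} (o ∷ os) = trans (cong₂ _++_ (trans (sym (code-word 1 (ty C))) (cong (map code) (ty-word n≤m o))) (reading-ty os))
      (sym (map-++ code C (concat Cs)))

    sizes-ty : ∀ {Cs} → All (ColOK n) Cs → sizes (map ty Cs) ≡ map length Cs
    sizes-ty [] = refl
    sizes-ty (o ∷ os) = cong₂ _∷_ (ty-size n≤m o) (sizes-ty os)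

  bit-true : ∀ a → 1 ≤ bit a → a ≡ true
  bit-true true _ = refl

  subset-extremal : ∀ {x x'} → length x ≡ m → length x' ≡ m →
    (∀ {q} → q ≤ m + m → cnt q (word 1 x) ≤ cnt q (word 1 x')) → ∀ {y} → y ∈ wordL 1 x → y ∈ wordL 1 x'
  subset-extremal {x} {x'} l l' le y∈ with letter⁻ {1} {x} y∈
  ... | inj₁ (i , b , refl , h) = let (a' , b') , h' = has-at {1} {x'} (has-≥ h) (≤-trans (has-< h) (≤-reflexive (cong suc (trans l (sym l'))))) in
        pos⁺ (subst (λ a → Has 1 x' i (a , b')) (bit-true a' (≤-trans (≤-reflexive (sym (cnt-word-pos h (cong suc l))))
          (≤-trans (le (≤-trans (i≤m h) (m≤m+n m m))) (≤-reflexive (cnt-word-pos h' (cong suc l')))))) h')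
    where
    i≤m : ∀ {i t} → Has 1 x i t → i ≤ m
    i≤m h = ≤-pred (≤-trans (has-< h) (≤-reflexive (cong suc l)))
  ... | inj₂ (i , a , refl , h) = let (a' , b') , h' = has-at {1} {x'} (has-≥ h) (≤-trans (has-< h) (≤-reflexive (cong suc (trans l (sym l'))))) in
        bar⁺ (subst (λ b → Has 1 x' i (a' , b)) (bit-true b' (≤-trans (≤-reflexive (sym (cnt-word-conj h (cong suc l))))
          (≤-trans (le (∸-monoʳ-≤ (suc (m + m)) (has-≥ h))) (≤-reflexive (cnt-word-conj h' (cong suc l')))))) h')

-- Knuth paths, and the comparison of two skew tableaux.

kctx-positive : ∀ {n w w'} → SymClosure (KCtx n) w w' → Positive w → Positive w'
kctx-positive (fwd (ctx u v s)) = in-context u v (kstep-positive s)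
kctx-positive (bwd (ctx u v s)) = in-context u v (kstep-positive⁻ s)

-- M bounds the letters on the path.
plactic-≈ : ∀ {n w w'} → w ∼[ n ] w' → Positive w →
  Σ ℕ λ M → ∀ m → M ≤ m → n ≤ m → Rank._≈_ m (map (Rank.code m) w) (map (Rank.code m) w')
plactic-≈ ε p = 0 , λ m _ _ J → refl
plactic-≈ {n} {w} (_◅_ {j = w₁} s path) p with plactic-≈ path (kctx-positive s p)
... | M , f = maxAbs w ⊔ maxAbs w₁ ⊔ M , λ m M≤ n≤ →
    Rank.≈-trans m {map (Rank.code m) w} {map (Rank.code m) w₁}
      (first m s (valid p (≤-trans (≤-trans (m≤m⊔n _ _) (m≤m⊔n _ M)) M≤))
        (valid (kctx-positive s p) (≤-trans (≤-trans (m≤n⊔m (maxAbs w) _) (m≤m⊔n _ M)) M≤)) n≤)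
      (f m (≤-trans (m≤n⊔m _ M) M≤) n≤)
  where
  first : ∀ m {w w₁} → SymClosure (KCtx n) w w₁ → ValidW m w → ValidW m w₁ → n ≤ m →
          Rank._≈_ m (map (Rank.code m) w) (map (Rank.code m) w₁)
  first m (fwd s) v v₁ n≤ = Rank.KC-≈ m (Rank.ctx-KC m n≤ v s)
  first m {w} {w₁} (bwd s) v v₁ n≤ = Rank.≈-sym m {map (Rank.code m) w₁} (Rank.KC-≈ m (Rank.ctx-KC m n≤ v₁ s))

columns : SkewTab → List Word
columns S = reverse (map proj₂ S)

lastCol-first : ∀ S → 1 ≤ length (lastCol S) → Σ (List Word) λ rest → columns S ≡ lastCol S ∷ rest
lastCol-first (c ∷ []) _ = [] , refl
lastCol-first (c ∷ d ∷ S) l = let rest , e = lastCol-first (d ∷ S) l in rest ++ proj₂ c ∷ [] ,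
  trans (unfold-reverse (proj₂ c) (map proj₂ (d ∷ S))) (cong (_++ proj₂ c ∷ []) e)

positive : ∀ {n w} → ValidW n w → Positive w
positive = All.map λ { {pos i} (l , _) → l ; {bar i} (l , _) → l }

module Compare {n T} (kT : KNTab n T) where
  okT : All (ColOK n) (reverse T)
  okT = All-resp-↭ (↭-sym (↭-reverse T)) (subst (All (ColOK n)) (proj₂-asSkew T) (columns-ok (asSkew T) (proj₂ kT)))

  module _ {S} (kS : KNSkew n S) (p : map (λ c → length (proj₂ c)) S ↭ map length T) (path : cr S ∼[ n ] crT T) where
    okS : All (ColOK n) (columns S)
    okS = All-resp-↭ (↭-sym (↭-reverse (map proj₂ S))) (columns-ok S kS)

    lengths-↭ : map length (columns S) ↭ map length (reverse T)
    lengths-↭ = ↭-trans (↭-map⁺ length (↭-reverse (map proj₂ S))) (↭-trans (↭-reflexive (sym (map-∘ S)))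
      (↭-trans p (↭-map⁺ length (↭-sym (↭-reverse T)))))

    bound-≈ : Σ ℕ λ M → ∀ m → M ≤ m → n ≤ m → Rank._≈_ m (map (Rank.code m) (cr S)) (map (Rank.code m) (crT T))
    bound-≈ = plactic-≈ path (positive (All-concat⁺ (All.map letters okS)))

  rCol-nested : ∀ {ℓ ℓ' S S'} → Admits n T ℓ S → Admits n T ℓ' S' → 1 ≤ ℓ → ℓ ≤ ℓ' →
                ∀ {x} → x ∈ rCol (lastCol S) → x ∈ rCol (lastCol S')
  rCol-nested {S = S} {S'} (kS , p , refl , _ , (_ , path)) (kS' , p' , refl , _ , (_ , path')) 1≤ℓ ℓ≤ {x} x∈
    with lastCol-first S 1≤ℓ | lastCol-first S' (≤-trans 1≤ℓ ℓ≤) | bound-≈ kS p path | bound-≈ kS' p' path'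
  ... | rest , e | rest' , e' | M , f | M' , f' =
      subst (x ∈_) (sym (rCol-ty n≤m ok')) (subset-extremal {rT (ty (lastCol S))} {rT (ty (lastCol S'))} (ty-length rTy (lastCol S)) (ty-length rTy (lastCol S'))
        counts (subst (x ∈_) (rCol-ty n≤m ok) x∈))
    where
    m : ℕ
    -- Large enough for [±n] and for every letter on either of the two Knuth paths.
    m = n ⊔ (M ⊔ M')
    n≤m : n ≤ m
    n≤m = m≤m⊔n n (M ⊔ M')
    open Rank m
    oks : All (ColOK n) (lastCol S ∷ rest)
    oks = subst (All (ColOK n)) e (okS kS p path)
    oks' : All (ColOK n) (lastCol S' ∷ rest')
    oks' = subst (All (ColOK n)) e' (okS kS' p' path')
    ok : ColOK n (lastCol S)
    ok = All.head oks
    ok' : ColOK n (lastCol S')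
    ok' = All.head oks'

    word-≈ : ∀ {Cs} → All (ColOK n) Cs → map code (concat Cs) ≈ map code (crT T) → reading (map ty Cs) ≈ reading (map ty (reverse T))
    word-≈ os h J = subst₂ (λ u v → Bal (raises J u) (raises J v)) (sym (reading-ty n≤m os)) (sym (reading-ty n≤m okT)) (h J)

    ≈S : reading (map ty (lastCol S ∷ rest)) ≈ reading (map ty (reverse T))
    ≈S = word-≈ oks (subst (λ Cs → map code (concat Cs) ≈ map code (crT T)) e
           (f m (≤-trans (m≤m⊔n M M') (m≤n⊔m n _)) n≤m))
    ≈S' : reading (map ty (lastCol S' ∷ rest')) ≈ reading (map ty (reverse T))
    ≈S' = word-≈ oks' (subst (λ Cs → map code (concat Cs) ≈ map code (crT T)) e'
           (f' m (≤-trans (m≤n⊔m M M') (m≤n⊔m n _)) n≤m))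

    sizes-↭ : ∀ {Cs} → All (ColOK n) Cs → map length Cs ↭ map length (reverse T) → sizes (map ty Cs) ↭ sizes (map ty (reverse T))
    sizes-↭ os q = subst₂ _↭_ (sym (sizes-ty n≤m os)) (sym (sizes-ty n≤m okT)) q

    ↭S : sizes (map ty (lastCol S ∷ rest)) ↭ sizes (map ty (reverse T))
    ↭S = sizes-↭ oks (subst (λ Cs → map length Cs ↭ map length (reverse T)) e (lengths-↭ kS p path))
    ↭S' : sizes (map ty (lastCol S' ∷ rest')) ↭ sizes (map ty (reverse T))
    ↭S' = sizes-↭ oks' (subst (λ Cs → map length Cs ↭ map length (reverse T)) e' (lengths-↭ kS' p' path'))

    nonempty : Σ Word λ c → Σ (List Word) λ ds → T ≡ c ∷ ds
    nonempty = go T (λ T≡ → ↭-absurd (subst (λ T → map length (lastCol S ∷ rest) ↭ map length (reverse T)) T≡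
        (subst (λ Cs → map length Cs ↭ map length (reverse T)) e (lengths-↭ kS p path))))
      where
      ↭-absurd : ∀ {x : ℕ} {xs} → x ∷ xs ↭ [] → ⊥
      ↭-absurd q = ¬x∷xs↭[] q
      go : ∀ T' → (T' ≡ [] → ⊥) → Σ Word λ c → Σ (List Word) λ ds → T' ≡ c ∷ ds
      go [] n = ⊥-elim (n refl)
      go (c ∷ ds) _ = c , ds , refl

    counts : ∀ {q} → q ≤ m + m → cnt q (word 1 (rT (ty (lastCol S)))) ≤ cnt q (word 1 (rT (ty (lastCol S'))))
    -- The tableau T provides a dominating permutation; it is first transferred to the reading of S,
    -- and only then are S and S' compared.
    counts = let _ , _ , T≡ = nonempty
                 v , F , D = dem-tableau n≤m T≡ kT in
      nested (μ v) {v} {cs = map ty rest} {map ty rest'} ≤-refl F (goods n≤m oks) (goods n≤m oks') (↭-trans ↭S (↭-sym ↭S'))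
        (≈-trans {reading (map ty (lastCol S ∷ rest))} {reading (map ty (reverse T))} ≈S (λ J → sym (≈S' J)))
        (subst₂ _≤_ (sym (ty-size n≤m ok)) (sym (ty-size n≤m ok')) ℓ≤)
        (transfer (μ v) {v} {map ty (reverse T)} {map ty (lastCol S ∷ rest)} ≤-refl F (goods n≤m okT) (goods n≤m oks) (↭-sym ↭S) (λ J → sym (≈S J)) D)

-- Tableaux of nested extremal columns, and the theorem.

record KeyColumn (n : ℕ) (k : Word) : Set where
  constructor keyColumn
  field
    {shape} : List Ty
    shape-length : length shape ≡ n
    extremal : NoPairs shape
    is-word : k ≡ wordL 1 shape

key-column : ∀ {n C} → ColOK n C → KeyColumn n (rCol C)
key-column {n} {C} ok = keyColumn (Rank.ty-length n rTy C) (resolve-noPairs rRes (types n C)) (Rank.rCol-ty n ≤-refl ok)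

key-letters : ∀ {n k} → KeyColumn n k → ValidW n k
key-letters (keyColumn {c} refl _ refl) = wordL-valid c

key-sorted : ∀ {n k} → KeyColumn n k → Sorted k
key-sorted (keyColumn {c} _ _ refl) = wordL-sorted 1 c

key-pairs : ∀ {n k i} → KeyColumn n k → pos i ∈ k → bar i ∈ k → ⊥
key-pairs (keyColumn {c} _ np refl) p b with pos⁻ {1} {c} p | bar⁻ {1} {c} b
... | _ , h | _ , h' with has-unique h h'
... | refl = noPair np h
  where
  noPair : ∀ {k c i} → NoPairs c → Has k c i (true , true) → ⊥
  noPair (n ∷ _) here = n refl
  noPair (_ ∷ ns) (there h) = noPair ns h

key-rCol : ∀ {n k} → KeyColumn n k → rCol k ≡ k
key-rCol (keyColumn _ np refl) = rCol-extremal np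

key-lCol : ∀ {n k} → KeyColumn n k → lCol k ≡ k
key-lCol (keyColumn _ np refl) = lCol-extremal np

at-∈ : ∀ {w r x} → At w r x → x ∈ w
at-∈ {_ ∷ _} {zero} refl = here refl
at-∈ {_ ∷ _} {suc r} p = there (at-∈ p)

at-unique : ∀ {w r x y} → At w r x → At w r y → x ≡ y
at-unique {_ ∷ _} {zero} refl refl = refl
at-unique {_ ∷ w} {suc r} p q = at-unique {w} {r} p q

key-admissible : ∀ {n k} → KeyColumn n k → Admissible k
key-admissible K = AllPairs⇒Linked (key-sorted K) , λ i a b p q → ⊥-elim (key-pairs K (at-∈ p) (at-∈ q))

rows-refl : ∀ {k} → RowsOK (0 , k) (0 , k)
rows-refl {k} r x y _ _ p q = inj₂ (at-unique {k} {r} p q)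

rows-⊆ : ∀ {c d} → Sorted c → Sorted d → (∀ {x} → x ∈ d → x ∈ c) → RowsOK (0 , c) (0 , d)
rows-⊆ sc sd f r x y _ _ p q = go r sc sd f p q
  where
  go : ∀ {c d x y} r → Sorted c → Sorted d → (∀ {x} → x ∈ d → x ∈ c) → At c r x → At d r y → x ≤ᴸ y
  go {_ ∷ _} {_ ∷ _} zero (lc ∷ _) _ f refl refl with f (here refl)
  ... | here e = inj₂ (sym e)
  ... | there y∈ = inj₁ (All.lookup lc y∈)
  go {a ∷ c} {b ∷ d} (suc r) (lc ∷ sc) (ld ∷ sd) f p q = go r sc sd tail p q
    where
    tail : ∀ {z} → z ∈ d → z ∈ c
    tail z∈ with f (there z∈)
    ... | there r = r
    ... | here refl with f (here refl)
    ... | here refl = ⊥-elim (<ᴸ-irrefl (All.lookup ld z∈))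
    ... | there b∈ = ⊥-elim (<ᴸ-irrefl (<ᴸ-trans (All.lookup lc b∈) (All.lookup ld z∈)))

doubled : Tab → SkewTab
doubled [] = []
doubled (k ∷ K) = (0 , k) ∷ (0 , k) ∷ doubled K

split-extremal : ∀ {K} → All (λ k → lCol k ≡ k × rCol k ≡ k) K → split (asSkew K) ≡ doubled K
split-extremal [] = refl
split-extremal {k ∷ K} ((l , r) ∷ es) = cong₂ _∷_ (cong (0 ,_) l) (cong₂ _∷_ (cong (0 ,_) r) (split-extremal es))

doubled-all : ∀ {P : ℕ × Word → Set} {K} → All (λ k → P (0 , k)) K → All P (doubled K)
doubled-all [] = []
doubled-all (p ∷ ps) = p ∷ p ∷ doubled-all ps

doubled-linked : ∀ {R : ℕ × Word → ℕ × Word → Set} {K} → (∀ {k} → R (0 , k) (0 , k)) →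
                 Linked (λ c d → R (0 , c) (0 , d)) K → Linked R (doubled K)
doubled-linked rf [] = []
doubled-linked rf [-] = rf ∷ [-]
doubled-linked {K = _ ∷ _ ∷ _} rf (r ∷ rs) = rf ∷ r ∷ doubled-linked rf rs

-- Extremal columns are fixed by ℓ and r, so splitting only doubles each column, and weak increase
-- along rows follows from the inclusions.
key-tableau : ∀ {n K} → All (λ k → 1 ≤ length k) K → All (KeyColumn n) K →
              Linked (λ c d → length d ≤ length c × (∀ {x} → x ∈ d → x ∈ c)) K → KNTab n K
key-tableau {n} {K} ne keys ls =
  (ne , Linked.map proj₁ ls) ,
  subst (λ cs → All (ValidL n) (concat cs)) (sym (proj₂-asSkew K)) (All-concat⁺ (All.map key-letters keys)) ,
  ((All-map⁺ ne , Linked-map⁺ (Linked.map (λ (l , _) → z≤n , l) ls)) ,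
   All-map⁺ (All.map (AllPairs⇒Linked ∘ key-sorted) keys) , Linked-map⁺ rows) ,
  All-map⁺ (All.map key-admissible keys) ,
  subst SemiStd (sym (split-extremal (All.map (λ k → key-lCol k , key-rCol k) keys)))
    ((doubled-all ne , doubled-linked (z≤n , ≤-refl) (Linked.map (λ (l , _) → z≤n , l) ls)) ,
     doubled-all (All.map (AllPairs⇒Linked ∘ key-sorted) keys) , doubled-linked (λ {k} → rows-refl {k}) rows)
  where
  with-all : ∀ {K R} → All (KeyColumn n) K → Linked R K → Linked (λ c d → KeyColumn n c × KeyColumn n d × R c d) K
  with-all [] [] = []
  with-all (_ ∷ []) [-] = [-]
  with-all (k ∷ k' ∷ ks) (r ∷ rs) = (k , k' , r) ∷ with-all (k' ∷ ks) rs

  rows : Linked (λ c d → RowsOK (0 , c) (0 , d)) K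
  rows = Linked.map (λ (k , k' , _ , f) → rows-⊆ (key-sorted k) (key-sorted k') f) (with-all keys ls)

theorem4p7 : (n : ℕ) → 1 ≤ n → (T : Tab) → KNTab n T →
    (S : ℕ → SkewTab) → (∀ ℓ → ℓ ∈ map length T → Admits n T ℓ (S ℓ)) →
    KeyTableau n (Kplus T S)
theorem4p7 n _ T kT S admits =
  key-tableau (All-map⁺ (All.tabulate nonempty)) (All-map⁺ (All.tabulate keys)) (Linked-map⁺ adjacent) ,
  Linked-map⁺ (Linked.map (λ (_ , f) _ → f) adjacent) ,
  noPair
  where
  k : Word → Word
  k c = rCol (lastCol (S (length c)))

  at : ∀ {c} → c ∈ T → Admits n T (length c) (S (length c))
  at c∈ = admits _ (∈-map⁺ length c∈)

  1≤ : ∀ {c} → c ∈ T → 1 ≤ length c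
  1≤ = All.lookup (proj₁ (proj₁ kT))

  column-ok : ∀ {c} → c ∈ T → ColOK n (lastCol (S (length c)))
  column-ok {c} c∈ = let kS , p , l , _ , (_ , path) = at c∈
                         rest , e = lastCol-first (S (length c)) (≤-trans (1≤ c∈) (≤-reflexive (sym l))) in
    All.head (subst (All (ColOK n)) e (Compare.okS kT kS p path))

  length-k : ∀ {c} → c ∈ T → length (k c) ≡ length c
  length-k {c} c∈ = trans (trans (length-sortᴸ (map (replBar _) (lastCol (S (length c))))) (length-map _ (lastCol (S (length c)))))
    (proj₁ (proj₂ (proj₂ (at c∈))))

  nonempty : ∀ {c} → c ∈ T → 1 ≤ length (k c)
  nonempty c∈ = ≤-trans (1≤ c∈) (≤-reflexive (sym (length-k c∈)))

  keys : ∀ {c} → c ∈ T → KeyColumn n (k c)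
  keys c∈ = key-column (column-ok c∈)

  nested-k : ∀ {c d} → c ∈ T → d ∈ T → length d ≤ length c → ∀ {x} → x ∈ k d → x ∈ k c
  nested-k c∈ d∈ l = Compare.rCol-nested kT (at d∈) (at c∈) (1≤ d∈) l

  adjacent : Linked (λ c d → length (k d) ≤ length (k c) × (∀ {x} → x ∈ k d → x ∈ k c)) T
  adjacent = go (λ c∈ → c∈) (proj₂ (proj₁ kT))
    where
    go : ∀ {U} → (∀ {c} → c ∈ U → c ∈ T) → Linked (λ c d → length d ≤ length c) U →
         Linked (λ c d → length (k d) ≤ length (k c) × (∀ {x} → x ∈ k d → x ∈ k c)) U
    go f [] = []
    go f [-] = [-]
    go f (l ∷ ls) = (subst₂ _≤_ (sym (length-k (f (there (here refl))))) (sym (length-k (f (here refl)))) l ,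
      nested-k (f (here refl)) (f (there (here refl))) l) ∷ go (f ∘ there) ls

  noPair : ∀ i → pos i ∈ concat (Kplus T S) → bar i ∈ concat (Kplus T S) → ⊥
  -- The longer of the two columns contains both letters, and a single extremal column has no pair.
  noPair i p b with ∈-concat⁻′ (Kplus T S) p | ∈-concat⁻′ (Kplus T S) b
  ... | _ , p∈ , c∈ | _ , b∈ , d∈ with ∈-map⁻ k c∈ | ∈-map⁻ k d∈
  ... | c , c∈T , refl | d , d∈T , refl with ≤-total (length c) (length d)
  ... | inj₁ l = key-pairs (keys d∈T) (nested-k d∈T c∈T l p∈) b∈
  ... | inj₂ l = key-pairs (keys c∈T) p∈ (nested-k c∈T d∈T l b∈)
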